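{- Let $G$ be a simple graph on $n\geq 2$ vertices. Then $$\Big\lceil\frac{|E(G)|}{2n-2}\Big\rceil \leq \theta(G\times K_2)\leq \Big\lceil\frac{n}{4}\Big\rceil.$$
   Context: The thickness $\theta(G)$ of a graph $G$ is the minimum number of planar subgraphs whose union is $G$. The Kronecker product $G\times H$ of graphs $G$ and $H$ has vertex set $V(G)\times V(H)$, with $(g,h)$ adjacent to $(g',h')$ if and only if $gg'\in E(G)$ and $hh'\in E(H)$.
   Formalization: Planarity of the subgraphs in the thickness is defined by polygonal drawings whose vertices and bend points have rational coordinates, rather than by drawings in the real plane; a small perturbation of a real polygonal drawing shows that the two notions agree. -}

module Defs where

open import Data.Bool using (Bool; true; false; not; _∧_; if_then_else_)
open import Data.Nat as ℕ using (ℕ; zero; suc; _<ᵇ_)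
open import Data.Nat.DivMod using (_/_)
open import Data.Fin using (Fin; zero; suc; toℕ; fromℕ; inject₁; remQuot)
open import Data.List using (List; map; allFin)
open import Data.Nat.ListAction using (sum)
open import Data.Product using (Σ; ∃; _×_; _,_)
open import Data.Sum using (_⊎_)
open import Data.Rational using (ℚ; 0ℚ; 1ℚ; _+_; _*_; _-_; _≤_)
open import Relation.Binary.PropositionalEquality using (_≡_)

Graph : ℕ → Set
Graph n = Fin n → Fin n → Bool

record IsSimple {n : ℕ} (G : Graph n) : Set where
  field
    sym     : ∀ u v → G u v ≡ G v u
    irrefl  : ∀ u → G u u ≡ false

numEdges : ∀ {n} → Graph n → ℕ
numEdges {n} G =
  sum (map (λ u → sum (map (λ v → if (toℕ u <ᵇ toℕ v) ∧ G u v then 1 else 0)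
                           (allFin n)))
           (allFin n))

K : (m : ℕ) → Graph m
K m u v = not (toℕ u ℕ.≡ᵇ toℕ v)

-- Kronecker (tensor) product; vertex (g , h) is the index  combine g h,
-- i.e. V(G × H) = Fin (n * m) ≅ Fin n × Fin m via remQuot.
_×ₖ_ : ∀ {n m} → Graph n → Graph m → Graph (n ℕ.* m)
_×ₖ_ {n} {m} G H x y with remQuot {n} m x | remQuot {n} m y
... | g , h | g' , h' = G g g' ∧ H h h'

-- ceiling division  ⌈ a / b ⌉  (b > 0; value 0 for b = 0, never used)
⌈_/_⌉ : ℕ → ℕ → ℕ
⌈ a / zero ⌉  = 0
⌈ a / suc b ⌉ = (a ℕ.+ b) / suc b

-- Planarity (Diestel-style: drawings with polygonal arcs).
-- Points of the plane with rational coordinates.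

Point : Set
Point = ℚ × ℚ

OnSeg : Point → Point → Point → Set
OnSeg (p₁ , p₂) (q₁ , q₂) (r₁ , r₂) =
  Σ ℚ λ t → (0ℚ ≤ t) × (t ≤ 1ℚ) ×
    (r₁ ≡ p₁ + t * (q₁ - p₁)) × (r₂ ≡ p₂ + t * (q₂ - p₂))

record PolyArc (a b : Point) : Set where
  field
    k     : ℕ
    pt    : Fin (suc (suc k)) → Point
    start : pt zero ≡ a
    end   : pt (fromℕ (suc k)) ≡ b
    simple : ∀ (i j : Fin (suc k)) (r : Point) → toℕ i ℕ.< toℕ j →
             OnSeg (pt (inject₁ i)) (pt (suc i)) r →
             OnSeg (pt (inject₁ j)) (pt (suc j)) r →
             (toℕ j ≡ suc (toℕ i)) × (r ≡ pt (suc i))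

OnArc : ∀ {a b} → PolyArc a b → Point → Set
OnArc A r = ∃ λ i → OnSeg (pt (inject₁ i)) (pt (suc i)) r
  where open PolyArc A

record PlaneDrawing {m : ℕ} (H : Graph m) : Set where
  field
    pos     : Fin m → Point
    pos-inj : ∀ u v → pos u ≡ pos v → u ≡ v
    arc     : ∀ u v → toℕ u ℕ.< toℕ v → H u v ≡ true → PolyArc (pos u) (pos v)
    avoid-vertices : ∀ u v (p : toℕ u ℕ.< toℕ v) (e : H u v ≡ true) w →
                     OnArc (arc u v p e) (pos w) → (w ≡ u) ⊎ (w ≡ v)
    avoid-arcs : ∀ u v (p : toℕ u ℕ.< toℕ v) (e : H u v ≡ true)
                   u' v' (p' : toℕ u' ℕ.< toℕ v') (e' : H u' v' ≡ true) r →
                 OnArc (arc u v p e) r → OnArc (arc u' v' p' e') r →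
                 ((u ≡ u') × (v ≡ v')) ⊎ ((r ≡ pos u) ⊎ (r ≡ pos v))

Planar : ∀ {m} → Graph m → Set
Planar H = PlaneDrawing H

-- Thickness.  G is the union of k planar (simple) subgraphs H₀ … H_{k-1}.
-- θ(G) ≤ k  ⇔  Decomposition k G  (Decomposition is monotone in k,
-- since the empty graph is planar), and  L ≤ θ(G)  ⇔  every decomposition
-- into k planar subgraphs has L ≤ k.

Decomposition : ∀ {m} → ℕ → Graph m → Set
Decomposition {m} k G =
  Σ (Fin k → Graph m) λ H →
    (∀ c → IsSimple (H c)) ×
    (∀ c → Planar (H c)) ×
    (∀ c u v → H c u v ≡ true → G u v ≡ true) ×
    (∀ u v → G u v ≡ true → ∃ λ c → H c u v ≡ true)

{-# OPTIONS --safe #-}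
module Submission where

-- Lower bound.  A bipartite plane graph on v ≥ 3 vertices has at most 2v − 4 edges.  Instead of the Jordan
-- curve theorem, use the cycle space over 𝔽₂.  After a shear no segment of the drawing is vertical, and a
-- point off the drawing defines a functional on cycles: the parity of the cycle above that point.  Call the
-- functionals on the two sides of edges whose sides differ faces.  The two sides of e differ by the coordinate
-- of e, so a cycle on which all faces agree is zero, and counting equations gives e ≤ (v − 1) + (f − 1).
-- Sweeping along a segment and turning around a corner do not change the functional, so the edges with
-- exactly one side in a given face form an even, nonempty set, which has at least 4 edges since the graph
-- is bipartite; hence 4f ≤ 2e.  Finally G × K₂ has 2|E(G)| edges and 2n vertices.
--
-- Upper bound.  Split the vertices into groups of four.  Layer c contains the cube spanned by group c;
-- every other vertex is joined to two opposite corners of one of the four faces in a belt of the cube.  The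
-- faces are chosen so that an edge between two groups lies in the layer of exactly one of them.

open import Defs
open import Algebra.Bundles using (CommutativeRing)
open import Algebra.Structures using (IsCommutativeMonoid)
open import Data.Bool using (Bool; true; false; not; _∧_; _xor_; if_then_else_)
open import Data.Bool.Properties as 𝔹 using (xor-same; xor-identityʳ; xor-comm; xor-assoc; ∧-distribˡ-xor; ∧-distribʳ-xor; ∧-zeroʳ; ∧-identityʳ; ∧-assoc; ∧-comm)
open import Data.Empty using (⊥; ⊥-elim)
open import Data.Fin as Fin using (Fin; zero; suc; toℕ; fromℕ; fromℕ<; inject₁; punchIn; punchOut; remQuot; combine)
open import Data.Fin.Patterns using (0F; 1F; 2F; 3F)
open import Data.Fin.Properties as Fin using (toℕ-inject₁; toℕ-injective; toℕ-fromℕ; toℕ-fromℕ<; toℕ<n; toℕ≤pred[n]; fromℕ≢inject₁; punchIn-punchOut; remQuot-combine; combine-remQuot)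
open import Data.Fin.Relation.Unary.Top using (View; view; ‵fromℕ; ‵inject₁)
open import Data.Fin.Subset.Properties using (anySubset?)
import Data.Integer as ℤ
open import Data.List as List using (List; []; _∷_; _++_; map; concatMap; filter; length; allFin; cartesianProduct)
open import Data.List.Membership.Propositional using (_∈_; find)
open import Data.List.Membership.Propositional.Properties using (∈-lookup; ∈-allFin; ∈-filter⁺; ∈-filter⁻; ∈-map⁺; ∈-map⁻; ∈-++⁺ˡ; ∈-++⁺ʳ; ∈-++⁻; ∈-concat⁺′)
open import Data.List.Properties using (map-tabulate; length-map; length-++; length-tabulate)
open import Data.List.Relation.Binary.Disjoint.Propositional using (Disjoint)
open import Data.List.Relation.Binary.Permutation.Propositional as Perm using (_↭_; ↭-refl; ↭-prep; ↭-swap; ↭-trans)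
open import Data.List.Relation.Binary.Permutation.Propositional.Properties using (All-resp-↭)
open import Data.List.Relation.Unary.All as All using (All; []; _∷_)
open import Data.List.Relation.Unary.All.Properties as All using ()
open import Data.List.Relation.Unary.AllPairs as AllPairs using (AllPairs; []; _∷_)
open import Data.List.Relation.Unary.AllPairs.Properties as AllPairs using ()
open import Data.List.Relation.Unary.Any as Any using (here; there)
open import Data.List.Relation.Unary.Any.Properties using (lookup-index)
open import Data.List.Relation.Unary.Unique.Propositional using (Unique)
open import Data.List.Relation.Unary.Unique.Propositional.Properties as Unique using ()
open import Data.Nat as ℕ using (ℕ; zero; suc; s≤s; z≤n; _<ᵇ_)
open import Data.Nat.Coprimality using (1-coprimeTo)
open import Data.Nat.DivMod using (_/_; _%_; m≡m%n+[m/n]*n; m%n<n; m<n*o⇒m/o<n)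
open import Data.Nat.ListAction using (sum)
open import Data.Nat.Properties as ℕ using ()
open import Data.Nat.Tactic.RingSolver using () renaming (solve-∀ to solveℕ-∀)
open import Data.Product using (Σ; ∃; _×_; _,_; proj₁; proj₂; swap)
open import Data.Product.Properties using (≡-dec)
open import Data.Rational as ℚ using (ℚ; 0ℚ; 1ℚ; mkℚ; Positive)
open import Data.Rational.Properties as ℚ using ()
open import Data.Sum using (_⊎_; inj₁; inj₂) renaming (swap to swap⊎; map to map⊎)
open import Data.Vec using (Vec; lookup; tabulate)
open import Data.Vec.Properties using (lookup∘tabulate)
open import Function using (_∘_; id)
open import Level using (0ℓ)
open import Relation.Binary using (tri<; tri≈; tri>; DecidableEquality)
open import Relation.Binary.PropositionalEquality using (_≡_; _≢_; refl; cong; cong₂; subst; subst₂; module ≡-Reasoning) renaming (sym to ≡-sym; trans to ≡-trans)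
open import Relation.Nullary using (¬_; Dec; yes; no; does; ¬?)
open import Relation.Nullary.Decidable using (dec-true; dec-false; dec⇒maybe; decidable-stable; from-yes; _×-dec_; _⊎-dec_; _→-dec_)
open import Tactic.RingSolver using (solve-∀)
open import Tactic.RingSolver.Core.AlmostCommutativeRing using (AlmostCommutativeRing; fromCommutativeRing)

-- Euler's formula enters as a statement about ranks: the parity equations of all vertices but one,
-- together with the differences of the faces from one fixed face, have only the zero solution. In
-- this form disconnected drawings cause no extra case. A bridge lies on no cycle, so both its sides
-- carry the same functional; taking faces only from the other edges makes every face boundary
-- nonempty. The obstacle is that membership in a face is not linear in the functional, so the
-- evenness of a face boundary cannot be had by exchanging sums. Around a point the segments are
-- therefore sorted by slope, and the changes of membership telescope. The number four comes from
-- the lower bound. For complete `G` the product has n(n - 1) edges, and a bipartite planar graph on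
-- 2n vertices has at most 4(n - 1), so n/4 layers leave no slack. A cube has 12 edges, and two
-- edges for each of the other 2n - 8 vertices give 4(n - 1) in total. Such a vertex sees only half
-- of the four corners on the opposite side, so the two layers available to an edge between groups
-- have to complement each other.

-- Finite sums in a commutative monoid, and parity sums.

module ListSum {C : Set} {_∙_ : C → C → C} {ε : C} (isCM : IsCommutativeMonoid _≡_ _∙_ ε) where
  open IsCommutativeMonoid isCM using (assoc; comm; identityˡ; identityʳ)
  open ≡-Reasoning

  ∑ : {A : Set} → List A → (A → C) → C
  ∑ []       f = ε
  ∑ (x ∷ xs) f = f x ∙ ∑ xs f

  module _ {A : Set} where

    ∑-cong∈ : ∀ xs {f g : A → C} → (∀ {x} → x ∈ xs → f x ≡ g x) → ∑ xs f ≡ ∑ xs g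
    ∑-cong∈ []       h = refl
    ∑-cong∈ (x ∷ xs) h = cong₂ _∙_ (h (here refl)) (∑-cong∈ xs (h ∘ there))

    ∑-cong : ∀ xs {f g : A → C} → (∀ x → f x ≡ g x) → ∑ xs f ≡ ∑ xs g
    ∑-cong xs h = ∑-cong∈ xs (λ {x} _ → h x)

    ∑-const-ε : ∀ (xs : List A) → ∑ xs (λ _ → ε) ≡ ε
    ∑-const-ε []       = refl
    ∑-const-ε (x ∷ xs) = ≡-trans (identityˡ _) (∑-const-ε xs)

    ∑-ε : ∀ xs {f : A → C} → (∀ {x} → x ∈ xs → f x ≡ ε) → ∑ xs f ≡ ε
    ∑-ε xs h = ≡-trans (∑-cong∈ xs h) (∑-const-ε xs)

    interchange : ∀ a b c d → ((a ∙ b) ∙ (c ∙ d)) ≡ ((a ∙ c) ∙ (b ∙ d))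
    interchange a b c d = begin
      (a ∙ b) ∙ (c ∙ d) ≡⟨ assoc a b _ ⟩
      a ∙ (b ∙ (c ∙ d)) ≡⟨ cong (a ∙_) (assoc b c d) ⟨
      a ∙ ((b ∙ c) ∙ d) ≡⟨ cong (λ u → a ∙ (u ∙ d)) (comm b c) ⟩
      a ∙ ((c ∙ b) ∙ d) ≡⟨ cong (a ∙_) (assoc c b d) ⟩
      a ∙ (c ∙ (b ∙ d)) ≡⟨ assoc a c _ ⟨
      (a ∙ c) ∙ (b ∙ d) ∎

    ∑-∙ : ∀ xs (f g : A → C) → ∑ xs (λ x → f x ∙ g x) ≡ (∑ xs f ∙ ∑ xs g)
    ∑-∙ []       f g = ≡-sym (identityˡ ε)
    ∑-∙ (x ∷ xs) f g = ≡-trans (cong ((f x ∙ g x) ∙_) (∑-∙ xs f g)) (interchange _ _ _ _)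

    ∑-↭ : ∀ {xs ys} (f : A → C) → xs ↭ ys → ∑ xs f ≡ ∑ ys f
    ∑-↭ f Perm.refl        = refl
    ∑-↭ f (Perm.prep x p)  = cong (f x ∙_) (∑-↭ f p)
    ∑-↭ {xs = x ∷ y ∷ xs} {ys = _ ∷ _ ∷ ys} f (Perm.swap _ _ p) = begin
      f x ∙ (f y ∙ ∑ xs f) ≡⟨ assoc _ _ _ ⟨
      (f x ∙ f y) ∙ ∑ xs f ≡⟨ cong₂ _∙_ (comm (f x) (f y)) (∑-↭ f p) ⟩
      (f y ∙ f x) ∙ ∑ ys f ≡⟨ assoc _ _ _ ⟩
      f y ∙ (f x ∙ ∑ ys f) ∎
    ∑-↭ f (Perm.trans p q) = ≡-trans (∑-↭ f p) (∑-↭ f q)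

    ∑-++ : ∀ xs ys (f : A → C) → ∑ (xs ++ ys) f ≡ (∑ xs f ∙ ∑ ys f)
    ∑-++ []       ys f = ≡-sym (identityˡ _)
    ∑-++ (x ∷ xs) ys f = ≡-trans (cong (f x ∙_) (∑-++ xs ys f)) (≡-sym (assoc _ _ _))

  module _ {A B : Set} where

    ∑-swap : ∀ (xs : List A) (ys : List B) (f : A → B → C) →
             ∑ xs (λ x → ∑ ys (f x)) ≡ ∑ ys (λ y → ∑ xs (λ x → f x y))
    ∑-swap []       ys f = ≡-sym (∑-const-ε ys)
    ∑-swap (x ∷ xs) ys f = ≡-trans (cong (∑ ys (f x) ∙_) (∑-swap xs ys f)) (≡-sym (∑-∙ ys _ _))

    ∑-map : ∀ (g : A → B) xs (f : B → C) → ∑ (map g xs) f ≡ ∑ xs (f ∘ g)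
    ∑-map g []       f = refl
    ∑-map g (x ∷ xs) f = cong (f (g x) ∙_) (∑-map g xs f)

    ∑-concatMap : ∀ (g : A → List B) xs (f : B → C) → ∑ (concatMap g xs) f ≡ ∑ xs (λ x → ∑ (g x) f)
    ∑-concatMap g []       f = refl
    ∑-concatMap g (x ∷ xs) f = ≡-trans (∑-++ (g x) _ f) (cong (∑ (g x) f ∙_) (∑-concatMap g xs f))

  ∑-allFin-suc : ∀ n (f : Fin (suc n) → C) →
                 ∑ (allFin (suc n)) f ≡ (f zero ∙ ∑ (allFin n) (f ∘ suc))
  ∑-allFin-suc n f = cong (f zero ∙_)
    (≡-trans (cong (λ l → ∑ l f) (≡-sym (map-tabulate id suc))) (∑-map suc (allFin n) f))

module 𝔽₂ = ListSum (CommutativeRing.+-isCommutativeMonoid 𝔹.xor-∧-commutativeRing)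
open 𝔽₂ using () renaming (∑ to ⨁)

xor≡false⇒≡ : ∀ a b → a xor b ≡ false → a ≡ b
xor≡false⇒≡ true  true  _ = refl
xor≡false⇒≡ false false _ = refl

⨁-∧ : {A : Set} → ∀ c xs (f : A → Bool) → ⨁ xs (λ x → c ∧ f x) ≡ c ∧ ⨁ xs f
⨁-∧ c []       f = ≡-sym (∧-zeroʳ c)
⨁-∧ c (x ∷ xs) f = ≡-trans (cong (c ∧ f x xor_) (⨁-∧ c xs f)) (≡-sym (∧-distribˡ-xor c (f x) _))

⨁-filter : {A : Set} {P : A → Set} (P? : ∀ x → Dec (P x)) → ∀ xs (f : A → Bool) →
           ⨁ (filter P? xs) f ≡ ⨁ xs (λ x → does (P? x) ∧ f x)
⨁-filter P? []       f = refl
⨁-filter P? (x ∷ xs) f with does (P? x)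
... | true  = cong (f x xor_) (⨁-filter P? xs f)
... | false = ⨁-filter P? xs f

⨁-indicator : ∀ {n} (i : Fin n) (f : Fin n → Bool) → ⨁ (allFin n) (λ j → does (j Fin.≟ i) ∧ f j) ≡ f i
⨁-indicator {suc n} zero f = begin
  _ ≡⟨ 𝔽₂.∑-allFin-suc n (λ j → does (j Fin.≟ zero) ∧ f j) ⟩
  f zero xor ⨁ (allFin n) (λ _ → false) ≡⟨ cong (f zero xor_) (𝔽₂.∑-ε (allFin n) (λ _ → refl)) ⟩
  f zero xor false ≡⟨ xor-identityʳ _ ⟩
  f zero ∎ where open ≡-Reasoning
⨁-indicator {suc n} (suc i) f = ≡-trans (𝔽₂.∑-allFin-suc n (λ j → does (j Fin.≟ suc i) ∧ f j)) (⨁-indicator i (f ∘ suc))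

-- Homogeneous linear systems over 𝔽₂.

-- Gaussian elimination on the first unknown. If no equation contains it, its unit vector is a
-- solution. Otherwise a pivot row `p` removes it from the other rows, and a solution of the smaller
-- system is extended by the value that the pivot row dictates.
underdetermined : ∀ {m n} → m ℕ.< n → (a : Fin m → Fin n → Bool) →
  Σ (Fin n → Bool) λ z → (∃ λ j → z j ≡ true) × (∀ i → ⨁ (allFin n) (λ j → a i j ∧ z j) ≡ false)
underdetermined {m} {suc n} m<n a with Fin.any? (λ i → a i zero 𝔹.≟ true)
... | no none = (λ j → does (j Fin.≟ zero)) , (zero , refl) , λ i → begin
  ⨁ (allFin (suc n)) (λ j → a i j ∧ does (j Fin.≟ zero)) ≡⟨ 𝔽₂.∑-cong (allFin (suc n)) (λ j → ∧-comm (a i j) _) ⟩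
  ⨁ (allFin (suc n)) (λ j → does (j Fin.≟ zero) ∧ a i j) ≡⟨ ⨁-indicator zero (a i) ⟩
  a i zero ≡⟨ 𝔹.¬-not (λ e → none (i , e)) ⟩
  false ∎
  where open ≡-Reasoning
underdetermined {suc m} {suc n} (s≤s m<n) a | yes (p , ap≡true) = z , (suc (proj₁ nz) , proj₂ nz) , sat
  where
  open ≡-Reasoning
  a′ : Fin m → Fin n → Bool
  a′ k j = a (punchIn p k) (suc j) xor (a (punchIn p k) zero ∧ a p (suc j))
  rec = underdetermined m<n a′
  z′  = proj₁ rec
  nz  = proj₁ (proj₂ rec)
  z₀ : Bool
  z₀ = ⨁ (allFin n) (λ j → a p (suc j) ∧ z′ j)
  z : Fin (suc n) → Bool
  z zero    = z₀
  z (suc j) = z′ j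
  satPivot : ⨁ (allFin (suc n)) (λ j → a p j ∧ z j) ≡ false
  satPivot = begin
    ⨁ (allFin (suc n)) (λ j → a p j ∧ z j) ≡⟨ 𝔽₂.∑-allFin-suc n (λ j → a p j ∧ z j) ⟩
    (a p zero ∧ z₀) xor z₀                 ≡⟨ cong (λ b → (b ∧ z₀) xor z₀) ap≡true ⟩
    z₀ xor z₀                              ≡⟨ xor-same z₀ ⟩
    false                                  ∎
  satRest : ∀ k → ⨁ (allFin (suc n)) (λ j → a (punchIn p k) j ∧ z j) ≡ false
  satRest k = begin
    ⨁ (allFin (suc n)) (λ j → a (punchIn p k) j ∧ z j) ≡⟨ 𝔽₂.∑-allFin-suc n (λ j → a (punchIn p k) j ∧ z j) ⟩
    (b ∧ z₀) xor ⨁ (allFin n) (λ j → c j ∧ z′ j) ≡⟨ xor-comm (b ∧ z₀) _ ⟩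
    ⨁ (allFin n) (λ j → c j ∧ z′ j) xor (b ∧ z₀) ≡⟨ cong (⨁ (allFin n) (λ j → c j ∧ z′ j) xor_) (⨁-∧ b (allFin n) _) ⟨
    ⨁ (allFin n) (λ j → c j ∧ z′ j) xor ⨁ (allFin n) (λ j → b ∧ (a p (suc j) ∧ z′ j)) ≡⟨ 𝔽₂.∑-∙ (allFin n) _ _ ⟨
    ⨁ (allFin n) (λ j → (c j ∧ z′ j) xor (b ∧ (a p (suc j) ∧ z′ j))) ≡⟨ 𝔽₂.∑-cong (allFin n) (λ j →
      ≡-trans (cong ((c j ∧ z′ j) xor_) (≡-sym (∧-assoc b _ _))) (≡-sym (∧-distribʳ-xor (z′ j) (c j) _))) ⟩
    ⨁ (allFin n) (λ j → a′ k j ∧ z′ j) ≡⟨ proj₂ (proj₂ rec) k ⟩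
    false ∎
    where
    b = a (punchIn p k) zero
    c = λ j → a (punchIn p k) (suc j)
  sat : ∀ i → ⨁ (allFin (suc n)) (λ j → a i j ∧ z j) ≡ false
  sat i with p Fin.≟ i
  ... | yes refl = satPivot
  ... | no p≢i   = subst (λ k → ⨁ (allFin (suc n)) (λ j → a k j ∧ z j) ≡ false)
                         (punchIn-punchOut p≢i) (satRest (punchOut p≢i))

underdetermined-list : ∀ {n} (rows : List (Fin n → Bool)) → length rows ℕ.< n →
  Σ (Fin n → Bool) λ z → (∃ λ j → z j ≡ true) ×
    (∀ {r} → r ∈ rows → ⨁ (allFin n) (λ j → r j ∧ z j) ≡ false)
underdetermined-list {n} rows short with underdetermined short (List.lookup rows)
... | z , nz , sat = z , nz , λ r∈ → subst (λ r → ⨁ (allFin n) (λ j → r j ∧ z j) ≡ false)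
                                          (≡-sym (lookup-index r∈)) (sat (Any.index r∈))

-- Ordered-field arithmetic in ℚ.

module _ where
  open import Data.Rational using (_+_; _*_; _-_; -_; _≤_; _<_; 1/_)
  open import Data.Rational.Properties using (_≤?_; _<?_; _≟_; <-cmp)

  ℚ-ring : AlmostCommutativeRing 0ℓ 0ℓ
  ℚ-ring = fromCommutativeRing ℚ.+-*-commutativeRing (λ x → dec⇒maybe (0ℚ ≟ x))

  does-⇔ : {P Q : Set} → (P → Q) → (Q → P) → (P? : Dec P) (Q? : Dec Q) → does P? ≡ does Q?
  does-⇔ f g (yes p) Q? = ≡-sym (dec-true Q? (f p))
  does-⇔ f g (no ¬p) Q? = ≡-sym (dec-false Q? (¬p ∘ g))

  0<q-p : ∀ {p q} → p < q → 0ℚ < q - p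
  0<q-p {p} {q} p<q = subst (_< q - p) (ℚ.+-inverseʳ p) (ℚ.+-monoˡ-< (- p) p<q)

  0≤q-p : ∀ {p q} → p ≤ q → 0ℚ ≤ q - p
  0≤q-p {p} {q} p≤q = subst (_≤ q - p) (ℚ.+-inverseʳ p) (ℚ.+-monoˡ-≤ (- p) p≤q)

  p-q+q≡p : ∀ p q → p - q + q ≡ p
  p-q+q≡p = solve-∀ ℚ-ring

  0<q-p⇒p<q : ∀ {p q} → 0ℚ < q - p → p < q
  0<q-p⇒p<q {p} {q} h = subst₂ _<_ (ℚ.+-identityˡ p) (p-q+q≡p q p) (ℚ.+-monoˡ-< p h)

  0≤q-p⇒p≤q : ∀ {p q} → 0ℚ ≤ q - p → p ≤ q
  0≤q-p⇒p≤q {p} {q} h = subst₂ _≤_ (ℚ.+-identityˡ p) (p-q+q≡p q p) (ℚ.+-monoˡ-≤ p h)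

  p-q≡0⇒p≡q : ∀ {p q} → p - q ≡ 0ℚ → p ≡ q
  p-q≡0⇒p≡q {p} {q} h = ≡-trans (≡-sym (p-q+q≡p p q)) (≡-trans (cong (_+ q) h) (ℚ.+-identityˡ q))

  *-pos : ∀ {p q} → 0ℚ < p → 0ℚ < q → 0ℚ < p * q
  *-pos {p} {q} 0<p 0<q = ℚ.positive⁻¹ (p * q) {{ℚ.pos*pos⇒pos p {{ℚ.positive 0<p}} q {{ℚ.positive 0<q}}}}

  *-nonNeg : ∀ {p q} → 0ℚ ≤ p → 0ℚ ≤ q → 0ℚ ≤ p * q
  *-nonNeg {p} {q} 0≤p 0≤q = ℚ.nonNegative⁻¹ (p * q) {{ℚ.nonNeg*nonNeg⇒nonNeg p {{ℚ.nonNegative 0≤p}} q {{ℚ.nonNegative 0≤q}}}}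

  +-pos : ∀ {p q} → 0ℚ < p → 0ℚ < q → 0ℚ < p + q
  +-pos {p} {q} 0<p 0<q = subst (_< p + q) (ℚ.+-identityˡ 0ℚ) (ℚ.+-mono-< 0<p 0<q)

  recip : ∀ {d} → 0ℚ < d → ∃ λ r → 0ℚ < r × r * d ≡ 1ℚ
  recip {d} 0<d = 1/ d , ℚ.positive⁻¹ (1/ d) {{ℚ.1/pos⇒pos d {{d>0}}}} , ℚ.*-inverseˡ d
    where
    d>0 : Positive d
    d>0 = ℚ.positive 0<d
    instance
      d≢0 : ℚ.NonZero d
      d≢0 = ℚ.pos⇒nonZero d {{d>0}}

  module _ (y₁ m₁ y₂ m₂ : ℚ) where

    -- The crossing divides the interval in the ratio α : β of the gaps at its two ends. It is
    -- therefore rational, and the intermediate value theorem for affine functions holds over ℚ.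
    affine-crossing : ∀ {d} → 0ℚ < d → y₁ < y₂ → y₂ + m₂ * d < y₁ + m₁ * d →
      ∃ λ e → 0ℚ < e × e < d × y₁ + m₁ * e ≡ y₂ + m₂ * e
    affine-crossing {d} 0<d lt gt = e , *-pos 0<θ 0<d , e<d , agree
      where
      α = y₂ - y₁
      β = (y₁ + m₁ * d) - (y₂ + m₂ * d)
      0<α = 0<q-p lt
      0<β = 0<q-p gt
      inv = recip (+-pos 0<α 0<β)
      r = proj₁ inv
      0<r = proj₁ (proj₂ inv)
      r*≡1 : r * (α + β) ≡ 1ℚ
      r*≡1 = proj₂ (proj₂ inv)
      θ = r * α
      0<θ = *-pos 0<r 0<α
      e = θ * d
      e<d : e < d
      e<d = 0<q-p⇒p<q (subst (0ℚ <_) eq (*-pos (*-pos 0<r 0<β) 0<d))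
        where
        lem : ∀ r α β d → r * β * d ≡ r * (α + β) * d - r * α * d
        lem = solve-∀ ℚ-ring
        eq : r * β * d ≡ d - e
        eq = ≡-trans (lem r α β d) (cong (_- e) (≡-trans (cong (_* d) r*≡1) (ℚ.*-identityˡ d)))
      agree : y₁ + m₁ * e ≡ y₂ + m₂ * e
      agree = ≡-sym (p-q≡0⇒p≡q (begin
        (y₂ + m₂ * e) - (y₁ + m₁ * e)     ≡⟨ lem y₁ m₁ y₂ m₂ r d ⟩
        α - r * (α + β) * α               ≡⟨ cong (λ u → α - u * α) r*≡1 ⟩
        α - 1ℚ * α                        ≡⟨ cong (λ u → α - u) (ℚ.*-identityˡ α) ⟩
        α - α                             ≡⟨ ℚ.+-inverseʳ α ⟩
        0ℚ ∎))
        where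
        open ≡-Reasoning
        lem : ∀ y₁ m₁ y₂ m₂ r d →
          (y₂ + m₂ * (r * (y₂ - y₁) * d)) - (y₁ + m₁ * (r * (y₂ - y₁) * d)) ≡
          (y₂ - y₁) - r * ((y₂ - y₁) + ((y₁ + m₁ * d) - (y₂ + m₂ * d))) * (y₂ - y₁)
        lem = solve-∀ ℚ-ring

  xor-cancel-middle : ∀ a b c → (a xor b) xor (b xor c) ≡ a xor c
  xor-cancel-middle true  true  c = refl
  xor-cancel-middle true  false c = refl
  xor-cancel-middle false true  c = 𝔹.not-involutive c
  xor-cancel-middle false false c = refl

  xor-cross : ∀ a b c d e → a xor b ≡ e → c xor d ≡ e → a xor c ≡ b xor d
  xor-cross a b c d e p q = xor≡false⇒≡ (a xor c) (b xor d) (begin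
    (a xor c) xor (b xor d) ≡⟨ 𝔽₂.interchange {A = Bool} a c b d ⟩
    (a xor b) xor (c xor d) ≡⟨ cong₂ _xor_ p q ⟩
    e xor e                 ≡⟨ xor-same e ⟩
    false ∎)
    where open ≡-Reasoning

  -- Sorting and telescoping sums.

  module InsertionSort {A : Set} (_≺_ : A → A → Set) (≺-trans : ∀ {x y z} → x ≺ y → y ≺ z → x ≺ z) where

    insert : ∀ x ys → AllPairs _≺_ ys → All (λ y → x ≺ y ⊎ y ≺ x) ys →
             ∃ λ zs → (x ∷ ys) ↭ zs × AllPairs _≺_ zs
    insert x []       []          []              = x ∷ [] , ↭-refl , [] ∷ []
    insert x (y ∷ ys) (y≺ ∷ ys↗) (inj₁ x≺y ∷ _)  =
      x ∷ y ∷ ys , ↭-refl , (x≺y ∷ All.map (≺-trans x≺y) y≺) ∷ y≺ ∷ ys↗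
    insert x (y ∷ ys) (y≺ ∷ ys↗) (inj₂ y≺x ∷ cs) with insert x ys ys↗ cs
    ... | zs , x∷ys↭zs , zs↗ =
      y ∷ zs , ↭-trans (↭-swap x y ↭-refl) (↭-prep y x∷ys↭zs) , All-resp-↭ x∷ys↭zs (y≺x ∷ y≺) ∷ zs↗

    -- Comparability is asked only of the entries of the list: distinct segments at one corner have
    -- distinct slopes, while slopes elsewhere may coincide.
    sort : ∀ xs → AllPairs (λ x y → x ≺ y ⊎ y ≺ x) xs → ∃ λ ys → xs ↭ ys × AllPairs _≺_ ys
    sort []       []       = [] , ↭-refl , []
    sort (x ∷ xs) (c ∷ cs) with sort xs cs
    ... | ys , xs↭ys , ys↗ with insert x ys ys↗ (All-resp-↭ xs↭ys c)
    ...   | zs , x∷ys↭zs , zs↗ = zs , ↭-trans (↭-prep x xs↭ys) x∷ys↭zs , zs↗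

  module Telescope {S Z : Set} (val : Z → S → Bool) (I : (Z → Bool) → Bool)
    (I-ext : ∀ {f g} → (∀ z → f z ≡ g z) → I f ≡ I g)
    {_≺_ : S → S → Set} (_≺?_ : ∀ s t → Dec (s ≺ t)) (≺-asym : ∀ {s t} → s ≺ t → ¬ t ≺ s) where

    open ≡-Reasoning

    before : List S → S → Z → Bool
    before L l z = ⨁ L (λ t → does (t ≺? l) ∧ val z t)

    -- Whether `I` changes its verdict when `l` is crossed. Since `I` need not be additive, only
    -- verdicts that are consecutive in the order can cancel.
    jump : (Z → Bool) → List S → S → Bool
    jump A L l = I (λ z → A z xor before L l z) xor I (λ z → (A z xor before L l z) xor val z l)

    telescope-sorted : ∀ L → AllPairs _≺_ L → (A : Z → Bool) →
      ⨁ L (jump A L) ≡ I A xor I (λ z → A z xor ⨁ L (val z))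
    telescope-sorted [] [] A = ≡-sym (≡-trans (cong (I A xor_) (I-ext (λ z → xor-identityʳ (A z)))) (xor-same (I A)))
    telescope-sorted (l ∷ L) (l≺ ∷ L↗) A = begin
      jump A (l ∷ L) l xor ⨁ L (jump A (l ∷ L))      ≡⟨ cong₂ _xor_ first (𝔽₂.∑-cong∈ L rest) ⟩
      (I A xor I A′) xor ⨁ L (jump A′ L)             ≡⟨ cong ((I A xor I A′) xor_) (telescope-sorted L L↗ A′) ⟩
      (I A xor I A′) xor (I A′ xor I (λ z → A′ z xor ⨁ L (val z)))
                                                     ≡⟨ xor-cancel-middle (I A) (I A′) _ ⟩
      I A xor I (λ z → A′ z xor ⨁ L (val z))         ≡⟨ cong (I A xor_) (I-ext (λ z → xor-assoc (A z) _ _)) ⟩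
      I A xor I (λ z → A z xor ⨁ (l ∷ L) (val z))    ∎
      where
      A′ : Z → Bool
      A′ z = A z xor val z l
      none : ∀ z → before (l ∷ L) l z ≡ false
      none z = 𝔽₂.∑-ε (l ∷ L) λ where
        (here refl) → cong (_∧ val z l) (dec-false (l ≺? l) (λ l≺l → ≺-asym l≺l l≺l))
        {x} (there t∈) → cong (_∧ val z x) (dec-false (x ≺? l) (≺-asym (All.lookup l≺ t∈)))
      A-none : ∀ z → A z xor before (l ∷ L) l z ≡ A z
      A-none z = ≡-trans (cong (A z xor_) (none z)) (xor-identityʳ (A z))
      first : jump A (l ∷ L) l ≡ I A xor I A′
      first = cong₂ _xor_ (I-ext A-none) (I-ext (λ z → cong (_xor val z l) (A-none z)))
      rest : ∀ {x} → x ∈ L → jump A (l ∷ L) x ≡ jump A′ L x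
      rest {x} x∈ = cong₂ _xor_ (I-ext eq) (I-ext (λ z → cong (_xor val z x) (eq z)))
        where
        eq : ∀ z → A z xor before (l ∷ L) x z ≡ A′ z xor before L x z
        eq z = ≡-trans (cong (λ b → A z xor ((b ∧ val z l) xor before L x z)) (dec-true (l ≺? x) (All.lookup l≺ x∈)))
                       (≡-sym (xor-assoc (A z) (val z l) _))

    telescope : (≺-trans : ∀ {x y z} → x ≺ y → y ≺ z → x ≺ z) →
      ∀ L → AllPairs (λ x y → x ≺ y ⊎ y ≺ x) L → (A : Z → Bool) →
      ⨁ L (jump A L) ≡ I A xor I (λ z → A z xor ⨁ L (val z))
    telescope ≺-trans L comparable A with InsertionSort.sort _≺_ ≺-trans L comparable
    ... | L′ , L↭L′ , L′↗ = begin
      -- `before` is a commutative sum and does not see the order of the list, so sorting leaves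
      -- every jump unchanged.
      ⨁ L (jump A L)     ≡⟨ 𝔽₂.∑-cong L (λ l → cong₂ _xor_ (I-ext (λ z → cong (A z xor_) (same l z)))
                                                         (I-ext (λ z → cong (λ b → (A z xor b) xor val z l) (same l z)))) ⟩
      ⨁ L (jump A L′)    ≡⟨ 𝔽₂.∑-↭ _ L↭L′ ⟩
      ⨁ L′ (jump A L′)   ≡⟨ telescope-sorted L′ L′↗ A ⟩
      I A xor I (λ z → A z xor ⨁ L′ (val z)) ≡⟨ cong (I A xor_) (I-ext (λ z → cong (A z xor_) (𝔽₂.∑-↭ (val z) L↭L′))) ⟨
      I A xor I (λ z → A z xor ⨁ L (val z)) ∎
      where
      same : ∀ l z → before L l z ≡ before L′ l z
      same l z = 𝔽₂.∑-↭ _ L↭L′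

  -- Arrangements of non-vertical segments that meet only at their ends.

  module Arrangement
    {S : Set} (_≟S_ : DecidableEquality S) (segs : List S) (segs! : Unique segs)
    (xl yl xr yr m : S → ℚ) (xl<xr : ∀ s → xl s < xr s)
    (yr≡ : ∀ s → yr s ≡ yl s + m s * (xr s - xl s))
    (noncrossing : ∀ {s t} → s ≢ t → ∀ {x} → xl s ≤ x → x ≤ xr s → xl t ≤ x → x ≤ xr t →
      yl s + m s * (x - xl s) ≡ yl t + m t * (x - xl t) → x ≡ xl s ⊎ x ≡ xr s)
    where

    height : S → ℚ → ℚ
    height s x = yl s + m s * (x - xl s)

    height-shift : ∀ s x x′ → height s x′ ≡ height s x + m s * (x′ - x)
    height-shift s x x′ = lem (yl s) (m s) (xl s) x x′
      where
      lem : ∀ y m l x x′ → y + m * (x′ - l) ≡ (y + m * (x - l)) + m * (x′ - x)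
      lem = solve-∀ ℚ-ring

    height-xl : ∀ s → height s (xl s) ≡ yl s
    height-xl s = lem (yl s) (m s) (xl s)
      where
      lem : ∀ y m x → y + m * (x - x) ≡ y
      lem = solve-∀ ℚ-ring

    height-xr : ∀ s → height s (xr s) ≡ yr s
    height-xr s = ≡-sym (yr≡ s)

    interior-≢ : ∀ {s t x} → s ≢ t → xl s < x → x < xr s → xl t ≤ x → x ≤ xr t → height s x ≢ height t x
    interior-≢ s≢t l< <r l≤ ≤r eq with noncrossing s≢t (ℚ.<⇒≤ l<) (ℚ.<⇒≤ <r) l≤ ≤r eq
    ... | inj₁ refl = ℚ.<-irrefl refl l<
    ... | inj₂ refl = ℚ.<-irrefl refl <r

    -- A change of order would make the two affine heights agree at an interior abscissa, against
    -- `interior-≢`.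
    no-crossing : ∀ {s t x₁ x₂} → s ≢ t → x₁ < x₂ → xl s ≤ x₁ → xl t ≤ x₁ → x₂ ≤ xr s → x₂ ≤ xr t →
      height s x₁ < height t x₁ → ¬ height t x₂ < height s x₂
    no-crossing {s} {t} {x₁} {x₂} s≢t x₁<x₂ ls lt rs rt lt₁ gt₂ =
      interior-≢ s≢t (ℚ.≤-<-trans ls x₁<x) (ℚ.<-≤-trans x<x₂ rs)
                     (ℚ.≤-trans lt (ℚ.<⇒≤ x₁<x)) (ℚ.≤-trans (ℚ.<⇒≤ x<x₂) rt)
        (≡-trans (at s) (≡-trans agree (≡-sym (at t))))
      where
      cross = affine-crossing (height s x₁) (m s) (height t x₁) (m t) (0<q-p x₁<x₂) lt₁
                (subst₂ _<_ (height-shift t x₁ x₂) (height-shift s x₁ x₂) gt₂)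
      e = proj₁ cross
      x = e + x₁
      x₁<x : x₁ < x
      x₁<x = subst (_< x) (ℚ.+-identityˡ x₁) (ℚ.+-monoˡ-< x₁ (proj₁ (proj₂ cross)))
      x<x₂ : x < x₂
      x<x₂ = subst (x <_) (p-q+q≡p x₂ x₁) (ℚ.+-monoˡ-< x₁ (proj₁ (proj₂ (proj₂ cross))))
      agree = proj₂ (proj₂ (proj₂ cross))
      lem : ∀ e x₁ → (e + x₁) - x₁ ≡ e
      lem = solve-∀ ℚ-ring
      at : ∀ s → height s x ≡ height s x₁ + m s * e
      at s = ≡-trans (height-shift s x₁ x) (cong (λ u → height s x₁ + m s * u) (lem e x₁))

    diverge : ∀ {s t x x′} → height s x ≡ height t x → m s < m t → x < x′ → height s x′ < height t x′
    diverge {s} {t} {x} {x′} eq ms<mt x<x′ = subst₂ _<_ (≡-sym (height-shift s x x′)) (≡-sym (height-shift t x x′))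
      (subst (λ h → h + m s * (x′ - x) < height t x + m t * (x′ - x)) (≡-sym eq)
        (ℚ.+-monoʳ-< (height t x) (ℚ.*-monoˡ-<-pos (x′ - x) {{ℚ.positive (0<q-p x<x′)}} ms<mt)))

    converge : ∀ {s t x x′} → height s x′ ≡ height t x′ → m t < m s → x < x′ → height s x < height t x
    converge {s} {t} {x} {x′} eq mt<ms x<x′ with <-cmp (height s x) (height t x)
    ... | tri< lt _ _ = lt
    ... | tri≈ _ eqₓ _ = ⊥-elim (ℚ.<-irrefl (≡-sym eq) (diverge (≡-sym eqₓ) mt<ms x<x′))
    ... | tri> _ _ gt = ⊥-elim (ℚ.<-irrefl (≡-sym eq) (subst₂ _<_ (≡-sym (height-shift t x x′)) (≡-sym (height-shift s x x′))
            (ℚ.+-mono-< gt (ℚ.*-monoˡ-<-pos (x′ - x) {{ℚ.positive (0<q-p x<x′)}} mt<ms))))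

    -- The order of the segments immediately to the right and immediately to the left of `x`. At a
    -- common point the slopes decide, in opposite senses on the two sides.
    Above⁺ Above⁻ : S → S → ℚ → Set
    Above⁺ s t x = height s x < height t x ⊎ (height s x ≡ height t x × m s < m t)
    Above⁻ s t x = height s x < height t x ⊎ (height s x ≡ height t x × m t < m s)

    module _ {s t M} (s≢t : s ≢ t) (ls : xl s < M) (lt : xl t < M) (rs : M < xr s) (rt : M < xr t) where

      private
        M≢ : height s M ≢ height t M
        M≢ = interior-≢ s≢t ls rs (ℚ.<⇒≤ lt) (ℚ.<⇒≤ rt)

      parallel⇒⊥ : ∀ {x} → height s x ≡ height t x → ¬ m s ≡ m t
      parallel⇒⊥ {x} eq ms≡mt = M≢ (≡-trans (height-shift s x M)
        (≡-trans (cong₂ (λ h k → h + k * (M - x)) eq ms≡mt) (≡-sym (height-shift t x M))))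

      -- Over the common interior of their projections two segments keep their order, so one
      -- abscissa `M` in it represents that order. This and the next three lemmas move infinitesimal
      -- comparisons at an end to `M` and back.
      above⁺-mid : ∀ {x} → xl s ≤ x → xl t ≤ x → x < M → Above⁺ s t x → height s M < height t M
      above⁺-mid ls′ lt′ x<M (inj₂ (eq , ms<mt)) = diverge eq ms<mt x<M
      above⁺-mid ls′ lt′ x<M (inj₁ below) with <-cmp (height s M) (height t M)
      ... | tri< lt _ _ = lt
      ... | tri≈ _ eq _ = ⊥-elim (M≢ eq)
      ... | tri> _ _ gt = ⊥-elim (no-crossing s≢t x<M ls′ lt′ (ℚ.<⇒≤ rs) (ℚ.<⇒≤ rt) below gt)

      mid-above⁺ : ∀ {x} → xl s ≤ x → xl t ≤ x → x < M → height s M < height t M → Above⁺ s t x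
      mid-above⁺ {x} ls′ lt′ x<M mid with <-cmp (height s x) (height t x)
      ... | tri< lt _ _ = inj₁ lt
      ... | tri> _ _ gt = ⊥-elim (no-crossing (s≢t ∘ ≡-sym) x<M lt′ ls′ (ℚ.<⇒≤ rt) (ℚ.<⇒≤ rs) gt mid)
      ... | tri≈ _ eq _ with <-cmp (m s) (m t)
      ...   | tri< lt _ _ = inj₂ (eq , lt)
      ...   | tri≈ _ e _  = ⊥-elim (parallel⇒⊥ {x} eq e)
      ...   | tri> _ _ gt = ⊥-elim (ℚ.<-asym mid (diverge (≡-sym eq) gt x<M))

      above⁻-mid : ∀ {x} → x ≤ xr s → x ≤ xr t → M < x → Above⁻ s t x → height s M < height t M
      above⁻-mid rs′ rt′ M<x (inj₂ (eq , mt<ms)) = converge eq mt<ms M<x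
      above⁻-mid rs′ rt′ M<x (inj₁ below) with <-cmp (height s M) (height t M)
      ... | tri< lt _ _ = lt
      ... | tri≈ _ eq _ = ⊥-elim (M≢ eq)
      ... | tri> _ _ gt = ⊥-elim (no-crossing (s≢t ∘ ≡-sym) M<x (ℚ.<⇒≤ lt) (ℚ.<⇒≤ ls) rt′ rs′ gt below)

      mid-above⁻ : ∀ {x} → x ≤ xr s → x ≤ xr t → M < x → height s M < height t M → Above⁻ s t x
      mid-above⁻ {x} rs′ rt′ M<x mid with <-cmp (height s x) (height t x)
      ... | tri< lt _ _ = inj₁ lt
      ... | tri> _ _ gt = ⊥-elim (no-crossing s≢t M<x (ℚ.<⇒≤ ls) (ℚ.<⇒≤ lt) rs′ rt′ mid gt)
      ... | tri≈ _ eq _ with <-cmp (m s) (m t)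
      ...   | tri< lt _ _ = ⊥-elim (ℚ.<-asym mid (converge (≡-sym eq) lt M<x))
      ...   | tri≈ _ e _  = ⊥-elim (parallel⇒⊥ {x} eq e)
      ...   | tri> _ _ gt = inj₂ (eq , gt)

    above⁺? : ∀ s t x → Dec (Above⁺ s t x)
    above⁺? s t x = (height s x <? height t x) ⊎-dec ((height s x ≟ height t x) ×-dec (m s <? m t))

    above⁻? : ∀ s t x → Dec (Above⁻ s t x)
    above⁻? s t x = (height s x <? height t x) ⊎-dec ((height s x ≟ height t x) ×-dec (m t <? m s))

    -- The test points lie just above `s`, infinitesimally inside its left and its right end. Hence
    -- the half-open intervals: at the left end a segment starting at that abscissa counts and one
    -- stopping there does not, at the right end conversely.
    OverLeft OverRight : S → S → Set
    OverLeft  s t = (xl t ≤ xl s × xl s < xr t) × Above⁺ s t (xl s)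
    OverRight s t = (xl t < xr s × xr s ≤ xr t) × Above⁻ s t (xr s)

    overLeft? : ∀ s t → Dec (OverLeft s t)
    overLeft? s t = ((xl t ≤? xl s) ×-dec (xl s <? xr t)) ×-dec above⁺? s t (xl s)

    overRight? : ∀ s t → Dec (OverRight s t)
    overRight? s t = ((xl t <? xr s) ×-dec (xr s ≤? xr t)) ×-dec above⁻? s t (xr s)

    Region : S → ℚ → ℚ → Set
    Region s x y = (xl s < x × x < xr s) × height s x < y

    region? : ∀ s x y → Dec (Region s x y)
    region? s x y = ((xl s <? x) ×-dec (x <? xr s)) ×-dec (height s x <? y)

    -- Either `t` already spans the left end of `s`, or it starts inside the strip. In each case one
    -- of the two tests is false and the other reports the order at `M`.
    overLeft-region : ∀ {s t M} → s ≢ t → xl s < M → xl t < M → M < xr s → M < xr t →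
      does (overLeft? s t) xor does (region? s (xl t) (yl t)) ≡ does (height s M <? height t M)
    overLeft-region {s} {t} {M} s≢t ls lt rs rt with xl t ≤? xl s
    ... | yes t≤s = ≡-trans
      (cong₂ _xor_ (does-⇔ (λ (_ , a) → above⁺-mid s≢t ls lt rs rt ℚ.≤-refl t≤s ls a)
                           (λ mid → (t≤s , ℚ.<-trans ls rt) , mid-above⁺ s≢t ls lt rs rt ℚ.≤-refl t≤s ls mid)
                           (overLeft? s t) (height s M <? height t M))
                   (dec-false (region? s (xl t) (yl t)) (λ ((s<t , _) , _) → ℚ.<-irrefl refl (ℚ.<-≤-trans s<t t≤s))))
      (xor-identityʳ _)
    ... | no t≰s = cong₂ _xor_
      (dec-false (overLeft? s t) (λ ((t≤s , _) , _) → t≰s t≤s))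
      (does-⇔ (λ (_ , a) → above⁺-mid s≢t ls lt rs rt s≤t ℚ.≤-refl lt (inj₁ (subst (height s (xl t) <_) (≡-sym (height-xl t)) a)))
              (λ mid → (s<t , t<s) , unequal (mid-above⁺ s≢t ls lt rs rt s≤t ℚ.≤-refl lt mid))
              (region? s (xl t) (yl t)) (height s M <? height t M))
      where
      s<t = ℚ.≰⇒> t≰s
      s≤t = ℚ.<⇒≤ s<t
      t<s = ℚ.<-trans lt rs
      unequal : Above⁺ s t (xl t) → height s (xl t) < yl t
      unequal (inj₁ b) = subst (height s (xl t) <_) (height-xl t) b
      unequal (inj₂ (eq , _)) = ⊥-elim (interior-≢ s≢t s<t t<s ℚ.≤-refl (ℚ.<⇒≤ (xl<xr t)) eq)

    overRight-region : ∀ {s t M} → s ≢ t → xl s < M → xl t < M → M < xr s → M < xr t →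
      does (overRight? s t) xor does (region? s (xr t) (yr t)) ≡ does (height s M <? height t M)
    overRight-region {s} {t} {M} s≢t ls lt rs rt with xr s ≤? xr t
    ... | yes s≤t = ≡-trans
      (cong₂ _xor_ (does-⇔ (λ (_ , a) → above⁻-mid s≢t ls lt rs rt ℚ.≤-refl s≤t rs a)
                           (λ mid → (ℚ.<-trans lt rs , s≤t) , mid-above⁻ s≢t ls lt rs rt ℚ.≤-refl s≤t rs mid)
                           (overRight? s t) (height s M <? height t M))
                   (dec-false (region? s (xr t) (yr t)) (λ ((_ , t<s) , _) → ℚ.<-irrefl refl (ℚ.<-≤-trans t<s s≤t))))
      (xor-identityʳ _)
    ... | no s≰t = cong₂ _xor_
      (dec-false (overRight? s t) (λ ((_ , s≤t) , _) → s≰t s≤t))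
      (does-⇔ (λ (_ , a) → above⁻-mid s≢t ls lt rs rt t≤s ℚ.≤-refl rt (inj₁ (subst (height s (xr t) <_) (≡-sym (height-xr t)) a)))
              (λ mid → (s<t , t<s) , unequal (mid-above⁻ s≢t ls lt rs rt t≤s ℚ.≤-refl rt mid))
              (region? s (xr t) (yr t)) (height s M <? height t M))
      where
      t<s = ℚ.≰⇒> s≰t
      t≤s = ℚ.<⇒≤ t<s
      s<t = ℚ.<-trans ls rt
      unequal : Above⁻ s t (xr t) → height s (xr t) < yr t
      unequal (inj₁ b) = subst (height s (xr t) <_) (height-xr t) b
      unequal (inj₂ (eq , _)) = ⊥-elim (interior-≢ s≢t s<t t<s (ℚ.<⇒≤ (xl<xr t)) ℚ.≤-refl eq)

    common-point : ∀ {a b c d} → a < b → a < d → c < b → c < d → ∃ λ M → a < M × c < M × M < b × M < d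
    common-point {a} {b} {c} {d} a<b a<d c<b c<d with ℚ.<-dense lo<hi
      where
      lo<hi : a ℚ.⊔ c < b ℚ.⊓ d
      lo<hi with ℚ.≤-total a c | ℚ.≤-total b d
      ... | inj₁ a≤c | inj₁ b≤d rewrite ℚ.p≤q⇒p⊔q≡q a≤c | ℚ.p≤q⇒p⊓q≡p b≤d = c<b
      ... | inj₁ a≤c | inj₂ d≤b rewrite ℚ.p≤q⇒p⊔q≡q a≤c | ℚ.p≥q⇒p⊓q≡q d≤b = c<d
      ... | inj₂ c≤a | inj₁ b≤d rewrite ℚ.p≥q⇒p⊔q≡p c≤a | ℚ.p≤q⇒p⊓q≡p b≤d = a<b
      ... | inj₂ c≤a | inj₂ d≤b rewrite ℚ.p≥q⇒p⊔q≡p c≤a | ℚ.p≥q⇒p⊓q≡q d≤b = a<d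
    ... | M , lo<M , M<hi = M , ℚ.≤-<-trans (ℚ.p≤p⊔q a c) lo<M , ℚ.≤-<-trans (ℚ.p≤q⊔p a c) lo<M
                              , ℚ.<-≤-trans M<hi (ℚ.p⊓q≤p b d) , ℚ.<-≤-trans M<hi (ℚ.p⊓q≤q b d)

    all-false : ∀ {a b c d} → a ≡ false → b ≡ false → c ≡ false → d ≡ false → a xor b ≡ c xor d
    all-false refl refl refl refl = refl

    -- Sweeping from the left end to the right end of s, a segment enters or leaves
    -- the part of the plane above s only through an endpoint in the open strip above s.
    sweep : ∀ s t → does (overLeft? s t) xor does (overRight? s t) ≡
                    does (region? s (xl t) (yl t)) xor does (region? s (xr t) (yr t))
    sweep s t with s ≟S t
    ... | yes refl = all-false
      (dec-false (overLeft? s s) λ where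
        (_ , inj₁ lt) → ℚ.<-irrefl refl lt
        (_ , inj₂ (_ , lt)) → ℚ.<-irrefl refl lt)
      (dec-false (overRight? s s) λ where
        (_ , inj₁ lt) → ℚ.<-irrefl refl lt
        (_ , inj₂ (_ , lt)) → ℚ.<-irrefl refl lt)
      (dec-false (region? s (xl s) (yl s)) (λ ((lt , _) , _) → ℚ.<-irrefl refl lt))
      (dec-false (region? s (xr s) (yr s)) (λ ((_ , lt) , _) → ℚ.<-irrefl refl lt))
    ... | no s≢t with xl s <? xr t | xl t <? xr s
    ...   | yes s<t | yes t<s = let (M , ls , lt , rs , rt) = common-point (xl<xr s) s<t t<s (xl<xr t) in
      xor-cross (does (overLeft? s t)) (does (region? s (xl t) (yl t))) (does (overRight? s t)) (does (region? s (xr t) (yr t))) _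
        (overLeft-region s≢t ls lt rs rt) (overRight-region s≢t ls lt rs rt)
    ...   | no s≮t | _ = all-false
      (dec-false (overLeft? s t) (λ ((_ , s<t) , _) → s≮t s<t))
      (dec-false (overRight? s t) (λ ((_ , s≤t) , _) → s≮t (ℚ.<-≤-trans (xl<xr s) s≤t)))
      (dec-false (region? s (xl t) (yl t)) (λ ((s<t , _) , _) → s≮t (ℚ.<-trans s<t (xl<xr t))))
      (dec-false (region? s (xr t) (yr t)) (λ ((s<t , _) , _) → s≮t s<t))
    ...   | yes _ | no t≮s = all-false
      (dec-false (overLeft? s t) (λ ((t≤s , _) , _) → t≮s (ℚ.≤-<-trans t≤s (xl<xr s))))
      (dec-false (overRight? s t) (λ ((t<s , _) , _) → t≮s t<s))
      (dec-false (region? s (xl t) (yl t)) (λ ((_ , t<s) , _) → t≮s t<s))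
      (dec-false (region? s (xr t) (yr t)) (λ ((_ , t<s) , _) → t≮s (ℚ.<-trans (xl<xr t) t<s)))

    -- The parity of a cycle above a point, along a segment and around a corner.

    module Cycles {Z : Set} (val : Z → S → Bool)
      (cycle : ∀ z (R : ℚ → ℚ → Bool) → ⨁ segs (λ t → val z t ∧ (R (xl t) (yl t) xor R (xr t) (yr t))) ≡ false)
      where
      open ≡-Reasoning

      -- The functionals of the points just above the two ends of `s` and just below `s`. For the
      -- point below, `s` itself is one more segment overhead.
      upLeft upRight down : S → Z → Bool
      upLeft  s z = ⨁ segs (λ t → val z t ∧ does (overLeft? s t))
      upRight s z = ⨁ segs (λ t → val z t ∧ does (overRight? s t))
      down    s z = upLeft s z xor val z s

      -- `f` and `g` differ by the coboundary of `R`, and a cycle pairs to zero with every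
      -- coboundary.
      homologous : ∀ z {f g : S → Bool} (R : ℚ → ℚ → Bool) →
        (∀ t → f t xor g t ≡ R (xl t) (yl t) xor R (xr t) (yr t)) →
        ⨁ segs (λ t → val z t ∧ f t) ≡ ⨁ segs (λ t → val z t ∧ g t)
      homologous z {f} {g} R eq = xor≡false⇒≡ _ _ (begin
        ⨁ segs (λ t → val z t ∧ f t) xor ⨁ segs (λ t → val z t ∧ g t) ≡⟨ 𝔽₂.∑-∙ segs _ _ ⟨
        ⨁ segs (λ t → (val z t ∧ f t) xor (val z t ∧ g t))            ≡⟨ 𝔽₂.∑-cong segs (λ t →
          ≡-trans (≡-sym (∧-distribˡ-xor (val z t) (f t) (g t))) (cong (val z t ∧_) (eq t))) ⟩
        ⨁ segs (λ t → val z t ∧ (R (xl t) (yl t) xor R (xr t) (yr t))) ≡⟨ cycle z R ⟩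
        false ∎)

      upLeft≡upRight : ∀ s z → upLeft s z ≡ upRight s z
      upLeft≡upRight s z = homologous z (λ x y → does (region? s x y)) (sweep s)

      module Corner (I : (Z → Bool) → Bool) (I-ext : ∀ {f g} → (∀ z → f z ≡ g z) → I f ≡ I g) (X Y : ℚ) where

        at? : ∀ x y → Dec (x ≡ X × y ≡ Y)
        at? x y = (x ≟ X) ×-dec (y ≟ Y)

        starts? : ∀ t → Dec (xl t ≡ X × yl t ≡ Y)
        starts? t = at? (xl t) (yl t)

        ends? : ∀ t → Dec (xr t ≡ X × yr t ≡ Y)
        ends? t = at? (xr t) (yr t)

        height-start : ∀ {t} → xl t ≡ X × yl t ≡ Y → height t X ≡ Y
        height-start {t} (refl , refl) = height-xl t

        height-end : ∀ {t} → xr t ≡ X × yr t ≡ Y → height t X ≡ Y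
        height-end {t} (refl , refl) = height-xr t

        over⁺? : ∀ t → Dec ((xl t ≤ X × X < xr t) × Y < height t X)
        over⁺? t = ((xl t ≤? X) ×-dec (X <? xr t)) ×-dec (Y <? height t X)

        over⁻? : ∀ t → Dec ((xl t < X × X ≤ xr t) × Y < height t X)
        over⁻? t = ((xl t <? X) ×-dec (X ≤? xr t)) ×-dec (Y <? height t X)

        ray? : ∀ x y → Dec (x ≡ X × Y < y)
        ray? x y = (x ≟ X) ×-dec (Y <? y)

        -- When the vertical ray above the corner is crossed sideways, a segment is gained or lost
        -- only through an endpoint on the ray.
        over-ray : ∀ t → does (over⁺? t) xor does (over⁻? t) ≡ does (ray? (xl t) (yl t)) xor does (ray? (xr t) (yr t))
        over-ray t with <-cmp (xl t) X
        ... | tri> _ ≢X X<l = all-false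
          (dec-false (over⁺? t) (λ ((l≤X , _) , _) → ℚ.<-irrefl refl (ℚ.<-≤-trans X<l l≤X)))
          (dec-false (over⁻? t) (λ ((l<X , _) , _) → ℚ.<-asym X<l l<X))
          (dec-false (ray? (xl t) (yl t)) (≢X ∘ proj₁))
          (dec-false (ray? (xr t) (yr t)) (λ (r≡X , _) → ℚ.<-irrefl (≡-sym r≡X) (ℚ.<-trans X<l (xl<xr t))))
        ... | tri≈ ≮X refl _ = cong₂ _xor_
          (does-⇔ (λ (_ , lt) → refl , subst (Y <_) (height-xl t) lt)
                  (λ (_ , lt) → (ℚ.≤-refl , xl<xr t) , subst (Y <_) (≡-sym (height-xl t)) lt)
                  (over⁺? t) (ray? (xl t) (yl t)))
          (≡-trans (dec-false (over⁻? t) (λ ((l<X , _) , _) → ≮X l<X))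
            (≡-sym (dec-false (ray? (xr t) (yr t)) (λ (r≡X , _) → ℚ.<-irrefl (≡-sym r≡X) (xl<xr t)))))
        ... | tri< l<X ≢X _ with <-cmp (xr t) X
        ...   | tri< r<X r≢X _ = all-false
          (dec-false (over⁺? t) (λ ((_ , X<r) , _) → ℚ.<-asym r<X X<r))
          (dec-false (over⁻? t) (λ ((_ , X≤r) , _) → ℚ.<-irrefl refl (ℚ.<-≤-trans r<X X≤r)))
          (dec-false (ray? (xl t) (yl t)) (≢X ∘ proj₁))
          (dec-false (ray? (xr t) (yr t)) (r≢X ∘ proj₁))
        ...   | tri≈ _ refl X≮ = cong₂ _xor_
          (≡-trans (dec-false (over⁺? t) (λ ((_ , X<r) , _) → X≮ X<r))
            (≡-sym (dec-false (ray? (xl t) (yl t)) (≢X ∘ proj₁))))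
          (does-⇔ (λ (_ , lt) → refl , subst (Y <_) (height-xr t) lt)
                  (λ (_ , lt) → (l<X , ℚ.≤-refl) , subst (Y <_) (≡-sym (height-xr t)) lt)
                  (over⁻? t) (ray? (xr t) (yr t)))
        ...   | tri> _ r≢X X<r = ≡-trans
          (cong (_xor does (over⁻? t)) (does-⇔
            (λ (_ , lt) → (l<X , ℚ.<⇒≤ X<r) , lt) (λ (_ , lt) → (ℚ.<⇒≤ l<X , X<r) , lt) (over⁺? t) (over⁻? t)))
          (≡-trans (xor-same (does (over⁻? t)))
            (≡-sym (cong₂ _xor_ (dec-false (ray? (xl t) (yl t)) (≢X ∘ proj₁)) (dec-false (ray? (xr t) (yr t)) (r≢X ∘ proj₁)))))

        -- The parity overhead just to the right and just to the left of the corner. The strict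
        -- inequality in `over⁺?` and `over⁻?` leaves out the segments that issue from the corner
        -- itself.
        A⁺ A⁻ : Z → Bool
        A⁺ z = ⨁ segs (λ t → val z t ∧ does (over⁺? t))
        A⁻ z = ⨁ segs (λ t → val z t ∧ does (over⁻? t))

        A⁺≡A⁻ : ∀ z → A⁺ z ≡ A⁻ z
        A⁺≡A⁻ z = homologous z (λ x y → does (ray? x y)) over-ray

        outgoing incoming : List S
        outgoing = filter starts? segs
        incoming = filter ends? segs

        -- By `noncrossing` a segment through the corner ends there, and one that continues to the
        -- right can only have it as its left end.
        through-start : ∀ {s t} → xl s ≡ X × yl s ≡ Y → xl t ≤ X → X < xr t → height t X ≡ Y → xl t ≡ X × yl t ≡ Y
        through-start {s} {t} s-at@(xl≡ , _) l≤X X<r h with s ≟S t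
        ... | yes refl = s-at
        ... | no s≢t with noncrossing (s≢t ∘ ≡-sym) l≤X (ℚ.<⇒≤ X<r) (ℚ.≤-reflexive xl≡)
                           (ℚ.<⇒≤ (subst (_< xr s) xl≡ (xl<xr s))) (≡-trans h (≡-sym (height-start s-at)))
        ...   | inj₁ refl = refl , ≡-trans (≡-sym (height-xl t)) h
        ...   | inj₂ refl = ⊥-elim (ℚ.<-irrefl refl X<r)

        through-end : ∀ {s t} → xr s ≡ X × yr s ≡ Y → xl t < X → X ≤ xr t → height t X ≡ Y → xr t ≡ X × yr t ≡ Y
        through-end {s} {t} s-at@(xr≡ , _) l<X X≤r h with s ≟S t
        ... | yes refl = s-at
        ... | no s≢t with noncrossing (s≢t ∘ ≡-sym) (ℚ.<⇒≤ l<X) X≤r (ℚ.<⇒≤ (subst (xl s <_) xr≡ (xl<xr s)))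
                           (ℚ.≤-reflexive (≡-sym xr≡)) (≡-trans h (≡-sym (height-end s-at)))
        ...   | inj₁ refl = ⊥-elim (ℚ.<-irrefl refl l<X)
        ...   | inj₂ refl = refl , ≡-trans (≡-sym (height-xr t)) h

        -- Just to the right of the corner, a segment above `s` either passes over the corner or
        -- starts there with a larger slope.
        overLeft-split : ∀ {s} → xl s ≡ X × yl s ≡ Y → ∀ t →
          does (overLeft? s t) ≡ does (over⁺? t) xor (does (starts? t) ∧ does (m s <? m t))
        overLeft-split {s} s-at@(refl , _) t with over⁺? t
        ... | yes (spans , lt) = ≡-trans
          (dec-true (overLeft? s t) (spans , inj₁ (subst (_< height t X) (≡-sym (height-start s-at)) lt)))
          (≡-sym (cong₂ (λ a b → a xor (b ∧ does (m s <? m t))) (dec-true (over⁺? t) (spans , lt))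
            (dec-false (starts? t) (λ t-at → ℚ.<-irrefl (≡-sym (height-start t-at)) lt))))
        ... | no ¬over = ≡-trans (does-⇔ to from (overLeft? s t) (starts? t ×-dec (m s <? m t)))
          (cong (_xor (does (starts? t) ∧ does (m s <? m t))) (≡-sym (dec-false (over⁺? t) ¬over)))
          where
          to : OverLeft s t → (xl t ≡ X × yl t ≡ Y) × m s < m t
          to (spans , inj₁ lt) = ⊥-elim (¬over (spans , subst (_< height t X) (height-start s-at) lt))
          to ((l≤X , X<r) , inj₂ (eq , ms<mt)) = through-start s-at l≤X X<r (≡-trans (≡-sym eq) (height-start s-at)) , ms<mt
          from : (xl t ≡ X × yl t ≡ Y) × m s < m t → OverLeft s t
          from (t-at@(l≡X , _) , ms<mt) = (ℚ.≤-reflexive l≡X , subst (_< xr t) l≡X (xl<xr t)) ,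
            inj₂ (≡-trans (height-start s-at) (≡-sym (height-start t-at)) , ms<mt)

        overRight-split : ∀ {s} → xr s ≡ X × yr s ≡ Y → ∀ t →
          does (overRight? s t) ≡ does (over⁻? t) xor (does (ends? t) ∧ does (m t <? m s))
        overRight-split {s} s-at@(refl , _) t with over⁻? t
        ... | yes (spans , lt) = ≡-trans
          (dec-true (overRight? s t) (spans , inj₁ (subst (_< height t X) (≡-sym (height-end s-at)) lt)))
          (≡-sym (cong₂ (λ a b → a xor (b ∧ does (m t <? m s))) (dec-true (over⁻? t) (spans , lt))
            (dec-false (ends? t) (λ t-at → ℚ.<-irrefl (≡-sym (height-end t-at)) lt))))
        ... | no ¬over = ≡-trans (does-⇔ to from (overRight? s t) (ends? t ×-dec (m t <? m s)))
          (cong (_xor (does (ends? t) ∧ does (m t <? m s))) (≡-sym (dec-false (over⁻? t) ¬over)))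
          where
          to : OverRight s t → (xr t ≡ X × yr t ≡ Y) × m t < m s
          to (spans , inj₁ lt) = ⊥-elim (¬over (spans , subst (_< height t X) (height-end s-at) lt))
          to ((l<X , X≤r) , inj₂ (eq , mt<ms)) = through-end s-at l<X X≤r (≡-trans (≡-sym eq) (height-end s-at)) , mt<ms
          from : (xr t ≡ X × yr t ≡ Y) × m t < m s → OverRight s t
          from (t-at@(r≡X , _) , mt<ms) = (subst (xl t <_) r≡X (xl<xr t) , ℚ.≤-reflexive (≡-sym r≡X)) ,
            inj₂ (≡-trans (height-end s-at) (≡-sym (height-end t-at)) , mt<ms)

        -- Both orders run from top to bottom: to the right of the corner the steeper segment is the
        -- higher one, to the left the less steep one.
        module T⁺ = Telescope val I I-ext {λ t s → m s < m t} (λ t s → m s <? m t) (λ p q → ℚ.<-asym p q)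
        module T⁻ = Telescope val I I-ext {λ t s → m t < m s} (λ t s → m t <? m s) (λ p q → ℚ.<-asym p q)

        split-sum : ∀ {P : S → Set} (P? : ∀ t → Dec (P t)) z (o q : S → Bool) →
          ⨁ segs (λ t → val z t ∧ (o t xor (does (P? t) ∧ q t))) ≡
          ⨁ segs (λ t → val z t ∧ o t) xor ⨁ (filter P? segs) (λ t → q t ∧ val z t)
        split-sum P? z o q = begin
          ⨁ segs (λ t → val z t ∧ (o t xor (does (P? t) ∧ q t)))
            ≡⟨ 𝔽₂.∑-cong segs (λ t → ≡-trans (∧-distribˡ-xor (val z t) (o t) _) (cong ((val z t ∧ o t) xor_)
                 (≡-trans (∧-comm (val z t) _) (∧-assoc (does (P? t)) (q t) (val z t))))) ⟩
          ⨁ segs (λ t → (val z t ∧ o t) xor (does (P? t) ∧ (q t ∧ val z t)))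
            ≡⟨ 𝔽₂.∑-∙ segs _ _ ⟩
          ⨁ segs (λ t → val z t ∧ o t) xor ⨁ segs (λ t → does (P? t) ∧ (q t ∧ val z t))
            ≡⟨ cong (⨁ segs (λ t → val z t ∧ o t) xor_) (⨁-filter P? segs _) ⟨
          ⨁ segs (λ t → val z t ∧ o t) xor ⨁ (filter P? segs) (λ t → q t ∧ val z t) ∎

        upLeft-corner : ∀ {s} → xl s ≡ X × yl s ≡ Y → ∀ z → upLeft s z ≡ A⁺ z xor T⁺.before outgoing s z
        upLeft-corner {s} s-at z = ≡-trans (𝔽₂.∑-cong segs (λ t → cong (val z t ∧_) (overLeft-split s-at t)))
                                           (split-sum starts? z (λ t → does (over⁺? t)) (λ t → does (m s <? m t)))

        upRight-corner : ∀ {s} → xr s ≡ X × yr s ≡ Y → ∀ z → upRight s z ≡ A⁻ z xor T⁻.before incoming s z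
        upRight-corner {s} s-at z = ≡-trans (𝔽₂.∑-cong segs (λ t → cong (val z t ∧_) (overRight-split s-at t)))
                                            (split-sum ends? z (λ t → does (over⁻? t)) (λ t → does (m t <? m s)))

        comparable : ∀ xs → Unique xs → (∀ {s t} → s ∈ xs → t ∈ xs → s ≢ t → m s ≢ m t) →
          AllPairs (λ s t → m s < m t ⊎ m t < m s) xs
        comparable [] [] h = []
        comparable (x ∷ xs) (x∉ ∷ u) h =
          All.tabulate (λ {t} t∈ → cmp x t (h (here refl) (there t∈) (All.lookup x∉ t∈)))
          ∷ comparable xs u (λ s∈ t∈ → h (there s∈) (there t∈))
          where
          cmp : ∀ s t → m s ≢ m t → m s < m t ⊎ m t < m s
          cmp s t ≢ with <-cmp (m s) (m t)
          ... | tri< lt _ _ = inj₁ lt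
          ... | tri≈ _ eq _ = ⊥-elim (≢ eq)
          ... | tri> _ _ gt = inj₂ gt

        -- Two segments of equal slope from one corner would overlap to its right.
        slopes-outgoing : ∀ {s t} → s ∈ outgoing → t ∈ outgoing → s ≢ t → m s ≢ m t
        slopes-outgoing {s} {t} s∈ t∈ s≢t =
          let s-at = proj₂ (∈-filter⁻ starts? {xs = segs} s∈)
              t-at = proj₂ (∈-filter⁻ starts? {xs = segs} t∈)
              l≡   = ≡-trans (proj₁ s-at) (≡-sym (proj₁ t-at))
              (M , ls , lt , rs , rt) = common-point (xl<xr s) (subst (_< xr t) (≡-sym l≡) (xl<xr t))
                                                (subst (_< xr s) l≡ (xl<xr s)) (xl<xr t)
          in parallel⇒⊥ s≢t ls lt rs rt {X} (≡-trans (height-start s-at) (≡-sym (height-start t-at)))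

        slopes-incoming : ∀ {s t} → s ∈ incoming → t ∈ incoming → s ≢ t → m s ≢ m t
        slopes-incoming {s} {t} s∈ t∈ s≢t =
          let s-at = proj₂ (∈-filter⁻ ends? {xs = segs} s∈)
              t-at = proj₂ (∈-filter⁻ ends? {xs = segs} t∈)
              r≡   = ≡-trans (proj₁ s-at) (≡-sym (proj₁ t-at))
              (M , ls , lt , rs , rt) = common-point (xl<xr s) (subst (xl s <_) r≡ (xl<xr s))
                                                (subst (xl t <_) (≡-sym r≡) (xl<xr t)) (xl<xr t)
          in parallel⇒⊥ s≢t ls lt rs rt {X} (≡-trans (height-end s-at) (≡-sym (height-end t-at)))

        -- With `I` the indicator of a face, this says that exactly one side of `s` belongs to the
        -- face.
        boundary : S → Bool
        boundary s = I (upLeft s) xor I (down s)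

        sum-outgoing : ⨁ outgoing boundary ≡ I A⁺ xor I (λ z → A⁺ z xor ⨁ outgoing (val z))
        sum-outgoing = ≡-trans
          (𝔽₂.∑-cong∈ outgoing (λ {s} s∈ → let eq = upLeft-corner (proj₂ (∈-filter⁻ starts? {xs = segs} s∈)) in
            cong₂ _xor_ (I-ext eq) (I-ext (λ z → cong (_xor val z s) (eq z)))))
          (T⁺.telescope (λ p q → ℚ.<-trans q p) outgoing
            (AllPairs.map swap⊎ (comparable outgoing (Unique.filter⁺ starts? segs!) slopes-outgoing)) A⁺)

        sum-incoming : ⨁ incoming boundary ≡ I A⁻ xor I (λ z → A⁻ z xor ⨁ incoming (val z))
        sum-incoming = ≡-trans
          (𝔽₂.∑-cong∈ incoming (λ {s} s∈ →
            let eq = λ z → ≡-trans (upLeft≡upRight s z) (upRight-corner (proj₂ (∈-filter⁻ ends? {xs = segs} s∈)) z) in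
            cong₂ _xor_ (I-ext eq) (I-ext (λ z → cong (_xor val z s) (eq z)))))
          (T⁻.telescope ℚ.<-trans incoming (comparable incoming (Unique.filter⁺ ends? segs!) slopes-incoming) A⁻)

        -- The cycle condition for the indicator function of the corner.
        kirchhoff : ∀ z → ⨁ outgoing (val z) ≡ ⨁ incoming (val z)
        kirchhoff z = begin
          ⨁ outgoing (val z) ≡⟨ ⨁-filter starts? segs _ ⟩
          ⨁ segs (λ t → does (starts? t) ∧ val z t) ≡⟨ 𝔽₂.∑-cong segs (λ t → ∧-comm _ (val z t)) ⟩
          ⨁ segs (λ t → val z t ∧ does (starts? t)) ≡⟨ homologous z (λ x y → does (at? x y)) (λ t → refl) ⟩
          ⨁ segs (λ t → val z t ∧ does (ends? t)) ≡⟨ 𝔽₂.∑-cong segs (λ t → ∧-comm (val z t) _) ⟩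
          ⨁ segs (λ t → does (ends? t) ∧ val z t) ≡⟨ ⨁-filter ends? segs _ ⟨
          ⨁ incoming (val z) ∎

        -- The half turns on the right and on the left both lead from directly above the corner to
        -- directly below it. By `A⁺≡A⁻` and `kirchhoff` they begin with the same functional and
        -- finish with the same functional, so the two telescoped sums coincide and cancel.
        boundary-closed : ⨁ segs (λ t → (does (starts? t) xor does (ends? t)) ∧ boundary t) ≡ false
        boundary-closed = begin
          ⨁ segs (λ t → (does (starts? t) xor does (ends? t)) ∧ boundary t)
            ≡⟨ 𝔽₂.∑-cong segs (λ t → ∧-distribʳ-xor (boundary t) (does (starts? t)) _) ⟩
          ⨁ segs (λ t → (does (starts? t) ∧ boundary t) xor (does (ends? t) ∧ boundary t))
            ≡⟨ 𝔽₂.∑-∙ segs _ _ ⟩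
          ⨁ segs (λ t → does (starts? t) ∧ boundary t) xor ⨁ segs (λ t → does (ends? t) ∧ boundary t)
            ≡⟨ cong₂ _xor_ (⨁-filter starts? segs _) (⨁-filter ends? segs _) ⟨
          ⨁ outgoing boundary xor ⨁ incoming boundary
            ≡⟨ cong₂ _xor_ sum-outgoing sum-incoming ⟩
          (I A⁺ xor I (λ z → A⁺ z xor ⨁ outgoing (val z))) xor (I A⁻ xor I (λ z → A⁻ z xor ⨁ incoming (val z)))
            ≡⟨ cong₂ (λ a b → (a xor b) xor (I A⁻ xor I (λ z → A⁻ z xor ⨁ incoming (val z))))
                 (I-ext A⁺≡A⁻) (I-ext (λ z → cong₂ _xor_ (A⁺≡A⁻ z) (kirchhoff z))) ⟩
          (I A⁻ xor I (λ z → A⁻ z xor ⨁ incoming (val z))) xor (I A⁻ xor I (λ z → A⁻ z xor ⨁ incoming (val z)))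
            ≡⟨ xor-same (I A⁻ xor I (λ z → A⁻ z xor ⨁ incoming (val z))) ⟩
          false ∎

  -- Polygonal arcs without degenerate segments.

  _≟P_ : DecidableEquality Point
  _≟P_ = ≡-dec _≟_ _≟_

  onSeg-start : ∀ p q → OnSeg p q p
  onSeg-start (p₁ , p₂) (q₁ , q₂) = 0ℚ , ℚ.≤-refl , ℚ.<⇒≤ (ℚ.positive⁻¹ 1ℚ) , lem p₁ q₁ , lem p₂ q₂
    where
    lem : ∀ p q → p ≡ p + 0ℚ * (q - p)
    lem = solve-∀ ℚ-ring

  onSeg-sym : ∀ p q {r} → OnSeg p q r → OnSeg q p r
  onSeg-sym (p₁ , p₂) (q₁ , q₂) (t , 0≤t , t≤1 , refl , refl) =
    1ℚ - t , 0≤q-p t≤1 , 0≤q-p⇒p≤q (subst (0ℚ ≤_) (lem₁ t) 0≤t) , lem₂ p₁ q₁ t , lem₂ p₂ q₂ t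
    where
    lem₁ : ∀ t → t ≡ 1ℚ - (1ℚ - t)
    lem₁ = solve-∀ ℚ-ring
    lem₂ : ∀ p q t → p + t * (q - p) ≡ q + (1ℚ - t) * (p - q)
    lem₂ = solve-∀ ℚ-ring

  onSeg-end : ∀ p q → OnSeg p q q
  onSeg-end p q = onSeg-sym q p (onSeg-start q p)

  module _ {a b : Point} where
    open PolyArc

    Nondegenerate : PolyArc a b → Set
    Nondegenerate A = ∀ i → pt A (inject₁ i) ≢ pt A (suc i)

    dropFirst : ∀ {k′} (A : PolyArc a b) → k A ≡ suc k′ → pt A zero ≡ pt A (suc zero) →
      Σ (PolyArc a b) λ A′ → (∀ r → OnArc A′ r → OnArc A r) × k A′ ≡ k′
    dropFirst A@record { k = suc k′ } refl deg = A′ , (λ r (i , on) → suc i , on) , refl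
      where
      A′ : PolyArc a b
      A′ .k = k′
      A′ .pt i = pt A (suc i)
      A′ .start = ≡-trans (≡-sym deg) (start A)
      A′ .end = end A
      A′ .simple i j r i<j oni onj with simple A (suc i) (suc j) r (s≤s i<j) oni onj
      ... | eq , r≡ = ℕ.suc-injective eq , r≡

    dropLast : ∀ {k′} (A : PolyArc a b) → k A ≡ suc k′ → pt A (inject₁ (fromℕ (k A))) ≡ pt A (suc (fromℕ (k A))) →
      Σ (PolyArc a b) λ A′ → (∀ r → OnArc A′ r → OnArc A r) × k A′ ≡ k′
    dropLast A@record { k = suc k′ } refl deg = A′ , (λ r (i , on) → inject₁ i , on) , refl
      where
      A′ : PolyArc a b
      A′ .k = k′
      A′ .pt i = pt A (inject₁ i)
      A′ .start = start A
      A′ .end = ≡-trans deg (end A)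
      A′ .simple i j r i<j oni onj
        with simple A (inject₁ i) (inject₁ j) r (subst₂ ℕ._<_ (≡-sym (toℕ-inject₁ i)) (≡-sym (toℕ-inject₁ j)) i<j) oni onj
      ... | eq , r≡ = ≡-trans (≡-sym (toℕ-inject₁ j)) (≡-trans eq (cong suc (toℕ-inject₁ i))) , r≡

    seg-start : (A : PolyArc a b) → ∀ i → OnSeg (pt A (inject₁ i)) (pt A (suc i)) (pt A (inject₁ i))
    seg-start A i = onSeg-start (pt A (inject₁ i)) (pt A (suc i))

    seg-end : (A : PolyArc a b) → ∀ i → OnSeg (pt A (inject₁ i)) (pt A (suc i)) (pt A (suc i))
    seg-end A i = onSeg-end (pt A (inject₁ i)) (pt A (suc i))

    onSeg-resp : (A : PolyArc a b) → ∀ i {r r′} → r ≡ r′ →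
      OnSeg (pt A (inject₁ i)) (pt A (suc i)) r → OnSeg (pt A (inject₁ i)) (pt A (suc i)) r′
    onSeg-resp A i refl on = on

    meet⇒adjacent : (A : PolyArc a b) → ∀ i j → toℕ i ℕ.< toℕ j → pt A (suc i) ≡ pt A (inject₁ j) → toℕ j ≡ suc (toℕ i)
    meet⇒adjacent A i j i<j eq =
      proj₁ (simple A i j (pt A (suc i)) i<j (seg-end A i) (onSeg-resp A j (≡-sym eq) (seg-start A j)))

    -- An interior degenerate segment would make its two neighbours meet.
    nondegenerate-interior : (A : PolyArc a b) → pt A zero ≢ pt A (suc zero) →
      pt A (inject₁ (fromℕ (k A))) ≢ pt A (suc (fromℕ (k A))) → Nondegenerate A
    nondegenerate-interior A first last zero = first
    nondegenerate-interior A first last (suc i) deg = interior (suc i) refl (view (suc i))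
      where
      interior : ∀ j → j ≡ suc i → View j → ⊥
      interior _ eq ‵fromℕ = last (subst (λ j → pt A (inject₁ j) ≡ pt A (suc j)) (≡-sym eq) deg)
      interior _ eq (‵inject₁ j) = ℕ.1+n≢n
        (≡-trans (cong suc (≡-sym j≡)) (≡-trans (meet⇒adjacent A (inject₁ i) (suc j) lt pts) (cong suc (toℕ-inject₁ i))))
        where
        j≡ : toℕ j ≡ suc (toℕ i)
        j≡ = ≡-trans (≡-sym (toℕ-inject₁ j)) (cong toℕ eq)
        lt : toℕ (inject₁ i) ℕ.< toℕ (suc j)
        lt = subst₂ ℕ._<_ (≡-sym (toℕ-inject₁ i)) (cong suc (≡-sym j≡)) (ℕ.m<n⇒m<1+n (ℕ.n<1+n _))
        pts : pt A (suc (inject₁ i)) ≡ pt A (inject₁ (suc j))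
        pts = ≡-trans deg (≡-sym (cong (λ j → pt A (suc j)) eq))

    -- By `nondegenerate-interior` it suffices to treat the two extreme segments. Removing one keeps
    -- the arc inside the original, which preserves its separation from other arcs, and lowers the
    -- number of segments. A lone degenerate segment would give `a ≡ b`.
    normalise : a ≢ b → ∀ n (A : PolyArc a b) → k A ≡ n →
      Σ (PolyArc a b) λ A′ → (∀ r → OnArc A′ r → OnArc A r) × Nondegenerate A′
    normalise a≢b n A eq with pt A zero ≟P pt A (suc zero)
    normalise a≢b zero record { k = .zero ; start = s ; end = e } refl | yes deg =
      ⊥-elim (a≢b (≡-trans (≡-sym s) (≡-trans deg e)))
    normalise a≢b (suc n) A eq | yes deg with dropFirst A eq deg
    ... | A₁ , sub₁ , eq₁ with normalise a≢b n A₁ eq₁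
    ...   | A₂ , sub₂ , nd = A₂ , (λ r → sub₁ r ∘ sub₂ r) , nd
    normalise a≢b n A eq | no first with pt A (inject₁ (fromℕ (k A))) ≟P pt A (suc (fromℕ (k A)))
    ... | no last = A , (λ _ → id) , nondegenerate-interior A first last
    normalise a≢b zero record { k = .zero } refl | no first | yes deg = ⊥-elim (first deg)
    normalise a≢b (suc n) A eq | no first | yes deg with dropLast A eq deg
    ... | A₁ , sub₁ , eq₁ with normalise a≢b n A₁ eq₁
    ...   | A₂ , sub₂ , nd = A₂ , (λ r → sub₁ r ∘ sub₂ r) , nd

    onArc-pt : (A : PolyArc a b) → ∀ i → OnArc A (pt A i)
    onArc-pt A zero    = zero , seg-start A zero
    onArc-pt A (suc i) = i , seg-end A i

    -- If the endpoint of the arc lies on another segment than the extreme one, `simple` applied to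
    -- this pair makes it their joint.
    end-of-segment : (A : PolyArc a b) → ∀ i {r} → OnSeg (pt A (inject₁ i)) (pt A (suc i)) r →
      r ≡ a ⊎ r ≡ b → r ≡ pt A (inject₁ i) ⊎ r ≡ pt A (suc i)
    end-of-segment A zero    on (inj₁ r≡a) = inj₁ (≡-trans r≡a (≡-sym (start A)))
    end-of-segment A (suc i) {r} on (inj₁ r≡a) =
      inj₁ (≡-trans (proj₂ adj) (cong (λ j → pt A (suc j)) (toℕ-injective (≡-sym (≡-trans (toℕ-inject₁ i) (ℕ.suc-injective (proj₁ adj)))))))
      where
      adj : toℕ (suc i) ≡ 1 × r ≡ pt A (suc zero)
      adj = simple A zero (suc i) r (s≤s z≤n) (onSeg-resp A zero (≡-trans (start A) (≡-sym r≡a)) (seg-start A zero)) on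
    end-of-segment A i {r} on (inj₂ r≡b) with i Fin.≟ fromℕ (k A)
    ... | yes refl = inj₂ (≡-trans r≡b (≡-sym (end A)))
    ... | no i≢ = inj₂ (proj₂ (simple A i (fromℕ (k A)) r i< on
                    (onSeg-resp A (fromℕ (k A)) (≡-trans (end A) (≡-sym r≡b)) (seg-end A (fromℕ (k A))))))
      where
      i< : toℕ i ℕ.< toℕ (fromℕ (k A))
      i< = ℕ.≤∧≢⇒< (subst (toℕ i ℕ.≤_) (≡-sym (toℕ-fromℕ (k A))) (toℕ≤pred[n] i)) (i≢ ∘ toℕ-injective)

    pt-distinct : (A : PolyArc a b) → Nondegenerate A → ∀ i j → toℕ i ℕ.< toℕ j → pt A i ≢ pt A j
    pt-distinct A nd i (suc j) lt eq with view i
    ... | ‵fromℕ = ℕ.<-irrefl refl (ℕ.<-≤-trans lt (subst (toℕ (suc j) ℕ.≤_) (≡-sym (toℕ-fromℕ (suc (k A)))) (toℕ≤pred[n] (suc j))))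
    ... | ‵inject₁ i′ with i′ Fin.≟ j
    ...   | yes refl = nd i′ eq
    ...   | no i′≢j = nd i′ (proj₂ (simple A i′ j (pt A (inject₁ i′)) i′<j (seg-start A i′)
                        (onSeg-resp A j (≡-sym eq) (seg-end A j))))
      where
      i′<j : toℕ i′ ℕ.< toℕ j
      i′<j = ℕ.≤∧≢⇒< (ℕ.s≤s⁻¹ (subst (ℕ._< suc (toℕ j)) (toℕ-inject₁ i′) lt)) (i′≢j ∘ toℕ-injective)

    pt-injective : (A : PolyArc a b) → Nondegenerate A → ∀ i j → pt A i ≡ pt A j → i ≡ j
    pt-injective A nd i j eq with ℕ.<-cmp (toℕ i) (toℕ j)
    ... | tri< lt _ _ = ⊥-elim (pt-distinct A nd i j lt eq)
    ... | tri≈ _ e _  = toℕ-injective e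
    ... | tri> _ _ gt = ⊥-elim (pt-distinct A nd j i gt (≡-sym eq))

  -- A shear that leaves no segment vertical.

  module _ {A : Set} (P : A → ℚ → Set) where

    eventually-all : (∀ a → ∃ λ B → ∀ x → B < x → P a x) → ∀ as → ∃ λ B → ∀ x → B < x → ∀ {a} → a ∈ as → P a x
    eventually-all ev []       = 0ℚ , λ _ _ ()
    eventually-all ev (a ∷ as) with ev a | eventually-all ev as
    ... | B₁ , h₁ | B₂ , h₂ = B₁ ℚ.⊔ B₂ , λ where
      x B<x (here refl) → h₁ x (ℚ.≤-<-trans (ℚ.p≤p⊔q B₁ B₂) B<x)
      x B<x (there a∈)  → h₂ x (ℚ.≤-<-trans (ℚ.p≤q⊔p B₁ B₂) B<x) a∈

  -- The new abscissa under (x, y) ↦ (x + cy, y); ordinates are kept.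
  shear : ℚ → Point → ℚ
  shear c (x , y) = x + c * y

  shear-injective : ∀ c p q → shear c p ≡ shear c q → proj₂ p ≡ proj₂ q → p ≡ q
  shear-injective c (p₁ , p₂) (q₁ , _) eq refl = cong (_, p₂) (p-q≡0⇒p≡q
    (≡-trans (lem p₁ q₁ (c * p₂)) (≡-trans (cong (_- (q₁ + c * p₂)) eq) (ℚ.+-inverseʳ (q₁ + c * p₂)))))
    where
    lem : ∀ p q u → p - q ≡ (p + u) - (q + u)
    lem = solve-∀ ℚ-ring

  -- The sheared abscissae are affine in `c`: they agree for a single value if the ordinates differ,
  -- and for none otherwise. Asking for all large `c` lets finitely many conditions combine through
  -- a maximum.
  separated-eventually : ∀ p q → p ≢ q → ∃ λ B → ∀ c → B < c → shear c p ≢ shear c q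
  separated-eventually (p₁ , p₂) (q₁ , q₂) p≢q with p₂ ≟ q₂
  ... | yes p₂≡q₂ = 0ℚ , λ c _ eq → p≢q (shear-injective c (p₁ , p₂) (q₁ , q₂) eq p₂≡q₂)
  ... | no p₂≢q₂ = B , λ c B<c eq → ℚ.<-irrefl (≡-sym (c≡B c eq)) B<c
    where
    instance
      nz : ℚ.NonZero (p₂ - q₂)
      nz = ℚ.≢-nonZero (p₂≢q₂ ∘ p-q≡0⇒p≡q)
    B = (q₁ - p₁) * 1/ (p₂ - q₂)
    lem : ∀ p₁ p₂ q₁ q₂ c → (p₁ + c * p₂) - (q₁ + c * q₂) ≡ c * (p₂ - q₂) - (q₁ - p₁)
    lem = solve-∀ ℚ-ring
    c≡B : ∀ c → p₁ + c * p₂ ≡ q₁ + c * q₂ → c ≡ B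
    c≡B c eq = begin
      c                                   ≡⟨ ℚ.*-identityʳ c ⟨
      c * 1ℚ                              ≡⟨ cong (c *_) (ℚ.*-inverseʳ (p₂ - q₂)) ⟨
      c * ((p₂ - q₂) * 1/ (p₂ - q₂))      ≡⟨ ℚ.*-assoc c _ _ ⟨
      c * (p₂ - q₂) * 1/ (p₂ - q₂)        ≡⟨ cong (_* 1/ (p₂ - q₂)) c*≡ ⟩
      B ∎
      where
      open ≡-Reasoning
      c*≡ : c * (p₂ - q₂) ≡ q₁ - p₁
      c*≡ = p-q≡0⇒p≡q (≡-trans (≡-sym (lem p₁ p₂ q₁ q₂ c))
              (≡-trans (cong (_- (q₁ + c * q₂)) eq) (ℚ.+-inverseʳ (q₁ + c * q₂))))

  slope : ∀ x₁ y₁ x₂ y₂ → x₁ < x₂ → ∃ λ m → y₂ ≡ y₁ + m * (x₂ - x₁)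
  slope x₁ y₁ x₂ y₂ x₁<x₂ = let (r , _ , r*≡1) = recip (0<q-p x₁<x₂) in
    (y₂ - y₁) * r , (begin
      y₂                                    ≡⟨ lem₁ y₁ y₂ ⟩
      y₁ + (y₂ - y₁) * 1ℚ                   ≡⟨ cong (λ u → y₁ + (y₂ - y₁) * u) r*≡1 ⟨
      y₁ + (y₂ - y₁) * (r * (x₂ - x₁))      ≡⟨ cong (y₁ +_) (ℚ.*-assoc (y₂ - y₁) r (x₂ - x₁)) ⟨
      y₁ + (y₂ - y₁) * r * (x₂ - x₁)        ∎)
    where
    open ≡-Reasoning
    lem₁ : ∀ y₁ y₂ → y₂ ≡ y₁ + (y₂ - y₁) * 1ℚ
    lem₁ = solve-∀ ℚ-ring

  -- Undoing the shear takes new abscissa x and ordinate h to (x - ch, h); the parameter along the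
  -- segment is (x - P)/(Q - P).
  onSeg-sheared : ∀ c p q m x → shear c p < shear c q → proj₂ q ≡ proj₂ p + m * (shear c q - shear c p) →
    shear c p ≤ x → x ≤ shear c q →
    OnSeg p q (x - c * (proj₂ p + m * (x - shear c p)) , proj₂ p + m * (x - shear c p))
  onSeg-sheared c p@(p₁ , p₂) q@(q₁ , q₂) m x p<q q₂≡ p≤x x≤q =
    τ , *-nonNeg (0≤q-p p≤x) (ℚ.<⇒≤ 0<r) , 0≤q-p⇒p≤q (subst (0ℚ ≤_) 1-τ (*-nonNeg (0≤q-p x≤q) (ℚ.<⇒≤ 0<r))) , first , second
    where
    open ≡-Reasoning
    P = shear c p
    Q = shear c q
    inv = recip (0<q-p p<q)
    r = proj₁ inv
    0<r = proj₁ (proj₂ inv)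
    r*≡1 : r * (Q - P) ≡ 1ℚ
    r*≡1 = proj₂ (proj₂ inv)
    τ = (x - P) * r
    1-τ : (Q - x) * r ≡ 1ℚ - τ
    1-τ = ≡-trans (lem P Q x r) (cong (_- τ) r*≡1)
      where
      lem : ∀ P Q x r → (Q - x) * r ≡ r * (Q - P) - (x - P) * r
      lem = solve-∀ ℚ-ring
    second : p₂ + m * (x - P) ≡ p₂ + τ * (q₂ - p₂)
    second = begin
      p₂ + m * (x - P)                       ≡⟨ lem₁ p₂ m x P ⟩
      p₂ + m * (x - P) * 1ℚ                  ≡⟨ cong (λ u → p₂ + m * (x - P) * u) r*≡1 ⟨
      p₂ + m * (x - P) * (r * (Q - P))       ≡⟨ lem₂ p₂ m x P Q r ⟩
      p₂ + τ * ((p₂ + m * (Q - P)) - p₂)     ≡⟨ cong (λ u → p₂ + τ * (u - p₂)) q₂≡ ⟨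
      p₂ + τ * (q₂ - p₂) ∎
      where
      lem₁ : ∀ p m x P → p + m * (x - P) ≡ p + m * (x - P) * 1ℚ
      lem₁ = solve-∀ ℚ-ring
      lem₂ : ∀ p m x P Q r → p + m * (x - P) * (r * (Q - P)) ≡ p + (x - P) * r * ((p + m * (Q - P)) - p)
      lem₂ = solve-∀ ℚ-ring
    first : x - c * (p₂ + m * (x - P)) ≡ p₁ + τ * (q₁ - p₁)
    first = begin
      x - c * (p₂ + m * (x - P))                       ≡⟨ cong (λ u → x - c * u) second ⟩
      x - c * (p₂ + τ * (q₂ - p₂))                     ≡⟨ lem₁ x P c p₂ q₂ τ ⟩
      P + (x - P) * 1ℚ - c * (p₂ + τ * (q₂ - p₂))      ≡⟨ cong (λ u → P + (x - P) * u - c * (p₂ + τ * (q₂ - p₂))) r*≡1 ⟨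
      P + (x - P) * (r * (Q - P)) - c * (p₂ + τ * (q₂ - p₂)) ≡⟨ lem₂ x c p₁ p₂ q₁ q₂ r ⟩
      p₁ + τ * (q₁ - p₁) ∎
      where
      lem₁ : ∀ x P c p q t → x - c * (p + t * (q - p)) ≡ P + (x - P) * 1ℚ - c * (p + t * (q - p))
      lem₁ = solve-∀ ℚ-ring
      lem₂ : ∀ x c p₁ p₂ q₁ q₂ r →
        (p₁ + c * p₂) + (x - (p₁ + c * p₂)) * (r * ((q₁ + c * q₂) - (p₁ + c * p₂)))
          - c * (p₂ + (x - (p₁ + c * p₂)) * r * (q₂ - p₂)) ≡ p₁ + (x - (p₁ + c * p₂)) * r * (q₁ - p₁)
      lem₂ = solve-∀ ℚ-ring

  ⨁-consecutive : ∀ k (f : Fin (suc k) → Bool) →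
    ⨁ (allFin k) (λ i → f (inject₁ i) xor f (suc i)) ≡ f zero xor f (fromℕ k)
  ⨁-consecutive zero    f = ≡-sym (xor-same (f zero))
  ⨁-consecutive (suc k) f = begin
    ⨁ (allFin (suc k)) (λ i → f (inject₁ i) xor f (suc i))
      ≡⟨ 𝔽₂.∑-allFin-suc k (λ i → f (inject₁ i) xor f (suc i)) ⟩
    (f zero xor f (suc zero)) xor ⨁ (allFin k) (λ i → f (suc (inject₁ i)) xor f (suc (suc i)))
      ≡⟨ cong ((f zero xor f (suc zero)) xor_) (⨁-consecutive k (f ∘ suc)) ⟩
    (f zero xor f (suc zero)) xor (f (suc zero) xor f (suc (fromℕ k)))
      ≡⟨ xor-cancel-middle (f zero) (f (suc zero)) _ ⟩
    f zero xor f (suc (fromℕ k)) ∎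
    where open ≡-Reasoning

  ⨁-only : ∀ {n} (i : Fin n) (f : Fin n → Bool) → (∀ j → j ≢ i → f j ≡ false) → ⨁ (allFin n) f ≡ f i
  ⨁-only {n} i f off = ≡-trans (𝔽₂.∑-cong (allFin n) guard) (⨁-indicator i f)
    where
    guard : ∀ j → f j ≡ does (j Fin.≟ i) ∧ f j
    guard j with j Fin.≟ i
    ... | yes _  = refl
    ... | no j≢i = off j j≢i

  constant-along : ∀ k (f : Fin (suc k) → Bool) → (∀ i → f (inject₁ i) ≡ f (suc i)) → ∀ i → f i ≡ f zero
  constant-along k       f step zero    = refl
  constant-along (suc k) f step (suc i) = ≡-trans (constant-along k (f ∘ suc) (step ∘ suc) i) (≡-sym (step zero))

  -- From a plane drawing to an arrangement of segments.

  module Drawing {n : ℕ} {H : Graph n} (D : PlaneDrawing H) {ne : ℕ} (src tgt : Fin ne → Fin n)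
    (src<tgt : ∀ e → toℕ (src e) ℕ.< toℕ (tgt e)) (adjacent : ∀ e → H (src e) (tgt e) ≡ true)
    (edge-injective : ∀ e e′ → src e ≡ src e′ → tgt e ≡ tgt e′ → e ≡ e′) where

    open PlaneDrawing D
    open PolyArc
    open ≡-Reasoning

    rawArc : ∀ e → PolyArc (pos (src e)) (pos (tgt e))
    rawArc e = arc (src e) (tgt e) (src<tgt e) (adjacent e)

    abstract
      normalArc : ∀ e → Σ (PolyArc (pos (src e)) (pos (tgt e))) λ A →
        (∀ r → OnArc A r → OnArc (rawArc e) r) × Nondegenerate A
      normalArc e = normalise (λ eq → ℕ.<-irrefl (cong toℕ (pos-inj (src e) (tgt e) eq)) (src<tgt e)) _ (rawArc e) refl

    Arc : ∀ e → PolyArc (pos (src e)) (pos (tgt e))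
    Arc e = proj₁ (normalArc e)

    arcs-meet : ∀ {e e′} → e ≢ e′ → ∀ {r} → OnArc (Arc e) r → OnArc (Arc e′) r → r ≡ pos (src e) ⊎ r ≡ pos (tgt e)
    arcs-meet {e} {e′} e≢e′ {r} on on′
      with avoid-arcs (src e) (tgt e) (src<tgt e) (adjacent e) (src e′) (tgt e′) (src<tgt e′) (adjacent e′) r
             (proj₁ (proj₂ (normalArc e)) r on) (proj₁ (proj₂ (normalArc e′)) r on′)
    ... | inj₁ (s≡ , t≡) = ⊥-elim (e≢e′ (edge-injective e e′ s≡ t≡))
    ... | inj₂ ends      = ends

    S : Set
    S = Σ (Fin ne) λ e → Fin (suc (k (Arc e)))

    _≟S_ : DecidableEquality S
    _≟S_ = ≡-dec Fin._≟_ Fin._≟_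

    from to : S → Point
    from (e , i) = pt (Arc e) (inject₁ i)
    to   (e , i) = pt (Arc e) (suc i)

    -- On different arcs a common point is an endpoint of the whole arc; on one arc it is the joint
    -- of two adjacent segments.
    segments-meet : ∀ s t → s ≢ t → ∀ {r} → OnSeg (from s) (to s) r → OnSeg (from t) (to t) r → r ≡ from s ⊎ r ≡ to s
    segments-meet (e , i) (e′ , j) s≢t {r} on on′ with e Fin.≟ e′
    ... | no e≢e′ = end-of-segment (Arc e) i on (arcs-meet e≢e′ (i , on) (j , on′))
    ... | yes refl with ℕ.<-cmp (toℕ i) (toℕ j)
    ...   | tri< i<j _ _ = inj₂ (proj₂ (simple (Arc e) i j r i<j on on′))
    ...   | tri≈ _ eq _  = ⊥-elim (s≢t (cong (e ,_) (toℕ-injective eq)))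
    ...   | tri> _ _ j<i = inj₁ (≡-trans (proj₂ adj)
              (cong (pt (Arc e)) (toℕ-injective (≡-sym (≡-trans (toℕ-inject₁ i) (proj₁ adj))))))
      where
      adj : toℕ i ≡ suc (toℕ j) × r ≡ pt (Arc e) (suc j)
      adj = simple (Arc e) j i r j<i on′ on

    segsOf : Fin ne → List S
    segsOf e = map (e ,_) (allFin (suc (k (Arc e))))

    segs : List S
    segs = concatMap segsOf (allFin ne)

    segs! : Unique segs
    segs! = Unique.concat⁺
      (All.map⁺ (All.universal (λ e → Unique.map⁺ ,-injectiveʳ′ (Unique.allFin⁺ _)) (allFin ne)))
      (AllPairs.map⁺ (AllPairs.tabulate⁺ disjoint))
      where
      ,-injectiveʳ′ : ∀ {e} {i j : Fin (suc (k (Arc e)))} → _≡_ {A = S} (e , i) (e , j) → i ≡ j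
      ,-injectiveʳ′ refl = refl
      disjoint : ∀ {e e′} → e ≢ e′ → Disjoint (segsOf e) (segsOf e′)
      disjoint e≢e′ (v∈ , v∈′) with ∈-map⁻ _ v∈ | ∈-map⁻ _ v∈′
      ... | _ , _ , refl | _ , _ , refl = e≢e′ refl

    ∈-segs : ∀ s → s ∈ segs
    ∈-segs (e , i) = ∈-concat⁺′ (∈-map⁺ (e ,_) (∈-allFin i)) (∈-map⁺ segsOf (∈-allFin e))

    ⨁-segs : ∀ (f : S → Bool) → ⨁ segs f ≡ ⨁ (allFin ne) (λ e → ⨁ (allFin (suc (k (Arc e)))) (λ i → f (e , i)))
    ⨁-segs f = ≡-trans (𝔽₂.∑-concatMap segsOf (allFin ne) f)
                       (𝔽₂.∑-cong (allFin ne) (λ e → 𝔽₂.∑-map (e ,_) (allFin (suc (k (Arc e)))) f))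

    abstract
      generic-shear : ∃ λ c → ∀ s → shear c (from s) ≢ shear c (to s)
      generic-shear =
        let (B , h) = eventually-all (λ s c → shear c (from s) ≢ shear c (to s))
                        (λ s → separated-eventually (from s) (to s) (proj₂ (proj₂ (normalArc (proj₁ s))) (proj₂ s))) segs
        in B + 1ℚ , λ s → h (B + 1ℚ) (subst (_< B + 1ℚ) (ℚ.+-identityʳ B) (ℚ.+-monoʳ-< B (ℚ.positive⁻¹ 1ℚ))) (∈-segs s)

    c : ℚ
    c = proj₁ generic-shear

    Oriented : S → Point → Point → Set
    Oriented s l r = (l ≡ from s × r ≡ to s) ⊎ (l ≡ to s × r ≡ from s)

    abstract
      orient : ∀ s → Σ Point λ l → Σ Point λ r → shear c l < shear c r × Oriented s l r
      orient s with <-cmp (shear c (from s)) (shear c (to s))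
      ... | tri< lt _ _ = from s , to s , lt , inj₁ (refl , refl)
      ... | tri≈ _ eq _ = ⊥-elim (proj₂ generic-shear s eq)
      ... | tri> _ _ gt = to s , from s , gt , inj₂ (refl , refl)

    left right : S → Point
    left s  = proj₁ (orient s)
    right s = proj₁ (proj₂ (orient s))

    left<right : ∀ s → shear c (left s) < shear c (right s)
    left<right s = proj₁ (proj₂ (proj₂ (orient s)))

    oriented : ∀ s → Oriented s (left s) (right s)
    oriented s = proj₂ (proj₂ (proj₂ (orient s)))

    abstract
      slopeOf : ∀ s → ∃ λ m → proj₂ (right s) ≡ proj₂ (left s) + m * (shear c (right s) - shear c (left s))
      slopeOf s = slope (shear c (left s)) (proj₂ (left s)) (shear c (right s)) (proj₂ (right s)) (left<right s)

    m : S → ℚ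
    m s = proj₁ (slopeOf s)

    heightAt : S → ℚ → ℚ
    heightAt s x = proj₂ (left s) + m s * (x - shear c (left s))

    unsheared : S → ℚ → Point
    unsheared s x = (x - c * heightAt s x) , heightAt s x

    shear-unsheared : ∀ s x → shear c (unsheared s x) ≡ x
    shear-unsheared s x = lem x (c * heightAt s x)
      where
      lem : ∀ x u → (x - u) + u ≡ x
      lem = solve-∀ ℚ-ring

    on-segment : ∀ s x → shear c (left s) ≤ x → x ≤ shear c (right s) → OnSeg (from s) (to s) (unsheared s x)
    on-segment s x l≤x x≤r = reorient (oriented s)
        (onSeg-sheared c (left s) (right s) (m s) x (left<right s) (proj₂ (slopeOf s)) l≤x x≤r)
      where
      reorient : ∀ {l r p} → Oriented s l r → OnSeg l r p → OnSeg (from s) (to s) p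
      reorient (inj₁ (refl , refl)) on = on
      reorient (inj₂ (refl , refl)) on = onSeg-sym (to s) (from s) on

    noncrossing : ∀ {s t} → s ≢ t → ∀ {x} → shear c (left s) ≤ x → x ≤ shear c (right s) →
      shear c (left t) ≤ x → x ≤ shear c (right t) → heightAt s x ≡ heightAt t x →
      x ≡ shear c (left s) ⊎ x ≡ shear c (right s)
    noncrossing {s} {t} s≢t {x} ls rs lt rt eq =
      ends (oriented s) (segments-meet s t s≢t (on-segment s x ls rs)
        (subst (OnSeg (from t) (to t)) (≡-sym (cong (λ h → (x - c * h) , h) eq)) (on-segment t x lt rt)))
      where
      at : ∀ {p} → unsheared s x ≡ p → x ≡ shear c p
      at eq = ≡-trans (≡-sym (shear-unsheared s x)) (cong (shear c) eq)
      ends : ∀ {l r} → Oriented s l r → unsheared s x ≡ from s ⊎ unsheared s x ≡ to s → x ≡ shear c l ⊎ x ≡ shear c r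
      ends (inj₁ (refl , refl)) (inj₁ e) = inj₁ (at e)
      ends (inj₁ (refl , refl)) (inj₂ e) = inj₂ (at e)
      ends (inj₂ (refl , refl)) (inj₁ e) = inj₂ (at e)
      ends (inj₂ (refl , refl)) (inj₂ e) = inj₁ (at e)

    ends-xor : ∀ (R : Point → Bool) s → R (left s) xor R (right s) ≡ R (from s) xor R (to s)
    ends-xor R s with oriented s
    ... | inj₁ (l≡ , r≡) = cong₂ (λ l r → R l xor R r) l≡ r≡
    ... | inj₂ (l≡ , r≡) = ≡-trans (cong₂ (λ l r → R l xor R r) l≡ r≡) (xor-comm (R (to s)) (R (from s)))

    -- Along an arc each inner joint occurs twice and cancels, so the arc contributes like its edge.
    ⨁-arcs : ∀ (x : Fin ne → Bool) (R : Point → Bool) →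
      ⨁ segs (λ s → x (proj₁ s) ∧ (R (from s) xor R (to s))) ≡
      ⨁ (allFin ne) (λ e → x e ∧ (R (pos (src e)) xor R (pos (tgt e))))
    ⨁-arcs x R = ≡-trans (⨁-segs (λ s → x (proj₁ s) ∧ (R (from s) xor R (to s)))) (𝔽₂.∑-cong (allFin ne) λ e → begin
      ⨁ (allFin (suc (k (Arc e)))) (λ i → x e ∧ (R (from (e , i)) xor R (to (e , i))))
        ≡⟨ ⨁-∧ (x e) (allFin (suc (k (Arc e)))) (λ i → R (from (e , i)) xor R (to (e , i))) ⟩
      x e ∧ ⨁ (allFin (suc (k (Arc e)))) (λ i → R (from (e , i)) xor R (to (e , i)))
        ≡⟨ cong (x e ∧_) (⨁-consecutive (suc (k (Arc e))) (R ∘ pt (Arc e))) ⟩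
      x e ∧ (R (pt (Arc e) zero) xor R (pt (Arc e) (fromℕ (suc (k (Arc e))))))
        ≡⟨ cong₂ (λ p q → x e ∧ (R p xor R q)) (start (Arc e)) (end (Arc e)) ⟩
      x e ∧ (R (pos (src e)) xor R (pos (tgt e))) ∎)

    incident : Fin n → Fin ne → Bool
    incident w e = does (w Fin.≟ src e) xor does (w Fin.≟ tgt e)

    module Arr = Arrangement _≟S_ segs segs! (shear c ∘ left) (proj₂ ∘ left) (shear c ∘ right) (proj₂ ∘ right) m
                             left<right (λ s → proj₂ (slopeOf s)) noncrossing

    -- The functional of the upper side of `e` in edge coordinates. Its base point lies just above
    -- the left end of the first segment of `e`.
    coefficient : Fin ne → Fin ne → Bool
    coefficient e e′ = ⨁ (allFin (suc (k (Arc e′)))) (λ i → does (Arr.overLeft? (e , zero) (e′ , i)))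

    module Faces {Z : Set} (zval : Z → Fin ne → Bool)
      (closed : ∀ z w → ⨁ (allFin ne) (λ e → zval z e ∧ incident w e) ≡ false) where

      val : Z → S → Bool
      val z s = zval z (proj₁ s)

      -- Regrouped by vertices, the value of `R` at `pos w` occurs once for each chosen edge at `w`,
      -- which is an even number of times.
      cycle : ∀ z (R : ℚ → ℚ → Bool) →
        ⨁ segs (λ s → val z s ∧ (R (shear c (left s)) (proj₂ (left s)) xor R (shear c (right s)) (proj₂ (right s)))) ≡ false
      cycle z R = begin
        ⨁ segs (λ s → val z s ∧ (R′ (left s) xor R′ (right s))) ≡⟨ 𝔽₂.∑-cong segs (λ s → cong (val z s ∧_) (ends-xor R′ s)) ⟩
        ⨁ segs (λ s → val z s ∧ (R′ (from s) xor R′ (to s)))    ≡⟨ ⨁-arcs (zval z) R′ ⟩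
        ⨁ (allFin ne) (λ e → zval z e ∧ (ρ (src e) xor ρ (tgt e)))
          ≡⟨ 𝔽₂.∑-cong (allFin ne) (λ e → expand (zval z e) (src e) (tgt e)) ⟩
        ⨁ (allFin ne) (λ e → ⨁ (allFin n) (λ w → ρ w ∧ (zval z e ∧ incident w e))) ≡⟨ 𝔽₂.∑-swap (allFin ne) (allFin n) _ ⟩
        ⨁ (allFin n) (λ w → ⨁ (allFin ne) (λ e → ρ w ∧ (zval z e ∧ incident w e)))
          ≡⟨ 𝔽₂.∑-cong (allFin n) (λ w → ⨁-∧ (ρ w) (allFin ne) (λ e → zval z e ∧ incident w e)) ⟩
        ⨁ (allFin n) (λ w → ρ w ∧ ⨁ (allFin ne) (λ e → zval z e ∧ incident w e))
          ≡⟨ 𝔽₂.∑-ε (allFin n) (λ {w} _ → ≡-trans (cong (ρ w ∧_) (closed z w)) (∧-zeroʳ (ρ w))) ⟩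
        false ∎
        where
        R′ : Point → Bool
        R′ p = R (shear c p) (proj₂ p)
        ρ : Fin n → Bool
        ρ w = R′ (pos w)
        collect : ∀ r z a b → z ∧ ((a ∧ r) xor (b ∧ r)) ≡ r ∧ (z ∧ (a xor b))
        collect r z a b = ≡-trans (cong (z ∧_) (≡-trans (≡-sym (∧-distribʳ-xor r a b)) (∧-comm (a xor b) r)))
          (≡-trans (≡-sym (∧-assoc z r (a xor b))) (≡-trans (cong (_∧ (a xor b)) (∧-comm z r)) (∧-assoc r z (a xor b))))
        expand : ∀ b u v → b ∧ (ρ u xor ρ v) ≡ ⨁ (allFin n) (λ w → ρ w ∧ (b ∧ (does (w Fin.≟ u) xor does (w Fin.≟ v))))
        expand b u v = begin
          b ∧ (ρ u xor ρ v) ≡⟨ cong₂ (λ p q → b ∧ (p xor q)) (⨁-indicator u ρ) (⨁-indicator v ρ) ⟨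
          b ∧ (⨁ (allFin n) (λ w → does (w Fin.≟ u) ∧ ρ w) xor ⨁ (allFin n) (λ w → does (w Fin.≟ v) ∧ ρ w))
            ≡⟨ cong (b ∧_) (𝔽₂.∑-∙ (allFin n) _ _) ⟨
          b ∧ ⨁ (allFin n) (λ w → (does (w Fin.≟ u) ∧ ρ w) xor (does (w Fin.≟ v) ∧ ρ w))
            ≡⟨ ⨁-∧ b (allFin n) _ ⟨
          ⨁ (allFin n) (λ w → b ∧ ((does (w Fin.≟ u) ∧ ρ w) xor (does (w Fin.≟ v) ∧ ρ w)))
            ≡⟨ 𝔽₂.∑-cong (allFin n) (λ w → collect (ρ w) b (does (w Fin.≟ u)) (does (w Fin.≟ v))) ⟩
          ⨁ (allFin n) (λ w → ρ w ∧ (b ∧ (does (w Fin.≟ u) xor does (w Fin.≟ v)))) ∎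

      open Arr.Cycles val cycle using (upLeft; down; module Corner)

      up⁰ : Fin ne → Z → Bool
      up⁰ e z = ⨁ (allFin ne) (λ j → coefficient e j ∧ zval z j)

      up⁰≡ : ∀ e z → up⁰ e z ≡ upLeft (e , zero) z
      up⁰≡ e z = ≡-sym (≡-trans (⨁-segs _) (𝔽₂.∑-cong (allFin ne) (λ j →
        ≡-trans (⨁-∧ (zval z j) (allFin (suc (k (Arc j)))) (λ i → does (Arr.overLeft? (e , zero) (j , i))))
                (∧-comm (zval z j) (coefficient e j)))))

      module _ (I : (Z → Bool) → Bool) (I-ext : ∀ {f g} → (∀ z → f z ≡ g z) → I f ≡ I g) where

        b : S → Bool
        b s = I (upLeft s) xor I (down s)

        boundary-at : ∀ P → ⨁ segs (λ s → (does (from s ≟P P) xor does (to s ≟P P)) ∧ b s) ≡ false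
        boundary-at P = ≡-trans (𝔽₂.∑-cong segs (λ s → cong (_∧ b s) (begin
            does (from s ≟P P) xor does (to s ≟P P)    ≡⟨ ends-xor (λ p → does (p ≟P P)) s ⟨
            does (left s ≟P P) xor does (right s ≟P P) ≡⟨ cong₂ _xor_ (same (left s)) (same (right s)) ⟩
            does (C.starts? s) xor does (C.ends? s)    ∎)))
          C.boundary-closed
          where
          module C = Corner I I-ext (shear c P) (proj₂ P)
          same : ∀ p → does (p ≟P P) ≡ does (C.at? (shear c p) (proj₂ p))
          same p = does-⇔ (λ eq → cong (shear c) eq , cong proj₂ eq) (λ (e₁ , e₂) → shear-injective c p P e₁ e₂)
                          (p ≟P P) (C.at? (shear c p) (proj₂ p))

        module _ (e : Fin ne) where
          pe = pt (Arc e)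
          nd = proj₂ (proj₂ (normalArc e))

          -- Two arcs meet only at endpoints, and an inner joint of a simple nondegenerate arc is
          -- neither of its ends.
          foreign : ∀ e′ → e′ ≢ e → ∀ i j → pt (Arc e′) j ≢ pe (suc (inject₁ i))
          foreign e′ e′≢e i j eq = not-end (arcs-meet (e′≢e ∘ ≡-sym) (onArc-pt (Arc e) (suc (inject₁ i)))
                                              (subst (OnArc (Arc e′)) eq (onArc-pt (Arc e′) j)))
            where
            not-end : pe (suc (inject₁ i)) ≡ pos (src e) ⊎ pe (suc (inject₁ i)) ≡ pos (tgt e) → ⊥
            not-end (inj₁ is-src) = Fin.0≢1+n (≡-sym (pt-injective (Arc e) nd (suc (inject₁ i)) zero
                                      (≡-trans is-src (≡-sym (start (Arc e))))))
            not-end (inj₂ is-tgt) = fromℕ≢inject₁ (≡-sym (Fin.suc-injective (pt-injective (Arc e) nd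
                                      (suc (inject₁ i)) (fromℕ (suc (k (Arc e)))) (≡-trans is-tgt (≡-sym (end (Arc e)))))))

          -- At an inner joint exactly two segments meet, so evenness at that point equates their
          -- values.
          b-step : ∀ i → b (e , inject₁ i) ≡ b (e , suc i)
          b-step i = ≡-sym (xor≡false⇒≡ (b (e , suc i)) (b (e , inject₁ i)) (begin
            b (e , suc i) xor b (e , inject₁ i)
              ≡⟨ cong₂ _xor_ (⨁-indicator (suc i) (λ j → b (e , j))) (⨁-indicator (inject₁ i) (λ j → b (e , j))) ⟨
            ⨁ (allFin _) (λ j → does (j Fin.≟ suc i) ∧ b (e , j)) xor ⨁ (allFin _) (λ j → does (j Fin.≟ inject₁ i) ∧ b (e , j))
              ≡⟨ 𝔽₂.∑-∙ (allFin (suc (k (Arc e)))) (λ j → does (j Fin.≟ suc i) ∧ b (e , j)) (λ j → does (j Fin.≟ inject₁ i) ∧ b (e , j)) ⟨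
            ⨁ (allFin _) (λ j → (does (j Fin.≟ suc i) ∧ b (e , j)) xor (does (j Fin.≟ inject₁ i) ∧ b (e , j)))
              ≡⟨ 𝔽₂.∑-cong (allFin (suc (k (Arc e)))) here-only ⟨
            ⨁ (allFin _) (λ j → term (e , j))
              ≡⟨ ⨁-only e (λ e′ → ⨁ (allFin _) (λ j → term (e′ , j))) elsewhere ⟨
            ⨁ (allFin ne) (λ e′ → ⨁ (allFin _) (λ j → term (e′ , j)))
              ≡⟨ ⨁-segs term ⟨
            ⨁ segs term
              ≡⟨ boundary-at P ⟩
            false ∎))
            where
            P = pe (suc (inject₁ i))
            term : S → Bool
            term s = (does (from s ≟P P) xor does (to s ≟P P)) ∧ b s
            elsewhere : ∀ e′ → e′ ≢ e → ⨁ (allFin _) (λ j → term (e′ , j)) ≡ false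
            elsewhere e′ e′≢e = 𝔽₂.∑-ε (allFin (suc (k (Arc e′)))) (λ {j} _ → cong₂ (λ p q → (p xor q) ∧ b (e′ , j))
              (dec-false (from (e′ , j) ≟P P) (foreign e′ e′≢e i (inject₁ j)))
              (dec-false (to (e′ , j) ≟P P) (foreign e′ e′≢e i (suc j))))
            here-only : ∀ j → term (e , j) ≡ (does (j Fin.≟ suc i) ∧ b (e , j)) xor (does (j Fin.≟ inject₁ i) ∧ b (e , j))
            here-only j = ≡-trans (cong₂ (λ p q → (p xor q) ∧ b (e , j))
                (does-⇔ (λ eq → Fin.inject₁-injective (pt-injective (Arc e) nd (inject₁ j) (inject₁ (suc i)) eq))
                        (λ eq → cong (λ l → pe (inject₁ l)) eq) (from (e , j) ≟P P) (j Fin.≟ suc i))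
                (does-⇔ (λ eq → Fin.suc-injective (pt-injective (Arc e) nd (suc j) (suc (inject₁ i)) eq))
                        (λ eq → cong (λ l → pe (suc l)) eq) (to (e , j) ≟P P) (j Fin.≟ inject₁ i)))
              (∧-distribʳ-xor (b (e , j)) (does (j Fin.≟ suc i)) (does (j Fin.≟ inject₁ i)))

        b-constant : ∀ s → b s ≡ b (proj₁ s , zero)
        b-constant (e , i) = constant-along (k (Arc e)) (λ j → b (e , j)) (b-step e) i

        -- Since `b` is constant along every arc, evenness over the segments at `pos w` becomes
        -- evenness over the edges at `w`.
        face-even : ∀ w → ⨁ (allFin ne) (λ e → b (e , zero) ∧ incident w e) ≡ false
        face-even w = begin
          ⨁ (allFin ne) (λ e → b (e , zero) ∧ incident w e)
            ≡⟨ 𝔽₂.∑-cong (allFin ne) (λ e → cong (b (e , zero) ∧_) (cong₂ _xor_ (same (src e)) (same (tgt e)))) ⟩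
          ⨁ (allFin ne) (λ e → b (e , zero) ∧ (does (pos (src e) ≟P pos w) xor does (pos (tgt e) ≟P pos w)))
            ≡⟨ ⨁-arcs (λ e → b (e , zero)) (λ p → does (p ≟P pos w)) ⟨
          ⨁ segs (λ s → b (proj₁ s , zero) ∧ (does (from s ≟P pos w) xor does (to s ≟P pos w)))
            ≡⟨ 𝔽₂.∑-cong segs (λ s → ≡-trans (∧-comm (b (proj₁ s , zero)) _)
                 (cong ((does (from s ≟P pos w) xor does (to s ≟P pos w)) ∧_) (≡-sym (b-constant s)))) ⟩
          ⨁ segs (λ s → (does (from s ≟P pos w) xor does (to s ≟P pos w)) ∧ b s)
            ≡⟨ boundary-at (pos w) ⟩
          false ∎
          where
          same : ∀ u → does (w Fin.≟ u) ≡ does (pos u ≟P pos w)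
          same u = does-⇔ (λ { refl → refl }) (λ eq → ≡-sym (pos-inj u w eq)) (w Fin.≟ u) (pos u ≟P pos w)

        face-boundary-even : ∀ w →
          ⨁ (allFin ne) (λ e → (I (up⁰ e) xor I (λ z → up⁰ e z xor zval z e)) ∧ incident w e) ≡ false
        face-boundary-even w = ≡-trans (𝔽₂.∑-cong (allFin ne) (λ e → cong (_∧ incident w e)
          (cong₂ _xor_ (I-ext (up⁰≡ e)) (I-ext (λ z → cong (_xor zval z e) (up⁰≡ e z)))))) (face-even w)

-- Counting in ℕ, and representatives of classes.

module ℕΣ = ListSum ℕ.+-0-isCommutativeMonoid
open ℕΣ using (∑)

module _ where
  open import Data.Nat using (_+_; _*_; _∸_; _≤_; _<_)

  𝟙 : Bool → ℕ
  𝟙 b = if b then 1 else 0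

  ∑-mono : {A : Set} → ∀ xs {f g : A → ℕ} → (∀ x → f x ≤ g x) → ∑ xs f ≤ ∑ xs g
  ∑-mono []       h = z≤n
  ∑-mono (x ∷ xs) h = ℕ.+-mono-≤ (h x) (∑-mono xs h)

  ∑-const : {A : Set} → ∀ (xs : List A) c → ∑ xs (λ _ → c) ≡ length xs * c
  ∑-const []       c = refl
  ∑-const (x ∷ xs) c = cong (c +_) (∑-const xs c)

  ∑-≥-const : {A : Set} → ∀ c xs {f : A → ℕ} → (∀ {x} → x ∈ xs → c ≤ f x) → length xs * c ≤ ∑ xs f
  ∑-≥-const c []       h = z≤n
  ∑-≥-const c (x ∷ xs) h = ℕ.+-mono-≤ (h (here refl)) (∑-≥-const c xs (h ∘ there))

  ∑-indicator : ∀ {n} (i : Fin n) → ∑ (allFin n) (λ j → 𝟙 (does (j Fin.≟ i))) ≡ 1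
  ∑-indicator {suc n} zero = ≡-trans (ℕΣ.∑-allFin-suc n (λ j → 𝟙 (does (j Fin.≟ zero))))
    (cong suc (ℕΣ.∑-const-ε (allFin n)))
  ∑-indicator {suc n} (suc i) = ≡-trans (ℕΣ.∑-allFin-suc n (λ j → 𝟙 (does (j Fin.≟ suc i)))) (∑-indicator i)

  four-distinct : ∀ {n} (b : Fin n → Bool) {i j k l : Fin n} → b i ≡ true → b j ≡ true → b k ≡ true → b l ≡ true →
    i ≢ j → i ≢ k → i ≢ l → j ≢ k → j ≢ l → k ≢ l → 4 ≤ ∑ (allFin n) (𝟙 ∘ b)
  four-distinct {n} b {i} {j} {k} {l} bi bj bk bl i≢j i≢k i≢l j≢k j≢l k≢l =
    subst (_≤ ∑ (allFin n) (𝟙 ∘ b)) total (∑-mono (allFin n) bound)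
    where
    δ : Fin n → Fin n → ℕ
    δ i x = 𝟙 (does (x Fin.≟ i))
    total : ∑ (allFin n) (λ x → (δ i x + δ j x) + (δ k x + δ l x)) ≡ 4
    total = ≡-trans (ℕΣ.∑-∙ (allFin n) _ _) (cong₂ _+_
      (≡-trans (ℕΣ.∑-∙ (allFin n) (δ i) (δ j)) (cong₂ _+_ (∑-indicator i) (∑-indicator j)))
      (≡-trans (ℕΣ.∑-∙ (allFin n) (δ k) (δ l)) (cong₂ _+_ (∑-indicator k) (∑-indicator l))))
    bound : ∀ x → (δ i x + δ j x) + (δ k x + δ l x) ≤ 𝟙 (b x)
    bound x with x Fin.≟ i | x Fin.≟ j | x Fin.≟ k | x Fin.≟ l
    ... | yes refl | yes refl | _        | _        = ⊥-elim (i≢j refl)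
    ... | yes refl | no _     | yes refl | _        = ⊥-elim (i≢k refl)
    ... | yes refl | no _     | no _     | yes refl = ⊥-elim (i≢l refl)
    ... | yes refl | no _     | no _     | no _     rewrite bi = ℕ.≤-refl
    ... | no _     | yes refl | yes refl | _        = ⊥-elim (j≢k refl)
    ... | no _     | yes refl | no _     | yes refl = ⊥-elim (j≢l refl)
    ... | no _     | yes refl | no _     | no _     rewrite bj = ℕ.≤-refl
    ... | no _     | no _     | yes refl | yes refl = ⊥-elim (k≢l refl)
    ... | no _     | no _     | yes refl | no _     rewrite bk = ℕ.≤-refl
    ... | no _     | no _     | no _     | yes refl rewrite bl = ℕ.≤-refl
    ... | no _     | no _     | no _     | no _     = z≤n

  module _ {A : Set} {_≈_ : A → A → Set} (_≈?_ : ∀ x y → Dec (x ≈ y)) where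

    -- Many sides of edges carry the same functional; the representatives chosen here are what is
    -- counted as faces.
    transversal : (≈-refl : ∀ {x} → x ≈ x) → ∀ xs → ∃ λ ds →
      AllPairs (λ x y → ¬ x ≈ y) ds × (∀ {x} → x ∈ xs → ∃ λ d → d ∈ ds × x ≈ d) × (∀ {d} → d ∈ ds → d ∈ xs)
    transversal ≈-refl []       = [] , [] , (λ ()) , λ ()
    transversal ≈-refl (x ∷ xs) with transversal ≈-refl xs
    ... | ds , distinct , covers , sub with Any.any? (x ≈?_) ds
    ...   | yes found = ds , distinct , covers′ , there ∘ sub
      where
      covers′ : ∀ {y} → y ∈ x ∷ xs → ∃ λ d → d ∈ ds × y ≈ d
      covers′ (here refl) = let (d , d∈ , x≈d) = find found in d , d∈ , x≈d
      covers′ (there y∈)  = covers y∈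
    ...   | no none = x ∷ ds , All.¬Any⇒All¬ ds none ∷ distinct , covers′ , sub′
      where
      covers′ : ∀ {y} → y ∈ x ∷ xs → ∃ λ d → d ∈ x ∷ ds × y ≈ d
      covers′ (here refl) = x , here refl , ≈-refl
      covers′ (there y∈)  = let (d , d∈ , y≈d) = covers y∈ in d , there d∈ , y≈d
      sub′ : ∀ {d} → d ∈ x ∷ ds → d ∈ x ∷ xs
      sub′ (here refl) = here refl
      sub′ (there d∈)  = there (sub d∈)

    -- Two representatives related to `x` would be related to each other by the Euclidean law, which
    -- combines symmetry and transitivity.
    transversal-hit : (∀ {x y z} → z ≈ x → z ≈ y → x ≈ y) → ∀ x ds → AllPairs (λ x y → ¬ x ≈ y) ds →
      ∑ ds (λ d → 𝟙 (does (x ≈? d))) ≤ 1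
    transversal-hit eucl x []       []        = z≤n
    transversal-hit eucl x (d ∷ ds) (d≉ ∷ ds!) with x ≈? d
    ... | no _    = transversal-hit eucl x ds ds!
    ... | yes x≈d = ℕ.≤-reflexive (cong suc (ℕΣ.∑-ε ds (λ {d′} d′∈ →
            cong 𝟙 (dec-false (x ≈? d′) (λ x≈d′ → All.lookup d≉ d′∈ (eucl x≈d x≈d′))))))

  true≢false : true ≢ false
  true≢false ()

  ∧-true : ∀ {a b} → a ∧ b ≡ true → a ≡ true × b ≡ true
  ∧-true {true} {true} _ = refl , refl

  does-true : {P : Set} (P? : Dec P) → does P? ≡ true → P
  does-true (yes p) _ = p

  ⨁-partner : ∀ {n} (f : Fin n → Bool) → ⨁ (allFin n) f ≡ false → ∀ i → f i ≡ true → ∃ λ j → j ≢ i × f j ≡ true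
  ⨁-partner f even i fi with Fin.any? (λ j → ¬? (j Fin.≟ i) ×-dec (f j 𝔹.≟ true))
  ... | yes found = found
  ... | no none = ⊥-elim (true≢false (≡-trans (≡-sym fi) (≡-trans (≡-sym (⨁-only i f (λ j j≢i → 𝔹.¬-not (λ fj → none (j , j≢i , fj))))) even)))

  -- The edge bound for bipartite graphs, from functionals on the cycle space.

  module _ {n ne : ℕ} (white black : Fin ne → Fin n) where

    incidence : Fin n → Fin ne → Bool
    incidence w e = does (w Fin.≟ white e) xor does (w Fin.≟ black e)

    -- Each row sums to zero over the vertices, so the equation of one vertex is redundant.
    closed-but-one : ∀ {w₀ : Fin n} (z : Fin ne → Bool) →
      (∀ w → w ≢ w₀ → ⨁ (allFin ne) (λ e → z e ∧ incidence w e) ≡ false) →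
      ∀ w → ⨁ (allFin ne) (λ e → z e ∧ incidence w e) ≡ false
    closed-but-one {w₀} z rest w with w Fin.≟ w₀
    ... | no w≢w₀ = rest w w≢w₀
    ... | yes refl = begin
      ⨁ (allFin ne) (λ e → z e ∧ incidence w e)                           ≡⟨ ⨁-only w _ rest ⟨
      ⨁ (allFin n) (λ w → ⨁ (allFin ne) (λ e → z e ∧ incidence w e))      ≡⟨ 𝔽₂.∑-swap (allFin n) (allFin ne) _ ⟩
      ⨁ (allFin ne) (λ e → ⨁ (allFin n) (λ w → z e ∧ incidence w e))      ≡⟨ 𝔽₂.∑-ε (allFin ne) (λ {e} _ → column e) ⟩
      false ∎
      where
      open ≡-Reasoning
      single : ∀ u → ⨁ (allFin n) (λ w → does (w Fin.≟ u)) ≡ true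
      single u = ≡-trans (𝔽₂.∑-cong (allFin n) (λ w → ≡-sym (∧-identityʳ (does (w Fin.≟ u))))) (⨁-indicator u (λ _ → true))
      column : ∀ e → ⨁ (allFin n) (λ w → z e ∧ incidence w e) ≡ false
      column e = ≡-trans (⨁-∧ (z e) (allFin n) (λ w → incidence w e)) (≡-trans (cong (z e ∧_)
        (≡-trans (𝔽₂.∑-∙ (allFin n) _ _) (cong₂ _xor_ (single (white e)) (single (black e))))) (∧-zeroʳ (z e)))

  -- With a face present, double the first inequality and replace 2f by at most `ne`. The case of
  -- zero faces is that of a forest, where `pred` truncates and `2 ≤ n₁`, that is at least three
  -- vertices, supplies the bound.
  edge-bound-arithmetic : ∀ {ne n₁} f → 2 ≤ n₁ → ne ≤ n₁ + ℕ.pred f → f * 4 ≤ ne * 2 → ne + 4 ≤ 2 * suc n₁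
  edge-bound-arithmetic {ne} {n₁} zero 2≤n₁ h₁ _ = begin
    ne + 4                 ≤⟨ ℕ.+-monoˡ-≤ 4 h₁ ⟩
    (n₁ + 0) + 4           ≡⟨ lem₁ n₁ ⟩
    2 + (2 + n₁)           ≤⟨ ℕ.+-monoʳ-≤ 2 (ℕ.+-monoˡ-≤ n₁ 2≤n₁) ⟩
    2 + (n₁ + n₁)          ≡⟨ lem₂ n₁ ⟩
    2 * suc n₁             ∎
    where
    open ℕ.≤-Reasoning
    lem₁ : ∀ n → (n + 0) + 4 ≡ 2 + (2 + n)
    lem₁ = solveℕ-∀
    lem₂ : ∀ n → 2 + (n + n) ≡ 2 * suc n
    lem₂ = solveℕ-∀
  edge-bound-arithmetic {ne} {n₁} (suc f) 2≤n₁ h₁ h₂ = ℕ.+-cancelˡ-≤ ne _ _ (begin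
    ne + (ne + 4)              ≡⟨ lem₁ ne ⟩
    (ne * 2) + 4               ≤⟨ ℕ.+-monoˡ-≤ 4 (ℕ.*-monoˡ-≤ 2 h₁) ⟩
    (n₁ + f) * 2 + 4           ≡⟨ lem₂ n₁ f ⟩
    suc f * 2 + 2 * suc n₁     ≤⟨ ℕ.+-monoˡ-≤ (2 * suc n₁) half ⟩
    ne + 2 * suc n₁            ∎)
    where
    open ℕ.≤-Reasoning
    half : suc f * 2 ≤ ne
    half = ℕ.*-cancelʳ-≤ (suc f * 2) ne 2 (subst (_≤ ne * 2) (≡-sym (ℕ.*-assoc (suc f) 2 2)) h₂)
    lem₁ : ∀ e → e + (e + 4) ≡ (e * 2) + 4
    lem₁ = solveℕ-∀
    lem₂ : ∀ n f → (n + f) * 2 + 4 ≡ suc f * 2 + 2 * suc n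
    lem₂ = solveℕ-∀

  -- With coefficient e the functional attached to one side of the edge e, the other side
  -- differs from it by e; I selects a face.
  FaceEven : ∀ {n ne} (white black : Fin ne → Fin n) (coefficient : Fin ne → Fin ne → Bool) → Set₁
  FaceEven {n} {ne} white black coefficient = ∀ {Z : Set} (zval : Z → Fin ne → Bool) →
    (∀ z w → ⨁ (allFin ne) (λ e → zval z e ∧ incidence white black w e) ≡ false) →
    (I : (Z → Bool) → Bool) → (∀ {f g} → (∀ z → f z ≡ g z) → I f ≡ I g) → ∀ w →
    ⨁ (allFin ne) (λ e → (I (λ z → ⨁ (allFin ne) (λ j → coefficient e j ∧ zval z j)) xor
                          I (λ z → ⨁ (allFin ne) (λ j → coefficient e j ∧ zval z j) xor zval z e))
                         ∧ incidence white black w e) ≡ false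

  module BipartiteBound {n₁ ne : ℕ} (white black : Fin ne → Fin (suc n₁)) (colour : Fin (suc n₁) → Bool)
    (white-false : ∀ e → colour (white e) ≡ false) (black-true : ∀ e → colour (black e) ≡ true)
    (edge-injective : ∀ e e′ → white e ≡ white e′ → black e ≡ black e′ → e ≡ e′)
    (coefficient : Fin ne → Fin ne → Bool) (face-even : FaceEven white black coefficient)
    where

    open ≡-Reasoning

    Closed : (Fin ne → Bool) → Set
    Closed z = ∀ w → ⨁ (allFin ne) (λ e → z e ∧ incidence white black w e) ≡ false

    closed? : ∀ z → Dec (Closed z)
    closed? z = Fin.all? (λ w → ⨁ (allFin ne) (λ e → z e ∧ incidence white black w e) 𝔹.≟ false)

    white≢black : ∀ e e′ → white e ≢ black e′
    white≢black e e′ eq = true≢false (≡-trans (≡-sym (black-true e′)) (≡-trans (cong colour (≡-sym eq)) (white-false e)))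

    at-white : ∀ e e′ → incidence white black (white e) e′ ≡ does (white e Fin.≟ white e′)
    at-white e e′ = ≡-trans (cong (does (white e Fin.≟ white e′) xor_) (dec-false (white e Fin.≟ black e′) (white≢black e e′)))
                            (xor-identityʳ _)

    at-black : ∀ e e′ → incidence white black (black e) e′ ≡ does (black e Fin.≟ black e′)
    at-black e e′ = cong (_xor does (black e Fin.≟ black e′))
      (dec-false (black e Fin.≟ white e′) (λ eq → white≢black e′ e (≡-sym eq)))

    module _ (b : Fin ne → Bool) (closed : Closed b) where

      white-partner : ∀ e → b e ≡ true → ∃ λ e′ → e′ ≢ e × b e′ ≡ true × white e′ ≡ white e
      white-partner e be with ⨁-partner _ (closed (white e)) e
        (cong₂ _∧_ be (≡-trans (at-white e e) (dec-true (white e Fin.≟ white e) refl)))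
      ... | e′ , e′≢e , h = e′ , e′≢e , proj₁ (∧-true h) ,
        ≡-sym (does-true (white e Fin.≟ white e′) (≡-trans (≡-sym (at-white e e′)) (proj₂ (∧-true {b e′} h))))

      black-partner : ∀ e → b e ≡ true → ∃ λ e′ → e′ ≢ e × b e′ ≡ true × black e′ ≡ black e
      black-partner e be with ⨁-partner _ (closed (black e)) e
        (cong₂ _∧_ be (≡-trans (at-black e e) (dec-true (black e Fin.≟ black e) refl)))
      ... | e′ , e′≢e , h = e′ , e′≢e , proj₁ (∧-true h) ,
        ≡-sym (does-true (black e Fin.≟ black e′) (≡-trans (≡-sym (at-black e e′)) (proj₂ (∧-true {b e′} h))))

      -- Evenness yields a second edge e₁ at the white end of e₀, a second edge e₂ at its black end,
      -- and a second edge e₃ at the black end of e₁. Without multiple edges e₀ and e₁ have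
      -- different black ends, which separates e₀, e₂ from e₁, e₃.
      closed-has-four : ∀ e → b e ≡ true → 4 ≤ ∑ (allFin ne) (𝟙 ∘ b)
      closed-has-four e₀ b₀ =
        let (e₁ , e₁≢e₀ , b₁ , w₁) = white-partner e₀ b₀
            (e₂ , e₂≢e₀ , b₂ , k₂) = black-partner e₀ b₀
            (e₃ , e₃≢e₁ , b₃ , k₃) = black-partner e₁ b₁
            k₁≢k₀ : black e₁ ≢ black e₀
            k₁≢k₀ = λ k → e₁≢e₀ (edge-injective e₁ e₀ w₁ k)
        in four-distinct b b₀ b₁ b₂ b₃
             (e₁≢e₀ ∘ ≡-sym) (e₂≢e₀ ∘ ≡-sym)
             (λ eq → k₁≢k₀ (≡-trans (≡-sym k₃) (cong black (≡-sym eq))))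
             (λ eq → k₁≢k₀ (≡-trans (cong black eq) k₂))
             (e₃≢e₁ ∘ ≡-sym)
             (λ eq → k₁≢k₀ (≡-trans (≡-sym k₃) (≡-trans (cong black (≡-sym eq)) k₂)))

    -- Vectors outside the cycle space are sent to zero. A functional on cycles thus becomes a
    -- function on all Boolean vectors, a finite domain on which equality is decided by search.
    zval : Vec Bool ne → Fin ne → Bool
    zval v e = does (closed? (lookup v)) ∧ lookup v e

    zval-closed : ∀ v → Closed (zval v)
    zval-closed v w = by-cases (closed? (lookup v))
      where
      by-cases : (d : Dec (Closed (lookup v))) →
        ⨁ (allFin ne) (λ e → (does d ∧ lookup v e) ∧ incidence white black w e) ≡ false
      by-cases (yes cl) = cl w
      by-cases (no _)   = 𝔽₂.∑-ε (allFin ne) (λ _ → refl)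

    zval-tabulate : ∀ z → Closed z → ∀ e → zval (tabulate z) e ≡ z e
    zval-tabulate z cl e = cong₂ _∧_ (dec-true (closed? (lookup (tabulate z))) (λ w → ≡-trans
      (𝔽₂.∑-cong (allFin ne) (λ e → cong (_∧ incidence white black w e) (lookup∘tabulate z e))) (cl w)))
      (lookup∘tabulate z e)

    ⟦_⟧ : (Fin ne → Bool) → Vec Bool ne → Bool
    ⟦ r ⟧ v = ⨁ (allFin ne) (λ j → r j ∧ zval v j)

    -- Coefficient vectors are compared as functionals on cycles only: adding a cut to one of them
    -- leaves the face unchanged.
    _≈_ : (r s : Fin ne → Bool) → Set
    r ≈ s = ∀ v → ⟦ r ⟧ v ≡ ⟦ s ⟧ v

    pointwise? : (f g : Vec Bool ne → Bool) → Dec (∀ v → f v ≡ g v)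
    pointwise? f g with anySubset? (λ v → ¬? (f v 𝔹.≟ g v))
    ... | yes (v , ≢) = no (λ eq → ≢ (eq v))
    ... | no none     = yes (λ v → decidable-stable (f v 𝔹.≟ g v) (λ ≢ → none (v , ≢)))

    _≈?_ : ∀ r s → Dec (r ≈ s)
    r ≈? s = pointwise? ⟦ r ⟧ ⟦ s ⟧

    up down : Fin ne → Fin ne → Bool
    up = coefficient
    down e j = coefficient e j xor does (j Fin.≟ e)

    ⟦down⟧ : ∀ e v → ⟦ down e ⟧ v ≡ ⟦ up e ⟧ v xor zval v e
    ⟦down⟧ e v = begin
      ⨁ (allFin ne) (λ j → (up e j xor does (j Fin.≟ e)) ∧ zval v j)
        ≡⟨ 𝔽₂.∑-cong (allFin ne) (λ j → ∧-distribʳ-xor (zval v j) (up e j) (does (j Fin.≟ e))) ⟩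
      ⨁ (allFin ne) (λ j → (up e j ∧ zval v j) xor (does (j Fin.≟ e) ∧ zval v j))
        ≡⟨ 𝔽₂.∑-∙ (allFin ne) (λ j → up e j ∧ zval v j) (λ j → does (j Fin.≟ e) ∧ zval v j) ⟩
      ⟦ up e ⟧ v xor ⨁ (allFin ne) (λ j → does (j Fin.≟ e) ∧ zval v j)
        ≡⟨ cong (⟦ up e ⟧ v xor_) (⨁-indicator e (zval v)) ⟩
      ⟦ up e ⟧ v xor zval v e ∎

    boundary : (Fin ne → Bool) → Fin ne → Bool
    boundary d e = does (up e ≈? d) xor does (down e ≈? d)

    boundary-closed : ∀ d → Closed (boundary d)
    boundary-closed d w = ≡-trans (𝔽₂.∑-cong (allFin ne) (λ e → cong (λ x → (does (up e ≈? d) xor x) ∧ incidence white black w e)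
        (I-ext {⟦ down e ⟧} {λ z → ⟦ up e ⟧ z xor zval z e} (⟦down⟧ e))))
      (face-even zval zval-closed I I-ext w)
      where
      -- Membership in the face `d`, a nonlinear test; this is why `FaceEven` allows an arbitrary
      -- `I`.
      I : (Vec Bool ne → Bool) → Bool
      I f = does (pointwise? f ⟦ d ⟧)
      I-ext : ∀ {f g} → (∀ z → f z ≡ g z) → I f ≡ I g
      I-ext {f} {g} eq = does-⇔ (λ h v → ≡-trans (≡-sym (eq v)) (h v)) (λ h v → ≡-trans (eq v) (h v))
                                (pointwise? f ⟦ d ⟧) (pointwise? g ⟦ d ⟧)

    -- The sides of `e` differ by the coordinate of `e`, so they are equal as functionals exactly
    -- when `e` lies on no cycle.
    nonBridges : List (Fin ne)
    nonBridges = filter (λ e → ¬? (up e ≈? down e)) (allFin ne)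

    sides : List (Fin ne → Bool)
    sides = map up nonBridges ++ map down nonBridges

    faces = transversal _≈?_ (λ v → refl) sides

    ds : List (Fin ne → Bool)
    ds = proj₁ faces

    ds! : AllPairs (λ r s → ¬ r ≈ s) ds
    ds! = proj₁ (proj₂ faces)

    face-size : ∀ {d} → d ∈ ds → 4 ≤ ∑ (allFin ne) (𝟙 ∘ boundary d)
    face-size {d} d∈ with ∈-++⁻ (map up nonBridges) (proj₂ (proj₂ (proj₂ faces)) d∈)
    ... | inj₁ d∈up with ∈-map⁻ up d∈up
    ...   | e , e∈ , refl = closed-has-four (boundary d) (boundary-closed d) e
      (cong₂ _xor_ (dec-true (up e ≈? d) (λ v → refl))
                   (dec-false (down e ≈? d) (λ eq → proj₂ (∈-filter⁻ (λ e → ¬? (up e ≈? down e)) {xs = allFin ne} e∈) (λ v → ≡-sym (eq v)))))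
    face-size {d} d∈ | inj₂ d∈down with ∈-map⁻ down d∈down
    ...   | e , e∈ , refl = closed-has-four (boundary d) (boundary-closed d) e
      (cong₂ _xor_ (dec-false (up e ≈? d) (proj₂ (∈-filter⁻ (λ e → ¬? (up e ≈? down e)) {xs = allFin ne} e∈)))
                   (dec-true (down e ≈? d) (λ v → refl)))

    𝟙-xor : ∀ a b → 𝟙 (a xor b) ≤ 𝟙 a + 𝟙 b
    𝟙-xor true  true  = z≤n
    𝟙-xor true  false = ℕ.≤-refl
    𝟙-xor false b     = ℕ.≤-refl

    -- Double counting of pairs of a face and an edge of its boundary: an edge has two sides, and
    -- each matches at most one representative.
    four-faces≤ : length ds * 4 ≤ ne * 2
    four-faces≤ = ℕ.≤-trans (∑-≥-const 4 ds face-size) (ℕ.≤-trans (ℕ.≤-reflexive (ℕΣ.∑-swap ds (allFin ne) _))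
      (ℕ.≤-trans (∑-mono (allFin ne) two) (ℕ.≤-reflexive (≡-trans (∑-const (allFin ne) 2) (cong (_* 2) (length-tabulate (id {A = Fin ne})))))))
      where
      two : ∀ e → ∑ ds (λ d → 𝟙 (boundary d e)) ≤ 2
      two e = ℕ.≤-trans (∑-mono ds (λ d → 𝟙-xor (does (up e ≈? d)) _))
        (ℕ.≤-trans (ℕ.≤-reflexive (ℕΣ.∑-∙ ds _ _)) (ℕ.+-mono-≤ (hit (up e)) (hit (down e))))
        where
        hit : ∀ r → ∑ ds (λ d → 𝟙 (does (r ≈? d))) ≤ 1
        hit r = transversal-hit _≈?_ (λ zx zy v → ≡-trans (≡-sym (zx v)) (zy v)) r ds ds!

    -- A closed z on which all faces agree vanishes: each of its edges would separate two faces.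
    faces-separate : ∀ z → Closed z → (∀ {d d′} → d ∈ ds → d′ ∈ ds → ⟦ d ⟧ (tabulate z) ≡ ⟦ d′ ⟧ (tabulate z)) →
      ∀ e → z e ≢ true
    faces-separate z cl agree e ze =
      let (d  , d∈  , eq)  = proj₁ (proj₂ (proj₂ faces)) (∈-++⁺ˡ (∈-map⁺ up e∈))
          (d′ , d′∈ , eq′) = proj₁ (proj₂ (proj₂ faces)) (∈-++⁺ʳ (map up nonBridges) (∈-map⁺ down e∈))
      in differ (≡-trans (eq v) (≡-trans (agree d∈ d′∈) (≡-sym (eq′ v))))
      where
      v = tabulate z
      zval-v : zval v e ≡ true
      zval-v = ≡-trans (zval-tabulate z cl e) ze
      differ : ⟦ up e ⟧ v ≢ ⟦ down e ⟧ v
      differ eq = 𝔹.not-¬ {⟦ up e ⟧ v} refl (≡-trans eq (≡-trans (⟦down⟧ e v) (≡-trans (cong (⟦ up e ⟧ v xor_) zval-v) (xor-comm _ true))))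
      e∈ : e ∈ nonBridges
      e∈ = ∈-filter⁺ (λ e → ¬? (up e ≈? down e)) (∈-allFin e) (λ eq → differ (eq v))

    ⟦⟧-tabulate : ∀ z → Closed z → ∀ r → ⟦ r ⟧ (tabulate z) ≡ ⨁ (allFin ne) (λ j → r j ∧ z j)
    ⟦⟧-tabulate z cl r = 𝔽₂.∑-cong (allFin ne) (λ j → cong (r j ∧_) (zval-tabulate z cl j))

    agree-with : ∀ d₀ (z : Fin ne → Bool) → Closed z → ∀ d → ⨁ (allFin ne) (λ j → (d j xor d₀ j) ∧ z j) ≡ false →
      ⟦ d ⟧ (tabulate z) ≡ ⟦ d₀ ⟧ (tabulate z)
    agree-with d₀ z cl d row = begin
      ⟦ d ⟧ (tabulate z)                  ≡⟨ ⟦⟧-tabulate z cl d ⟩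
      ⨁ (allFin ne) (λ j → d j ∧ z j)     ≡⟨ xor≡false⇒≡ _ _ (≡-trans (≡-sym (𝔽₂.∑-∙ (allFin ne) (λ j → d j ∧ z j) (λ j → d₀ j ∧ z j)))
        (≡-trans (𝔽₂.∑-cong (allFin ne) (λ j → ≡-sym (∧-distribʳ-xor (z j) (d j) (d₀ j)))) row)) ⟩
      ⨁ (allFin ne) (λ j → d₀ j ∧ z j)    ≡⟨ ⟦⟧-tabulate z cl d₀ ⟨
      ⟦ d₀ ⟧ (tabulate z)                 ∎

    -- The equation of vertex `zero` is left out and recovered by `closed-but-one`: the source of v
    -- - 1.
    vertexRows : List (Fin ne → Bool)
    vertexRows = map (λ w → incidence white black (suc w)) (allFin n₁)

    length-vertexRows : length vertexRows ≡ n₁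
    length-vertexRows = ≡-trans (length-map _ (allFin n₁)) (length-tabulate (id {A = Fin n₁}))

    rows⇒closed : (z : Fin ne → Bool) → (∀ {r} → r ∈ vertexRows → ⨁ (allFin ne) (λ j → r j ∧ z j) ≡ false) → Closed z
    rows⇒closed z sat = closed-but-one white black {zero} z λ where
      zero    ≢0 → ⊥-elim (≢0 refl)
      (suc w) _  → ≡-trans (𝔽₂.∑-cong (allFin ne) (λ e → ∧-comm (z e) (incidence white black (suc w) e)))
                           (sat (∈-map⁺ (λ w → incidence white black (suc w)) (∈-allFin w)))

    -- Agreement of all faces is agreement with the first one, which saves one equation: the source
    -- of f - 1.
    faceRows : List (Fin ne → Bool) → List (Fin ne → Bool)
    faceRows []       = []
    faceRows (d₀ ∷ D) = map (λ d j → d j xor d₀ j) D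

    length-faceRows : ∀ D → length (faceRows D) ≡ ℕ.pred (length D)
    length-faceRows []       = refl
    length-faceRows (d₀ ∷ D) = length-map _ D

    rows⇒agree : ∀ D (z : Fin ne → Bool) → Closed z → (∀ {r} → r ∈ faceRows D → ⨁ (allFin ne) (λ j → r j ∧ z j) ≡ false) →
      ∀ {d d′} → d ∈ D → d′ ∈ D → ⟦ d ⟧ (tabulate z) ≡ ⟦ d′ ⟧ (tabulate z)
    rows⇒agree (d₀ ∷ D) z cl sat d∈ d′∈ = ≡-trans (with-d₀ d∈) (≡-sym (with-d₀ d′∈))
      where
      with-d₀ : ∀ {d} → d ∈ d₀ ∷ D → ⟦ d ⟧ (tabulate z) ≡ ⟦ d₀ ⟧ (tabulate z)
      with-d₀ (here refl) = refl
      with-d₀ {d} (there d∈) = agree-with d₀ z cl d (sat (∈-map⁺ (λ d j → d j xor d₀ j) d∈))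

    -- Were there fewer equations than edges, a nonzero solution would be a cycle on which all faces
    -- agree, against `faces-separate`.
    euler-inequality : ne ≤ n₁ + ℕ.pred (length ds)
    euler-inequality = ℕ.≮⇒≥ too-few
      where
      rows = vertexRows ++ faceRows ds
      length-rows : length rows ≡ n₁ + ℕ.pred (length ds)
      length-rows = ≡-trans (length-++ vertexRows) (cong₂ _+_ length-vertexRows (length-faceRows ds))
      too-few : ¬ n₁ + ℕ.pred (length ds) < ne
      too-few lt with underdetermined-list rows (subst (_< ne) (≡-sym length-rows) lt)
      ... | z , (e , ze) , sat = faces-separate z cl (rows⇒agree ds z cl (sat ∘ ∈-++⁺ʳ vertexRows)) e ze
        where
        cl : Closed z
        cl = rows⇒closed z (sat ∘ ∈-++⁺ˡ)

    bipartite-bound : 2 ≤ n₁ → ne + 4 ≤ 2 * suc n₁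
    bipartite-bound 2≤n₁ = edge-bound-arithmetic (length ds) 2≤n₁ euler-inequality four-faces≤

  -- Edge counts of planar layers and of the product.

  module _ {A : Set} where

    lookup-injective : ∀ {xs : List A} → Unique xs → ∀ i j → List.lookup xs i ≡ List.lookup xs j → i ≡ j
    lookup-injective (x∉ ∷ _)  zero    zero    _  = refl
    lookup-injective (x∉ ∷ _)  zero    (suc j) eq = ⊥-elim (All.lookup x∉ (∈-lookup j) eq)
    lookup-injective (x∉ ∷ _)  (suc i) zero    eq = ⊥-elim (All.lookup x∉ (∈-lookup i) (≡-sym eq))
    lookup-injective (_ ∷ xs!) (suc i) (suc j) eq = cong suc (lookup-injective xs! i j eq)

    length-filter : {P : A → Set} (P? : ∀ x → Dec (P x)) → ∀ xs → length (filter P? xs) ≡ ∑ xs (λ x → 𝟙 (does (P? x)))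
    length-filter P? []       = refl
    length-filter P? (x ∷ xs) with does (P? x)
    ... | true  = cong suc (length-filter P? xs)
    ... | false = length-filter P? xs

    sum-map : ∀ (f : A → ℕ) xs → sum (map f xs) ≡ ∑ xs f
    sum-map f []       = refl
    sum-map f (x ∷ xs) = cong (f x +_) (sum-map f xs)

  ∑-cartesianProduct : {A B : Set} → ∀ (xs : List A) (ys : List B) f → ∑ (cartesianProduct xs ys) f ≡ ∑ xs (λ x → ∑ ys (λ y → f (x , y)))
  ∑-cartesianProduct []       ys f = refl
  ∑-cartesianProduct (x ∷ xs) ys f = ≡-trans (ℕΣ.∑-++ (map (x ,_) ys) (cartesianProduct xs ys) f)
    (cong₂ _+_ (ℕΣ.∑-map (x ,_) ys f) (∑-cartesianProduct xs ys f))

  numEdges-∑ : ∀ {n} (G : Graph n) →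
    numEdges G ≡ ∑ (allFin n) (λ u → ∑ (allFin n) (λ v → 𝟙 ((toℕ u <ᵇ toℕ v) ∧ G u v)))
  numEdges-∑ {n} G = ≡-trans (sum-map _ (allFin n)) (ℕΣ.∑-cong (allFin n) (λ u → sum-map _ (allFin n)))

  module EdgeList {n : ℕ} (H : Graph n) where

    isEdge? : (p : Fin n × Fin n) → Dec (toℕ (proj₁ p) < toℕ (proj₂ p) × H (proj₁ p) (proj₂ p) ≡ true)
    isEdge? (u , v) = (toℕ u ℕ.<? toℕ v) ×-dec (H u v 𝔹.≟ true)

    edges : List (Fin n × Fin n)
    edges = filter isEdge? (cartesianProduct (allFin n) (allFin n))

    edges! : Unique edges
    edges! = Unique.filter⁺ isEdge? (Unique.cartesianProduct⁺ (Unique.allFin⁺ n) (Unique.allFin⁺ n))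

    src tgt : Fin (length edges) → Fin n
    src e = proj₁ (List.lookup edges e)
    tgt e = proj₂ (List.lookup edges e)

    is-edge : ∀ e → toℕ (src e) < toℕ (tgt e) × H (src e) (tgt e) ≡ true
    is-edge e = proj₂ (∈-filter⁻ isEdge? {xs = cartesianProduct (allFin n) (allFin n)} (∈-lookup {xs = edges} e))

    edge-injective : ∀ e e′ → src e ≡ src e′ → tgt e ≡ tgt e′ → e ≡ e′
    edge-injective e e′ s t = lookup-injective edges! e e′ (cong₂ _,_ s t)

    length-edges : length edges ≡ numEdges H
    length-edges = begin
      length edges ≡⟨ length-filter isEdge? (cartesianProduct (allFin n) (allFin n)) ⟩
      ∑ (cartesianProduct (allFin n) (allFin n)) (λ p → 𝟙 (does (isEdge? p))) ≡⟨ ∑-cartesianProduct (allFin n) (allFin n) _ ⟩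
      ∑ (allFin n) (λ u → ∑ (allFin n) (λ v → 𝟙 ((toℕ u <ᵇ toℕ v) ∧ does (H u v 𝔹.≟ true))))
        ≡⟨ ℕΣ.∑-cong (allFin n) (λ u → ℕΣ.∑-cong (allFin n) (λ v → cong (λ b → 𝟙 ((toℕ u <ᵇ toℕ v) ∧ b)) (does-≟-true (H u v)))) ⟩
      ∑ (allFin n) (λ u → ∑ (allFin n) (λ v → 𝟙 ((toℕ u <ᵇ toℕ v) ∧ H u v))) ≡⟨ numEdges-∑ H ⟨
      numEdges H ∎
      where
      open ≡-Reasoning
      does-≟-true : ∀ b → does (b 𝔹.≟ true) ≡ b
      does-≟-true true  = refl
      does-≟-true false = refl

  -- The drawing orders the ends of an edge by vertex number, the counting argument by colour.
  -- Incidence is symmetric in the two ends, so evenness passes from one convention to the other.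
  bipartite-planar-bound : ∀ {n} (H : Graph n) (colour : Fin n → Bool) →
    (∀ u v → H u v ≡ true → colour u ≢ colour v) → Planar H → 3 ≤ n → numEdges H + 4 ≤ 2 * n
  bipartite-planar-bound {suc n₁} H colour proper planar (s≤s 2≤n₁) =
    subst (λ k → k + 4 ≤ 2 * suc n₁) length-edges (bipartite-bound 2≤n₁)
    where
    open EdgeList H
    open Drawing planar src tgt (proj₁ ∘ is-edge) (proj₂ ∘ is-edge) edge-injective using (incident; coefficient; module Faces)
    ne = length edges

    white black : Fin ne → Fin (suc n₁)
    white e = if colour (src e) then tgt e else src e
    black e = if colour (src e) then src e else tgt e

    tgt-colour : ∀ e → colour (tgt e) ≡ not (colour (src e))
    tgt-colour e = 𝔹.¬-not (λ eq → proper (src e) (tgt e) (proj₂ (is-edge e)) (≡-sym eq))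

    white-false : ∀ e → colour (white e) ≡ false
    white-false e with colour (src e) in eq
    ... | true  = ≡-trans (tgt-colour e) (cong not eq)
    ... | false = eq

    black-true : ∀ e → colour (black e) ≡ true
    black-true e with colour (src e) in eq
    ... | true  = eq
    ... | false = ≡-trans (tgt-colour e) (cong not eq)

    injective : ∀ e e′ → white e ≡ white e′ → black e ≡ black e′ → e ≡ e′
    injective e e′ w≡ b≡ with colour (src e) | colour (src e′)
    ... | true  | true  = edge-injective e e′ b≡ w≡
    ... | false | false = edge-injective e e′ w≡ b≡
    ... | true  | false = ⊥-elim (ℕ.<-asym (proj₁ (is-edge e)) (subst₂ (λ a b → toℕ a < toℕ b) (≡-sym w≡) (≡-sym b≡) (proj₁ (is-edge e′))))
    ... | false | true  = ⊥-elim (ℕ.<-asym (proj₁ (is-edge e)) (subst₂ (λ a b → toℕ a < toℕ b) (≡-sym b≡) (≡-sym w≡) (proj₁ (is-edge e′))))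

    incident≡ : ∀ w e → incidence white black w e ≡ incident w e
    incident≡ w e with colour (src e)
    ... | true  = xor-comm (does (w Fin.≟ tgt e)) (does (w Fin.≟ src e))
    ... | false = refl

    faces-even : FaceEven white black coefficient
    faces-even zval closed I I-ext w = ≡-trans
      (𝔽₂.∑-cong (allFin ne) (λ e → cong (_ ∧_) (incident≡ w e)))
      (Faces.face-boundary-even zval
        (λ z w → ≡-trans (𝔽₂.∑-cong (allFin ne) (λ e → cong (zval z e ∧_) (≡-sym (incident≡ w e)))) (closed z w))
        I I-ext w)

    open BipartiteBound white black colour white-false black-true injective coefficient faces-even using (bipartite-bound)

  -- Twice the number of edges for a simple graph. Ordered pairs make products and unions countable
  -- without comparing vertex numbers.
  ∑∑ : ∀ {n} → Graph n → ℕ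
  ∑∑ {n} G = ∑ (allFin n) (λ u → ∑ (allFin n) (λ v → 𝟙 (G u v)))

  handshake : ∀ {n} (G : Graph n) → IsSimple G → ∑∑ G ≡ numEdges G + numEdges G
  handshake {n} G simple = begin
    ∑∑ G
      ≡⟨ ℕΣ.∑-cong (allFin n) (λ u → ≡-trans (ℕΣ.∑-cong (allFin n) (split u)) (ℕΣ.∑-∙ (allFin n) (before u) (λ v → before v u))) ⟩
    ∑ (allFin n) (λ u → ∑ (allFin n) (before u) + ∑ (allFin n) (λ v → before v u))
      ≡⟨ ℕΣ.∑-∙ (allFin n) _ _ ⟩
    ∑ (allFin n) (λ u → ∑ (allFin n) (before u)) + ∑ (allFin n) (λ u → ∑ (allFin n) (λ v → before v u))
      ≡⟨ cong₂ _+_ (≡-sym (numEdges-∑ G)) (≡-trans (ℕΣ.∑-swap (allFin n) (allFin n) (λ u v → before v u)) (≡-sym (numEdges-∑ G))) ⟩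
    numEdges G + numEdges G ∎
    where
    open ≡-Reasoning
    open IsSimple simple
    before : Fin n → Fin n → ℕ
    before u v = 𝟙 ((toℕ u <ᵇ toℕ v) ∧ G u v)
    split : ∀ u v → 𝟙 (G u v) ≡ before u v + before v u
    split u v with ℕ.<-cmp (toℕ u) (toℕ v)
    ... | tri< lt _ ≯ = ≡-sym (≡-trans (cong₂ _+_
      (cong (λ b → 𝟙 (b ∧ G u v)) (dec-true (toℕ u ℕ.<? toℕ v) lt))
      (cong (λ b → 𝟙 (b ∧ G v u)) (dec-false (toℕ v ℕ.<? toℕ u) ≯))) (ℕ.+-identityʳ (𝟙 (G u v))))
    ... | tri> ≮ _ gt = ≡-sym (≡-trans (cong₂ _+_
      (cong (λ b → 𝟙 (b ∧ G u v)) (dec-false (toℕ u ℕ.<? toℕ v) ≮))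
      (cong (λ b → 𝟙 (b ∧ G v u)) (dec-true (toℕ v ℕ.<? toℕ u) gt))) (cong 𝟙 (sym v u)))
    ... | tri≈ ≮ eq ≯ with toℕ-injective eq
    ...   | refl = ≡-trans (cong 𝟙 (irrefl u)) (≡-sym (cong₂ _+_
      (cong (λ b → 𝟙 (b ∧ G u u)) (dec-false (toℕ u ℕ.<? toℕ u) ≮))
      (cong (λ b → 𝟙 (b ∧ G u u)) (dec-false (toℕ u ℕ.<? toℕ u) ≯))))

  ∑-allFin-*2 : ∀ n (f : Fin (n * 2) → ℕ) →
    ∑ (allFin (n * 2)) f ≡ ∑ (allFin n) (λ g → f (combine g zero) + f (combine g (suc zero)))
  ∑-allFin-*2 zero    f = refl
  ∑-allFin-*2 (suc n) f = begin
    ∑ (allFin (suc n * 2)) f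
      ≡⟨ ℕΣ.∑-allFin-suc (suc (n * 2)) f ⟩
    f zero + ∑ (allFin (suc (n * 2))) (f ∘ suc)
      ≡⟨ cong (f zero +_) (ℕΣ.∑-allFin-suc (n * 2) (f ∘ suc)) ⟩
    f zero + (f (suc zero) + ∑ (allFin (n * 2)) (λ x → f (suc (suc x))))
      ≡⟨ ℕ.+-assoc (f zero) _ _ ⟨
    f zero + f (suc zero) + ∑ (allFin (n * 2)) (λ x → f (suc (suc x)))
      ≡⟨ cong (f zero + f (suc zero) +_) (∑-allFin-*2 n (λ x → f (suc (suc x)))) ⟩
    f zero + f (suc zero) + ∑ (allFin n) (λ g → f (suc (suc (combine g zero))) + f (suc (suc (combine g (suc zero)))))
      ≡⟨ ℕΣ.∑-allFin-suc n (λ g → f (combine g zero) + f (combine g (suc zero))) ⟨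
    ∑ (allFin (suc n)) (λ g → f (combine g zero) + f (combine g (suc zero))) ∎
    where open ≡-Reasoning

  ×ₖ-combine : ∀ {n m} (G : Graph n) (H : Graph m) g h g′ h′ → (G ×ₖ H) (combine g h) (combine g′ h′) ≡ G g g′ ∧ H h h′
  ×ₖ-combine G H g h g′ h′ = cong₂ (λ (a , b) (c , d) → G a c ∧ H b d) (remQuot-combine g h) (remQuot-combine g′ h′)

  -- Each of the two copies of a vertex is adjacent only to copies on the other side, so its row
  -- repeats the row of `G`.
  ∑∑-×K₂ : ∀ {n} (G : Graph n) → ∑∑ (G ×ₖ K 2) ≡ ∑∑ G + ∑∑ G
  ∑∑-×K₂ {n} G = begin
    ∑∑ P
      ≡⟨ ∑-allFin-*2 n (λ x → ∑ (allFin (n * 2)) (λ y → 𝟙 (P x y))) ⟩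
    ∑ (allFin n) (λ g → ∑ (allFin (n * 2)) (λ y → 𝟙 (P (combine g zero) y)) + ∑ (allFin (n * 2)) (λ y → 𝟙 (P (combine g (suc zero)) y)))
      ≡⟨ ℕΣ.∑-cong (allFin n) (λ g → cong₂ _+_ (row₀ g) (row₁ g)) ⟩
    ∑ (allFin n) (λ g → ∑ (allFin n) (λ g′ → 𝟙 (G g g′)) + ∑ (allFin n) (λ g′ → 𝟙 (G g g′)))
      ≡⟨ ℕΣ.∑-∙ (allFin n) _ _ ⟩
    ∑∑ G + ∑∑ G ∎
    where
    open ≡-Reasoning
    P = G ×ₖ K 2
    row₀ : ∀ g → ∑ (allFin (n * 2)) (λ y → 𝟙 (P (combine g zero) y)) ≡ ∑ (allFin n) (λ g′ → 𝟙 (G g g′))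
    row₀ g = ≡-trans (∑-allFin-*2 n _) (ℕΣ.∑-cong (allFin n) (λ g′ → cong₂ _+_
      (cong 𝟙 (≡-trans (×ₖ-combine G (K 2) g zero g′ zero) (∧-zeroʳ (G g g′))))
      (cong 𝟙 (≡-trans (×ₖ-combine G (K 2) g zero g′ (suc zero)) (∧-identityʳ (G g g′))))))
    row₁ : ∀ g → ∑ (allFin (n * 2)) (λ y → 𝟙 (P (combine g (suc zero)) y)) ≡ ∑ (allFin n) (λ g′ → 𝟙 (G g g′))
    row₁ g = ≡-trans (∑-allFin-*2 n _) (ℕΣ.∑-cong (allFin n) (λ g′ → ≡-trans (cong₂ _+_
      (cong 𝟙 (≡-trans (×ₖ-combine G (K 2) g (suc zero) g′ zero) (∧-identityʳ (G g g′))))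
      (cong 𝟙 (≡-trans (×ₖ-combine G (K 2) g (suc zero) g′ (suc zero)) (∧-zeroʳ (G g g′))))) (ℕ.+-identityʳ _)))

  sideOf : ∀ {n} → Fin (n * 2) → Fin 2
  sideOf {n} x = proj₂ (remQuot {n} 2 x)

  K₂-proper : ∀ (h h′ : Fin 2) → K 2 h h′ ≡ true → does (h Fin.≟ zero) ≢ does (h′ Fin.≟ zero)
  K₂-proper zero       zero       ()
  K₂-proper zero       (suc zero) _  ()
  K₂-proper (suc zero) zero       _  ()
  K₂-proper (suc zero) (suc zero) ()

  ∑-term≤ : {A : Set} → ∀ {xs} (f : A → ℕ) {x} → x ∈ xs → f x ≤ ∑ xs f
  ∑-term≤ f (here refl) = ℕ.m≤m+n _ _
  ∑-term≤ f (there x∈)  = ℕ.≤-trans (∑-term≤ f x∈) (ℕ.m≤n+m _ _)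

  ∑∑-union : ∀ {m k} (P : Graph m) (H : Fin k → Graph m) → (∀ u v → P u v ≡ true → ∃ λ c → H c u v ≡ true) →
    ∑∑ P ≤ ∑ (allFin k) (λ c → ∑∑ (H c))
  ∑∑-union {m} {k} P H covers = ℕ.≤-trans
    (∑-mono (allFin m) (λ u → ℕ.≤-trans (∑-mono (allFin m) (bound u)) (ℕ.≤-reflexive (ℕΣ.∑-swap (allFin m) (allFin k) _))))
    (ℕ.≤-reflexive (ℕΣ.∑-swap (allFin m) (allFin k) _))
    where
    bound : ∀ u v → 𝟙 (P u v) ≤ ∑ (allFin k) (λ c → 𝟙 (H c u v))
    bound u v with P u v in eq
    ... | false = z≤n
    ... | true  = let (c , h) = covers u v eq in
      ℕ.≤-trans (ℕ.≤-reflexive (cong 𝟙 (≡-sym h))) (∑-term≤ (λ c → 𝟙 (H c u v)) (∈-allFin c))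

  ⌈/⌉≤ : ∀ a b k → a ≤ k * b → ⌈ a / b ⌉ ≤ k
  ⌈/⌉≤ a zero    k _ = z≤n
  ⌈/⌉≤ a (suc b) k h = ℕ.s≤s⁻¹ (m<n*o⇒m/o<n {n = suc k} (ℕ.≤-trans (ℕ.≤-reflexive (≡-sym (ℕ.+-suc a b)))
    (ℕ.≤-trans (ℕ.+-monoˡ-≤ (suc b) h) (ℕ.≤-reflexive (ℕ.+-comm (k * suc b) (suc b))))))

  module _ {n : ℕ} (2≤n : 2 ≤ n) (G : Graph n) (simple : IsSimple G) where

    thickness-lower : ∀ k → Decomposition k (G ×ₖ K 2) → ⌈ numEdges G / 2 * n ∸ 2 ⌉ ≤ k
    thickness-lower k (H , simples , planars , subgraphs , covers) = ⌈/⌉≤ (numEdges G) (2 * n ∸ 2) k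
      -- The factor 4: ordered pairs double |E(G)|, and the product with `K 2` doubles it again. A
      -- layer has at most 2(2n - 2) edges, hence 4(2n - 2) ordered pairs.
      (ℕ.*-cancelˡ-≤ 4 (begin
        4 * E                                         ≡⟨ lem E ⟩
        (E + E) + (E + E)                             ≡⟨ cong₂ _+_ (handshake G simple) (handshake G simple) ⟨
        ∑∑ G + ∑∑ G                                   ≡⟨ ∑∑-×K₂ G ⟨
        ∑∑ (G ×ₖ K 2)                                 ≤⟨ ∑∑-union (G ×ₖ K 2) H covers ⟩
        ∑ (allFin k) (λ c → ∑∑ (H c))                 ≤⟨ ∑-mono (allFin k) each ⟩
        ∑ (allFin k) (λ _ → 4 * (2 * n ∸ 2))          ≡⟨ ∑-const (allFin k) _ ⟩
        length (allFin k) * (4 * (2 * n ∸ 2))         ≡⟨ cong (_* (4 * (2 * n ∸ 2))) (length-tabulate (id {A = Fin k})) ⟩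
        k * (4 * (2 * n ∸ 2))                         ≡⟨ lem₂ k (2 * n ∸ 2) ⟩
        4 * (k * (2 * n ∸ 2))                         ∎))
      where
      open ℕ.≤-Reasoning
      E = numEdges G
      lem : ∀ e → 4 * e ≡ (e + e) + (e + e)
      lem = solveℕ-∀
      lem₂ : ∀ k b → k * (4 * b) ≡ 4 * (k * b)
      lem₂ = solveℕ-∀
      lem₃ : ∀ n → 2 * (n * 2) ≡ 2 * (2 * n)
      lem₃ = solveℕ-∀
      lem₄ : ∀ b → 2 * b + 2 * b ≡ 4 * b
      lem₄ = solveℕ-∀
      3≤n*2 : 3 ≤ n * 2
      3≤n*2 = ℕ.≤-trans (ℕ.n≤1+n 3) (ℕ.*-monoˡ-≤ 2 2≤n)
      proper : ∀ c u v → H c u v ≡ true → does (sideOf {n} u Fin.≟ zero) ≢ does (sideOf {n} v Fin.≟ zero)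
      proper c u v h = K₂-proper (sideOf {n} u) (sideOf {n} v)
        (proj₂ (∧-true {G (proj₁ (remQuot {n} 2 u)) (proj₁ (remQuot {n} 2 v))} (subgraphs c u v h)))
      edges≤ : ∀ c → numEdges (H c) ≤ 2 * (2 * n ∸ 2)
      edges≤ c = begin
        numEdges (H c)             ≤⟨ ℕ.m+n≤o⇒m≤o∸n (numEdges (H c)) (bipartite-planar-bound (H c) _ (proper c) (planars c) 3≤n*2) ⟩
        2 * (n * 2) ∸ 4            ≡⟨ cong (_∸ 4) (lem₃ n) ⟩
        2 * (2 * n) ∸ 2 * 2        ≡⟨ ℕ.*-distribˡ-∸ 2 (2 * n) 2 ⟨
        2 * (2 * n ∸ 2)            ∎
      each : ∀ c → ∑∑ (H c) ≤ 4 * (2 * n ∸ 2)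
      each c = begin
        ∑∑ (H c)                                 ≡⟨ handshake (H c) (simples c) ⟩
        numEdges (H c) + numEdges (H c)          ≤⟨ ℕ.+-mono-≤ (edges≤ c) (edges≤ c) ⟩
        2 * (2 * n ∸ 2) + 2 * (2 * n ∸ 2)        ≡⟨ lem₄ (2 * n ∸ 2) ⟩
        4 * (2 * n ∸ 2)                          ∎

-- The upper bound: two fans of segments in one quadrant.

module _ where
  open import Data.Rational using (_+_; _*_; _-_; -_; _≤_; _<_; 1/_)
  open import Data.Rational.Properties using (_≟_)

  nonNeg-sum-zero : ∀ a b → 0ℚ ≤ a → 0ℚ ≤ b → a + b ≡ 0ℚ → a ≡ 0ℚ × b ≡ 0ℚ
  nonNeg-sum-zero a b 0≤a 0≤b eq = ℚ.≤-antisym (subst (a ≤_) eq (subst (_≤ a + b) (ℚ.+-identityʳ a) (ℚ.+-monoʳ-≤ a 0≤b))) 0≤a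
    , ℚ.≤-antisym (subst (b ≤_) eq (subst (_≤ a + b) (ℚ.+-identityˡ b) (ℚ.+-monoˡ-≤ b 0≤a))) 0≤b

  *-zero-split : ∀ a b → a * b ≡ 0ℚ → a ≡ 0ℚ ⊎ b ≡ 0ℚ
  *-zero-split a b eq with a ≟ 0ℚ
  ... | yes a≡0 = inj₁ a≡0
  ... | no a≢0 = inj₂ (begin
    b                 ≡⟨ ℚ.*-identityˡ b ⟨
    1ℚ * b            ≡⟨ cong (_* b) (ℚ.*-inverseˡ a) ⟨
    1/ a * a * b      ≡⟨ ℚ.*-assoc (1/ a) a b ⟩
    1/ a * (a * b)    ≡⟨ cong (1/ a *_) eq ⟩
    1/ a * 0ℚ         ≡⟨ ℚ.*-zeroʳ (1/ a) ⟩
    0ℚ ∎)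
    where
    open ≡-Reasoning
    instance
      nz : ℚ.NonZero a
      nz = ℚ.≢-nonZero a≢0

  double-zero : ∀ a → 0ℚ ≤ a → (1ℚ + 1ℚ) * a ≡ 0ℚ → a ≡ 0ℚ
  double-zero a 0≤a eq = proj₁ (nonNeg-sum-zero a a 0≤a 0≤a (≡-trans (lem a) eq))
    where
    lem : ∀ a → a + a ≡ (1ℚ + 1ℚ) * a
    lem = solve-∀ ℚ-ring

  data Fan : Set where
    outer inner : Fan

  2ℚ : ℚ
  2ℚ = 1ℚ + 1ℚ

  -- In the closed first quadrant every edge joins (0,2) or (1,0) to a point of the
  -- diagonal from (2,0) to (0,1); the other quadrants are rotated copies.
  apex₀ : Fan → Point
  apex₀ outer = 0ℚ , 2ℚ
  apex₀ inner = 1ℚ , 0ℚ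

  -- Both ends of the diagonal are corners of the cube, so the edges of the cube are themselves fan
  -- edges, with τ = 0 or τ = 1.
  tip₀ : ℚ → Point
  tip₀ τ = 2ℚ * (1ℚ - τ) , τ

  -- A spoke lies in two closed quadrants; excluding τ = 1 from the outer fan leaves it with one name.
  Valid : Fan → ℚ → Set
  Valid outer τ = 0ℚ ≤ τ × τ < 1ℚ
  Valid inner τ = 0ℚ ≤ τ × τ ≤ 1ℚ

  valid≤ : ∀ f {τ} → Valid f τ → 0ℚ ≤ τ × 0ℚ ≤ 1ℚ - τ
  valid≤ outer (0≤τ , τ<1) = 0≤τ , 0≤q-p (ℚ.<⇒≤ τ<1)
  valid≤ inner (0≤τ , τ≤1) = 0≤τ , 0≤q-p τ≤1

  End₀ : Fan → ℚ → Point → Set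
  End₀ f τ p = p ≡ apex₀ f ⊎ p ≡ tip₀ τ

  fanX fanY : Fan → ℚ → ℚ → ℚ
  fanX outer t τ = 2ℚ * (t * (1ℚ - τ))
  fanX inner t τ = (1ℚ - t) + 2ℚ * (t * (1ℚ - τ))
  fanY outer t τ = 2ℚ * (1ℚ - t) + t * τ
  fanY inner t τ = t * τ

  -- `t` runs from the apex to the tip. The coordinates are expanded into products of the factors t,
  -- 1 - t, τ and 1 - τ, so that their signs are visible.
  record Param (f : Fan) (τ x y : ℚ) : Set where
    field
      t   : ℚ
      0≤t : 0ℚ ≤ t
      0≤s : 0ℚ ≤ 1ℚ - t
      atApex : t ≡ 0ℚ → (x , y) ≡ apex₀ f
      atTip  : 1ℚ - t ≡ 0ℚ → (x , y) ≡ tip₀ τ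
      x≡ : x ≡ fanX f t τ
      y≡ : y ≡ fanY f t τ

  onSeg-at-0 : ∀ p q r ((t , _) : OnSeg p q r) → t ≡ 0ℚ → r ≡ p
  onSeg-at-0 (p₁ , p₂) (q₁ , q₂) r (t , _ , _ , e₁ , e₂) refl = cong₂ _,_ (≡-trans e₁ (lem p₁ q₁)) (≡-trans e₂ (lem p₂ q₂))
    where
    lem : ∀ p q → p + 0ℚ * (q - p) ≡ p
    lem = solve-∀ ℚ-ring

  onSeg-at-1 : ∀ p q r ((t , _) : OnSeg p q r) → 1ℚ - t ≡ 0ℚ → r ≡ q
  onSeg-at-1 (p₁ , p₂) (q₁ , q₂) r (t , _ , _ , e₁ , e₂) s≡0 = cong₂ _,_ (at p₁ q₁ e₁) (at p₂ q₂ e₂)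
    where
    lem : ∀ p q t → p + t * (q - p) ≡ q + (1ℚ - t) * (p - q)
    lem = solve-∀ ℚ-ring
    lem₀ : ∀ p q → q + 0ℚ * (p - q) ≡ q
    lem₀ = solve-∀ ℚ-ring
    at : ∀ p q {r} → r ≡ p + t * (q - p) → r ≡ q
    at p q eq = ≡-trans eq (≡-trans (lem p q t) (≡-trans (cong (λ s → q + s * (p - q)) s≡0) (lem₀ p q)))

  param : ∀ f τ x y → OnSeg (apex₀ f) (tip₀ τ) (x , y) → Param f τ x y
  param outer τ x y on@(t , 0≤t , t≤1 , e₁ , e₂) = record
    { t = t ; 0≤t = 0≤t ; 0≤s = 0≤q-p t≤1
    ; atApex = onSeg-at-0 (apex₀ outer) (tip₀ τ) (x , y) on ; atTip = onSeg-at-1 (apex₀ outer) (tip₀ τ) (x , y) on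
    ; x≡ = ≡-trans e₁ (lem₁ t τ) ; y≡ = ≡-trans e₂ (lem₂ t τ) }
    where
    lem₁ : ∀ t τ → 0ℚ + t * ((1ℚ + 1ℚ) * (1ℚ - τ) - 0ℚ) ≡ (1ℚ + 1ℚ) * (t * (1ℚ - τ))
    lem₁ = solve-∀ ℚ-ring
    lem₂ : ∀ t τ → (1ℚ + 1ℚ) + t * (τ - (1ℚ + 1ℚ)) ≡ (1ℚ + 1ℚ) * (1ℚ - t) + t * τ
    lem₂ = solve-∀ ℚ-ring
  param inner τ x y on@(t , 0≤t , t≤1 , e₁ , e₂) = record
    { t = t ; 0≤t = 0≤t ; 0≤s = 0≤q-p t≤1
    ; atApex = onSeg-at-0 (apex₀ inner) (tip₀ τ) (x , y) on ; atTip = onSeg-at-1 (apex₀ inner) (tip₀ τ) (x , y) on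
    ; x≡ = ≡-trans e₁ (lem₁ t τ) ; y≡ = ≡-trans e₂ (lem₂ t τ) }
    where
    lem₁ : ∀ t τ → 1ℚ + t * ((1ℚ + 1ℚ) * (1ℚ - τ) - 1ℚ) ≡ (1ℚ - t) + (1ℚ + 1ℚ) * (t * (1ℚ - τ))
    lem₁ = solve-∀ ℚ-ring
    lem₂ : ∀ t τ → 0ℚ + t * (τ - 0ℚ) ≡ t * τ
    lem₂ = solve-∀ ℚ-ring

  0≤2 : 0ℚ ≤ 2ℚ
  0≤2 = ℚ.nonNegative⁻¹ 2ℚ

  +-nonNeg : ∀ {p q} → 0ℚ ≤ p → 0ℚ ≤ q → 0ℚ ≤ p + q
  +-nonNeg {p} {q} 0≤p 0≤q = subst (_≤ p + q) (ℚ.+-identityˡ 0ℚ) (ℚ.+-mono-≤ 0≤p 0≤q)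

  fanX-nonNeg : ∀ f {t τ} → 0ℚ ≤ t → 0ℚ ≤ 1ℚ - t → 0ℚ ≤ 1ℚ - τ → 0ℚ ≤ fanX f t τ
  fanX-nonNeg outer {t} {τ} 0≤t 0≤s 0≤u = *-nonNeg {2ℚ} {t * (1ℚ - τ)} 0≤2 (*-nonNeg {t} {1ℚ - τ} 0≤t 0≤u)
  fanX-nonNeg inner {t} {τ} 0≤t 0≤s 0≤u = +-nonNeg 0≤s (*-nonNeg {2ℚ} {t * (1ℚ - τ)} 0≤2 (*-nonNeg {t} {1ℚ - τ} 0≤t 0≤u))

  fanY-nonNeg : ∀ f {t τ} → 0ℚ ≤ t → 0ℚ ≤ 1ℚ - t → 0ℚ ≤ τ → 0ℚ ≤ fanY f t τ
  fanY-nonNeg outer {t} {τ} 0≤t 0≤s 0≤τ = +-nonNeg (*-nonNeg {2ℚ} {1ℚ - t} 0≤2 0≤s) (*-nonNeg {t} {τ} 0≤t 0≤τ)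
  fanY-nonNeg inner {t} {τ} 0≤t 0≤s 0≤τ = *-nonNeg {t} {τ} 0≤t 0≤τ

  module _ {f τ x y} (v : Valid f τ) (P : Param f τ x y) where
    open Param P

    x-nonNeg : 0ℚ ≤ x
    x-nonNeg = subst (0ℚ ≤_) (≡-sym x≡) (fanX-nonNeg f 0≤t 0≤s (proj₂ (valid≤ f v)))

    y-nonNeg : 0ℚ ≤ y
    y-nonNeg = subst (0ℚ ≤_) (≡-sym y≡) (fanY-nonNeg f 0≤t 0≤s (proj₁ (valid≤ f v)))

  level : Fan → ℚ → ℚ
  level outer s = 2ℚ * s
  level inner s = - s

  -- x + 2y − 2 vanishes on the diagonal carrying the tips.
  level≡ : ∀ {f τ x y} (P : Param f τ x y) → x + 2ℚ * y - 2ℚ ≡ level f (1ℚ - Param.t P)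
  level≡ {f} {τ} P = ≡-trans (cong₂ (λ a b → a + 2ℚ * b - 2ℚ) x≡ y≡) (go f)
    where
    open Param P
    lem₁ : ∀ t τ → (1ℚ + 1ℚ) * (t * (1ℚ - τ)) + (1ℚ + 1ℚ) * ((1ℚ + 1ℚ) * (1ℚ - t) + t * τ) - (1ℚ + 1ℚ) ≡ (1ℚ + 1ℚ) * (1ℚ - t)
    lem₁ = solve-∀ ℚ-ring
    lem₂ : ∀ t τ → (1ℚ - t) + (1ℚ + 1ℚ) * (t * (1ℚ - τ)) + (1ℚ + 1ℚ) * (t * τ) - (1ℚ + 1ℚ) ≡ - (1ℚ - t)
    lem₂ = solve-∀ ℚ-ring
    go : ∀ f → fanX f t τ + 2ℚ * fanY f t τ - 2ℚ ≡ level f (1ℚ - t)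
    go outer = lem₁ t τ
    go inner = lem₂ t τ

  s≡0⇒t≡1 : ∀ {t} → 1ℚ - t ≡ 0ℚ → t ≡ 1ℚ
  s≡0⇒t≡1 eq = ≡-sym (p-q≡0⇒p≡q eq)

  *-cancel-nonzero : ∀ a b c → a * b ≡ a * c → a ≡ 0ℚ ⊎ b ≡ c
  *-cancel-nonzero a b c eq = map⊎ id p-q≡0⇒p≡q (*-zero-split a (b - c)
    (≡-trans (lem a b c) (≡-trans (cong (_- a * c) eq) (ℚ.+-inverseʳ (a * c)))))
    where
    lem : ∀ a b c → a * (b - c) ≡ a * b - a * c
    lem = solve-∀ ℚ-ring

  1-injective : ∀ {a b} → 1ℚ - a ≡ 1ℚ - b → a ≡ b
  1-injective {a} {b} eq = ≡-trans (lem a) (≡-trans (cong (λ c → 1ℚ - c) eq) (≡-sym (lem b)))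
    where
    lem : ∀ a → a ≡ 1ℚ - (1ℚ - a)
    lem = solve-∀ ℚ-ring

  2-cancel : ∀ a b → 2ℚ * a ≡ 2ℚ * b → a ≡ b
  2-cancel a b eq = nonzero (*-cancel-nonzero 2ℚ a b eq)
    where
    nonzero : 2ℚ ≡ 0ℚ ⊎ a ≡ b → a ≡ b
    nonzero (inj₂ a≡b) = a≡b

  -- The level determines `t`; then one coordinate determines τ, unless `t` vanishes and the point
  -- is the apex.
  same-fan : ∀ f {τ τ′ x y} → Param f τ x y → Param f τ′ x y → τ ≡ τ′ ⊎ (x , y) ≡ apex₀ f
  same-fan f {τ} {τ′} P P′ = go f P P′
    where
    t-equal : ∀ f s s′ → level f s ≡ level f s′ → s ≡ s′
    t-equal outer s s′ eq = 2-cancel s s′ eq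
    t-equal inner s s′ eq = ℚ.neg-injective eq
    go : ∀ f {x y} → Param f τ x y → Param f τ′ x y → τ ≡ τ′ ⊎ (x , y) ≡ apex₀ f
    go f P P′ = by-fan f P P′ (1-injective (t-equal f (1ℚ - Param.t P) (1ℚ - Param.t P′) (≡-trans (≡-sym (level≡ P)) (level≡ P′))))
      where
      by-fan : ∀ f {x y} (P : Param f τ x y) (P′ : Param f τ′ x y) → Param.t P ≡ Param.t P′ → τ ≡ τ′ ⊎ (x , y) ≡ apex₀ f
      by-fan outer P P′ t≡t′ = swap⊎ (map⊎ (Param.atApex P) 1-injective (*-cancel-nonzero (Param.t P) (1ℚ - τ) (1ℚ - τ′)
        (2-cancel (Param.t P * (1ℚ - τ)) (Param.t P * (1ℚ - τ′)) (≡-trans (≡-sym (Param.x≡ P))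
          (≡-trans (Param.x≡ P′) (cong (λ t → 2ℚ * (t * (1ℚ - τ′))) (≡-sym t≡t′)))))))
      by-fan inner P P′ t≡t′ = swap⊎ (map⊎ (Param.atApex P) id (*-cancel-nonzero (Param.t P) τ τ′ (≡-trans (≡-sym (Param.y≡ P))
          (≡-trans (Param.y≡ P′) (cong (_* τ′) (≡-sym t≡t′))))))

  -- The level is nonnegative on the outer fan and nonpositive on the inner one, so a common point
  -- lies on the diagonal, where both edges end.
  different-fans : ∀ {τ τ′ x y} → Param outer τ x y → Param inner τ′ x y → (x , y) ≡ tip₀ τ × (x , y) ≡ tip₀ τ′
  different-fans {τ} {τ′} P P′ = Param.atTip P (double-zero s (Param.0≤s P) (proj₁ zeros)) , Param.atTip P′ (proj₂ zeros)
    where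
    s  = 1ℚ - Param.t P
    s′ = 1ℚ - Param.t P′
    zeros : 2ℚ * s ≡ 0ℚ × s′ ≡ 0ℚ
    zeros = nonNeg-sum-zero (2ℚ * s) s′ (*-nonNeg {2ℚ} {s} 0≤2 (Param.0≤s P)) (Param.0≤s P′)
      (≡-trans (cong (_+ s′) (≡-trans (≡-sym (level≡ P)) (level≡ P′))) (ℚ.+-inverseˡ s′))

  meet-in-quadrant : ∀ f f′ {τ τ′ x y} → Param f τ x y → Param f′ τ′ x y →
    (f ≡ f′ × τ ≡ τ′) ⊎ (End₀ f τ (x , y) × End₀ f′ τ′ (x , y))
  meet-in-quadrant outer inner P P′ = let (a , b) = different-fans P P′ in inj₂ (inj₂ a , inj₂ b)
  meet-in-quadrant inner outer P P′ = let (a , b) = different-fans P′ P in inj₂ (inj₂ b , inj₂ a)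
  meet-in-quadrant outer outer P P′ = map⊎ (λ e → refl , e) (λ a → inj₁ a , inj₁ a) (same-fan outer P P′)
  meet-in-quadrant inner inner P P′ = map⊎ (λ e → refl , e) (λ a → inj₁ a , inj₁ a) (same-fan inner P P′)

  -- A sum of nonnegative terms vanishes only termwise, which leaves the corners (0,2) and (0,1).
  -- Their heights are recorded because a quarter turn makes them the abscissae that
  -- `on-horizontal-axis` asks for.
  on-vertical-axis : ∀ f {τ x y} → Valid f τ → Param f τ x y → x ≡ 0ℚ → End₀ f τ (x , y) × (y ≡ 2ℚ ⊎ y ≡ 1ℚ)
  on-vertical-axis outer {τ} {x} {y} (0≤τ , τ<1) P x≡0 = by-cases (*-zero-split t u
      (double-zero (t * u) (*-nonNeg {t} {u} 0≤t (0≤q-p (ℚ.<⇒≤ τ<1))) (≡-trans (≡-sym x≡) x≡0)))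
    where
    open Param P
    u = 1ℚ - τ
    by-cases : t ≡ 0ℚ ⊎ u ≡ 0ℚ → End₀ outer τ (x , y) × (y ≡ 2ℚ ⊎ y ≡ 1ℚ)
    by-cases (inj₁ t≡0) = inj₁ (atApex t≡0) , inj₁ (cong proj₂ (atApex t≡0))
    by-cases (inj₂ u≡0) = ⊥-elim (ℚ.<-irrefl (s≡0⇒t≡1 u≡0) τ<1)
  on-vertical-axis inner {τ} {x} {y} (0≤τ , τ≤1) P x≡0 = by-cases (*-zero-split t u
      (double-zero (t * u) (*-nonNeg {t} {u} 0≤t (0≤q-p τ≤1)) (proj₂ zeros)))
    where
    open Param P
    s = 1ℚ - t
    u = 1ℚ - τ
    zeros : s ≡ 0ℚ × 2ℚ * (t * u) ≡ 0ℚ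
    zeros = nonNeg-sum-zero s (2ℚ * (t * u)) 0≤s (*-nonNeg {2ℚ} {t * u} 0≤2 (*-nonNeg {t} {u} 0≤t (0≤q-p τ≤1))) (≡-trans (≡-sym x≡) x≡0)
    by-cases : t ≡ 0ℚ ⊎ u ≡ 0ℚ → End₀ inner τ (x , y) × (y ≡ 2ℚ ⊎ y ≡ 1ℚ)
    by-cases (inj₁ t≡0) = ⊥-elim (ℚ.1≢0 (≡-trans (≡-sym (s≡0⇒t≡1 (proj₁ zeros))) t≡0))
    by-cases (inj₂ u≡0) = inj₂ (atTip (proj₁ zeros)) , inj₂ (≡-trans (cong proj₂ (atTip (proj₁ zeros))) (s≡0⇒t≡1 u≡0))

  -- This axis carries a whole spoke. The condition on `x` singles out its two ends, the only points
  -- that the neighbouring quadrant reaches.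
  on-horizontal-axis : ∀ f {τ x y} → Valid f τ → Param f τ x y → y ≡ 0ℚ → x ≡ 2ℚ ⊎ x ≡ 1ℚ → End₀ f τ (x , y)
  on-horizontal-axis outer {τ} (0≤τ , τ<1) P y≡0 _ = inj₂ (atTip (double-zero s 0≤s
    (proj₁ (nonNeg-sum-zero (2ℚ * s) (t * τ) (*-nonNeg {2ℚ} {s} 0≤2 0≤s) (*-nonNeg {t} {τ} 0≤t 0≤τ) (≡-trans (≡-sym y≡) y≡0)))))
    where
    open Param P
    s = 1ℚ - t
  on-horizontal-axis inner {τ} {x} {y} v P y≡0 x-hub = by-cases (*-zero-split t τ (≡-trans (≡-sym y≡) y≡0))
    where
    open Param P
    lem : ∀ t → (1ℚ - t) + (1ℚ + 1ℚ) * (t * (1ℚ - 0ℚ)) ≡ 1ℚ + t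
    lem = solve-∀ ℚ-ring
    lem₁ : ∀ t → 1ℚ - t ≡ (1ℚ + 1ℚ) - (1ℚ + t)
    lem₁ = solve-∀ ℚ-ring
    lem₂ : ∀ t → t ≡ (1ℚ + t) - 1ℚ
    lem₂ = solve-∀ ℚ-ring
    hub : x ≡ 1ℚ + t → x ≡ 2ℚ ⊎ x ≡ 1ℚ → End₀ inner τ (x , y)
    hub x≡1+t (inj₁ x≡2) = inj₂ (atTip (≡-trans (lem₁ t) (≡-trans (cong (λ w → 2ℚ - w) (≡-trans (≡-sym x≡1+t) x≡2)) (ℚ.+-inverseʳ 2ℚ))))
    hub x≡1+t (inj₂ x≡1) = inj₁ (atApex (≡-trans (lem₂ t) (≡-trans (cong (_- 1ℚ) (≡-trans (≡-sym x≡1+t) x≡1)) (ℚ.+-inverseʳ 1ℚ))))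
    by-cases : t ≡ 0ℚ ⊎ τ ≡ 0ℚ → End₀ inner τ (x , y)
    by-cases (inj₁ t≡0) = inj₁ (atApex t≡0)
    by-cases (inj₂ τ≡0) = hub (≡-trans x≡ (≡-trans (cong (λ τ → (1ℚ - t) + 2ℚ * (t * (1ℚ - τ))) τ≡0) (lem t))) x-hub

  -- In the frame of the next quadrant the point is (y, -x). Nonnegativity of x and of -x puts it on
  -- the common axis.
  meet-adjacent : ∀ f f′ {τ τ′ x y x′} → Valid f τ → Valid f′ τ′ → Param f τ x y → Param f′ τ′ y x′ → x′ ≡ - x →
    End₀ f τ (x , y) × End₀ f′ τ′ (y , x′)
  meet-adjacent f f′ {τ} {τ′} {x} {y} {x′} v v′ P P′ x′≡ = proj₁ at-axis , on-horizontal-axis f′ v′ P′ (proj₂ zeros) (proj₂ at-axis)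
    where
    zeros : x ≡ 0ℚ × x′ ≡ 0ℚ
    zeros = nonNeg-sum-zero x x′ (x-nonNeg v P) (y-nonNeg v′ P′) (≡-trans (cong (x +_) x′≡) (ℚ.+-inverseʳ x))
    at-axis : End₀ f τ (x , y) × (y ≡ 2ℚ ⊎ y ≡ 1ℚ)
    at-axis = on-vertical-axis f v P (proj₁ zeros)

  -- Opposite closed quadrants share only the origin, and no fan edge contains it.
  meet-opposite : ∀ f f′ {τ τ′ x y x′ y′} → Valid f τ → Valid f′ τ′ → Param f τ x y → Param f′ τ′ x′ y′ →
    x′ ≡ - x → y′ ≡ - y → ⊥
  meet-opposite f f′ {τ} {τ′} {x} {y} {x′} {y′} v v′ P P′ x′≡ y′≡ = nonzero (proj₂ (on-vertical-axis f v P
      (proj₁ (nonNeg-sum-zero x x′ (x-nonNeg v P) (x-nonNeg v′ P′) (≡-trans (cong (x +_) x′≡) (ℚ.+-inverseʳ x))))))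
      (proj₁ (nonNeg-sum-zero y y′ (y-nonNeg v P) (y-nonNeg v′ P′) (≡-trans (cong (y +_) y′≡) (ℚ.+-inverseʳ y))))
    where
    nonzero : y ≡ 2ℚ ⊎ y ≡ 1ℚ → y ≢ 0ℚ
    nonzero (inj₁ refl) ()
    nonzero (inj₂ refl) ()

  -- The four quadrants together, and straight-line drawings.

  rot unrot : Fin 4 → Point → Point
  rot 0F (x , y) = x , y
  rot 1F (x , y) = - y , x
  rot 2F (x , y) = - x , - y
  rot 3F (x , y) = y , - x
  unrot 0F (x , y) = x , y
  unrot 1F (x , y) = y , - x
  unrot 2F (x , y) = - x , - y
  unrot 3F (x , y) = - y , x

  neg-neg : ∀ x → - (- x) ≡ x
  neg-neg = solve-∀ ℚ-ring

  rot-unrot : ∀ j p → rot j (unrot j p) ≡ p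
  rot-unrot 0F (x , y) = refl
  rot-unrot 1F (x , y) = cong (_, y) (neg-neg x)
  rot-unrot 2F (x , y) = cong₂ _,_ (neg-neg x) (neg-neg y)
  rot-unrot 3F (x , y) = cong (x ,_) (neg-neg y)

  unrot-rot : ∀ j p → unrot j (rot j p) ≡ p
  unrot-rot 0F (x , y) = refl
  unrot-rot 1F (x , y) = cong (x ,_) (neg-neg y)
  unrot-rot 2F (x , y) = cong₂ _,_ (neg-neg x) (neg-neg y)
  unrot-rot 3F (x , y) = cong (_, y) (neg-neg x)

  onSeg-unrot : ∀ j p q r → OnSeg p q r → OnSeg (unrot j p) (unrot j q) (unrot j r)
  onSeg-unrot j (p₁ , p₂) (q₁ , q₂) (r₁ , r₂) (t , 0≤t , t≤1 , e₁ , e₂) = go j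
    where
    lem : ∀ p q t → - (p + t * (q - p)) ≡ - p + t * (- q - - p)
    lem = solve-∀ ℚ-ring
    neg : ∀ p q {r} → r ≡ p + t * (q - p) → - r ≡ - p + t * (- q - - p)
    neg p q eq = ≡-trans (cong -_ eq) (lem p q t)
    go : ∀ j → OnSeg (unrot j (p₁ , p₂)) (unrot j (q₁ , q₂)) (unrot j (r₁ , r₂))
    go 0F = t , 0≤t , t≤1 , e₁ , e₂
    go 1F = t , 0≤t , t≤1 , e₂ , neg p₁ q₁ e₁
    go 2F = t , 0≤t , t≤1 , neg p₁ q₁ e₁ , neg p₂ q₂ e₂
    go 3F = t , 0≤t , t≤1 , neg p₂ q₂ e₂ , e₁

  -- The name of one segment in a fixed configuration to which the edges of all layers belong.
  -- Planarity is thus checked once, in `meet`, and not for each layer.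
  record Key : Set where
    constructor key
    field
      quadrant : Fin 4
      fan      : Fan
      τ        : ℚ
      valid    : Valid fan τ

    apex tip : Point
    apex = rot quadrant (apex₀ fan)
    tip  = rot quadrant (tip₀ τ)

  open Key using (apex; tip)

  End : Key → Point → Set
  End κ p = p ≡ apex κ ⊎ p ≡ tip κ

  meet-base : ∀ j f {τ} j′ f′ {τ′} → Valid f τ → Valid f′ τ′ → ∀ x y →
    Param f τ (proj₁ (unrot j (x , y))) (proj₂ (unrot j (x , y))) →
    Param f′ τ′ (proj₁ (unrot j′ (x , y))) (proj₂ (unrot j′ (x , y))) →
    (j ≡ j′ × f ≡ f′ × τ ≡ τ′) ⊎ (End₀ f τ (unrot j (x , y)) × End₀ f′ τ′ (unrot j′ (x , y)))
  meet-base 0F f 0F f′ v v′ x y P P′ = map⊎ (refl ,_) id (meet-in-quadrant f f′ P P′)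
  meet-base 1F f 1F f′ v v′ x y P P′ = map⊎ (refl ,_) id (meet-in-quadrant f f′ P P′)
  meet-base 2F f 2F f′ v v′ x y P P′ = map⊎ (refl ,_) id (meet-in-quadrant f f′ P P′)
  meet-base 3F f 3F f′ v v′ x y P P′ = map⊎ (refl ,_) id (meet-in-quadrant f f′ P P′)
  meet-base 0F f 1F f′ v v′ x y P P′ = inj₂ (meet-adjacent f f′ v v′ P P′ refl)
  meet-base 1F f 2F f′ v v′ x y P P′ = inj₂ (meet-adjacent f f′ v v′ P P′ refl)
  meet-base 2F f 3F f′ v v′ x y P P′ = inj₂ (meet-adjacent f f′ v v′ P P′ (≡-sym (neg-neg x)))
  meet-base 3F f 0F f′ v v′ x y P P′ = inj₂ (meet-adjacent f f′ v v′ P P′ (≡-sym (neg-neg y)))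
  meet-base 1F f 0F f′ v v′ x y P P′ = inj₂ (swap (meet-adjacent f′ f v′ v P′ P refl))
  meet-base 2F f 1F f′ v v′ x y P P′ = inj₂ (swap (meet-adjacent f′ f v′ v P′ P refl))
  meet-base 3F f 2F f′ v v′ x y P P′ = inj₂ (swap (meet-adjacent f′ f v′ v P′ P (≡-sym (neg-neg x))))
  meet-base 0F f 3F f′ v v′ x y P P′ = inj₂ (swap (meet-adjacent f′ f v′ v P′ P (≡-sym (neg-neg y))))
  meet-base 0F f 2F f′ v v′ x y P P′ = ⊥-elim (meet-opposite f f′ v v′ P P′ refl refl)
  meet-base 2F f 0F f′ v v′ x y P P′ = ⊥-elim (meet-opposite f f′ v v′ P P′ (≡-sym (neg-neg x)) (≡-sym (neg-neg y)))
  meet-base 1F f 3F f′ v v′ x y P P′ = ⊥-elim (meet-opposite f f′ v v′ P P′ refl (≡-sym (neg-neg x)))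
  meet-base 3F f 1F f′ v v′ x y P P′ = ⊥-elim (meet-opposite f f′ v v′ P P′ (≡-sym (neg-neg y)) refl)

  meet : ∀ κ κ′ r → OnSeg (apex κ) (tip κ) r → OnSeg (apex κ′) (tip κ′) r →
    (apex κ ≡ apex κ′ × tip κ ≡ tip κ′) ⊎ (End κ r × End κ′ r)
  meet (key j f τ v) (key j′ f′ τ′ v′) r on on′
    = map⊎ (λ { (refl , refl , refl) → refl , refl }) (λ (e , e′) → back j f e , back j′ f′ e′)
        (meet-base j f j′ f′ v v′ (proj₁ r) (proj₂ r) (base j f on) (base j′ f′ on′))
    where
    base : ∀ j f {τ} → OnSeg (rot j (apex₀ f)) (rot j (tip₀ τ)) r →
      Param f τ (proj₁ (unrot j r)) (proj₂ (unrot j r))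
    base j f {τ} on = param f τ (proj₁ (unrot j r)) (proj₂ (unrot j r))
      (subst₂ (λ p q → OnSeg p q (unrot j r)) (unrot-rot j (apex₀ f)) (unrot-rot j (tip₀ τ))
        (onSeg-unrot j (rot j (apex₀ f)) (rot j (tip₀ τ)) r on))
    back : ∀ j f {τ} → End₀ f τ (unrot j r) → r ≡ rot j (apex₀ f) ⊎ r ≡ rot j (tip₀ τ)
    back j f = map⊎ (λ e → ≡-trans (≡-sym (rot-unrot j r)) (cong (rot j) e)) (λ e → ≡-trans (≡-sym (rot-unrot j r)) (cong (rot j) e))

  module _ {m : ℕ} (H : Graph m) (pos : Fin m → Point) (pos-injective : ∀ u v → pos u ≡ pos v → u ≡ v)
    (keyOf : ∀ u v → H u v ≡ true → Σ Key λ κ → (pos u ≡ apex κ × pos v ≡ tip κ) ⊎ (pos u ≡ tip κ × pos v ≡ apex κ))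
    (keyAt : ∀ w → Σ Key λ κ → End κ (pos w)) where

    private
      straight : ∀ p q → PolyArc p q
      straight p q = record
        { k = 0 ; pt = λ { zero → p ; (suc _) → q } ; start = refl ; end = refl
        ; simple = λ { zero zero _ () ; zero (suc ()) ; (suc ()) } }

      Matches : Key → Point → Point → Set
      Matches κ p q = (p ≡ apex κ × q ≡ tip κ) ⊎ (p ≡ tip κ × q ≡ apex κ)

      onKey : ∀ κ {p q r} → Matches κ p q → OnSeg p q r → OnSeg (apex κ) (tip κ) r
      onKey κ (inj₁ (refl , refl)) on = on
      onKey κ (inj₂ (refl , refl)) on = onSeg-sym (tip κ) (apex κ) on

      endOf : ∀ κ {p q r} → Matches κ p q → End κ r → r ≡ p ⊎ r ≡ q
      endOf κ (inj₁ (refl , refl)) e = e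
      endOf κ (inj₂ (refl , refl)) e = swap⊎ e

      onEnd : ∀ κ {r} → End κ r → OnSeg (apex κ) (tip κ) r
      onEnd κ (inj₁ refl) = onSeg-start (apex κ) (tip κ)
      onEnd κ (inj₂ refl) = onSeg-end (apex κ) (tip κ)

      onStraight : ∀ p q {r} → OnArc (straight p q) r → OnSeg p q r
      onStraight p q (zero , on) = on

      same-edge : ∀ {u v u′ v′} κ κ′ → apex κ ≡ apex κ′ × tip κ ≡ tip κ′ → Matches κ (pos u) (pos v) → Matches κ′ (pos u′) (pos v′) →
        toℕ u ℕ.< toℕ v → toℕ u′ ℕ.< toℕ v′ → u ≡ u′ × v ≡ v′
      same-edge κ κ′ (a≡ , t≡) (inj₁ (u≡ , v≡)) (inj₁ (u′≡ , v′≡)) _ _ =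
        pos-injective _ _ (≡-trans u≡ (≡-trans a≡ (≡-sym u′≡))) , pos-injective _ _ (≡-trans v≡ (≡-trans t≡ (≡-sym v′≡)))
      same-edge κ κ′ (a≡ , t≡) (inj₂ (u≡ , v≡)) (inj₂ (u′≡ , v′≡)) _ _ =
        pos-injective _ _ (≡-trans u≡ (≡-trans t≡ (≡-sym u′≡))) , pos-injective _ _ (≡-trans v≡ (≡-trans a≡ (≡-sym v′≡)))
      same-edge {u} {v} {u′} {v′} κ κ′ (a≡ , t≡) (inj₁ (u≡ , v≡)) (inj₂ (u′≡ , v′≡)) u<v u′<v′ =
        ⊥-elim (ℕ.<-asym u<v (subst₂ (λ a b → toℕ a ℕ.< toℕ b)
          (pos-injective u′ v (≡-trans u′≡ (≡-trans (≡-sym t≡) (≡-sym v≡))))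
          (pos-injective v′ u (≡-trans v′≡ (≡-trans (≡-sym a≡) (≡-sym u≡)))) u′<v′))
      same-edge {u} {v} {u′} {v′} κ κ′ (a≡ , t≡) (inj₂ (u≡ , v≡)) (inj₁ (u′≡ , v′≡)) u<v u′<v′ =
        ⊥-elim (ℕ.<-asym u<v (subst₂ (λ a b → toℕ a ℕ.< toℕ b)
          (pos-injective u′ v (≡-trans u′≡ (≡-trans (≡-sym a≡) (≡-sym v≡))))
          (pos-injective v′ u (≡-trans v′≡ (≡-trans (≡-sym t≡) (≡-sym u≡)))) u′<v′))

    straightDrawing : PlaneDrawing H
    straightDrawing = record
      { pos = pos
      ; pos-inj = pos-injective
      ; arc = λ u v _ _ → straight (pos u) (pos v)
      -- The vertex `w` is an end of some segment of the configuration, so a vertex on an edge is a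
      -- special case of two segments meeting.
      ; avoid-vertices = λ u v _ e w on →
          let (κ , μ)   = keyOf u v e
              (κ′ , end) = keyAt w
          in map⊎ (pos-injective w u) (pos-injective w v) (endOf κ μ
               (vertex-end κ κ′ end (meet κ κ′ (pos w) (onKey κ μ (onStraight (pos u) (pos v) on)) (onEnd κ′ end))))
      ; avoid-arcs = λ u v u<v e u′ v′ u′<v′ e′ r on on′ →
          let (κ , μ)   = keyOf u v e
              (κ′ , μ′) = keyOf u′ v′ e′
          in map⊎ (λ eq → same-edge κ κ′ eq μ μ′ u<v u′<v′) (λ (end , _) → endOf κ μ end)
               (meet κ κ′ r (onKey κ μ (onStraight (pos u) (pos v) on)) (onKey κ′ μ′ (onStraight (pos u′) (pos v′) on′)))
      }
      where
      vertex-end : ∀ κ κ′ {r} → End κ′ r → (apex κ ≡ apex κ′ × tip κ ≡ tip κ′) ⊎ (End κ r × End κ′ r) → End κ r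
      vertex-end κ κ′ end (inj₁ (a≡ , t≡)) = map⊎ (λ e → ≡-trans e (≡-sym a≡)) (λ e → ≡-trans e (≡-sym t≡)) end
      vertex-end κ κ′ end (inj₂ (e , _))   = e

  -- The cube of one group and the attachment of other vertices.

  Hub : Set
  Hub = Fan × Fin 4

  next : Fin 4 → Fin 4
  next 0F = 1F
  next 1F = 2F
  next 2F = 3F
  next 3F = 0F

  -- The cube K₄ × K₂ drawn as two nested squares; sector j lies between the spokes j and j + 1.
  hub : Fin 2 → Fin 4 → Hub
  hub 0F 1F = outer , 0F
  hub 1F 0F = outer , 1F
  hub 0F 2F = outer , 2F
  hub 1F 3F = outer , 3F
  hub 1F 2F = inner , 0F
  hub 0F 3F = inner , 1F
  hub 1F 1F = inner , 2F
  hub 0F 0F = inner , 3F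

  -- In binary, the sector depends on the high bit of the index on side 0 and on the low bit on side
  -- 1. Together with `hub` this links a vertex of side 0 to a hub of side 1 when its high bit
  -- equals the low bit of the hub, and a vertex of side 1 to a hub of side 0 when its low bit
  -- differs from the high bit of the hub. Of these conditions on a pair exactly one holds.
  sector : Fin 2 → Fin 4 → Fin 4
  sector 0F 0F = 0F
  sector 0F 1F = 0F
  sector 1F 0F = 1F
  sector 1F 2F = 1F
  sector 0F 2F = 2F
  sector 0F 3F = 2F
  sector 1F 1F = 3F
  sector 1F 3F = 3F

  -- The two hubs selected are the apexes of the outer and the inner fan in quadrant `k`.
  link : Hub → Fin 4 → Bool
  link (outer , j) k = does (j Fin.≟ next k)
  link (inner , j) k = does (j Fin.≟ k)

  hubPoint : Hub → Point
  hubPoint (outer , j) = rot j (2ℚ , 0ℚ)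
  hubPoint (inner , j) = rot j (1ℚ , 0ℚ)

  Joins : Point → Point → Set
  Joins p q = Σ Key λ κ → (p ≡ apex κ × q ≡ tip κ) ⊎ (p ≡ tip κ × q ≡ apex κ)

  Joins-sym : ∀ {p q} → Joins p q → Joins q p
  Joins-sym (κ , inj₁ (a , b)) = κ , inj₂ (b , a)
  Joins-sym (κ , inj₂ (a , b)) = κ , inj₁ (b , a)

  0≤1 : 0ℚ ≤ 1ℚ
  0≤1 = ℚ.nonNegative⁻¹ 1ℚ

  outer-side inner-side spoke : Fin 4 → Key
  outer-side j = key j outer 0ℚ (ℚ.≤-refl , ℚ.positive⁻¹ 1ℚ)
  inner-side j = key j inner 1ℚ (0≤1 , ℚ.≤-refl)
  spoke      j = key j inner 0ℚ (ℚ.≤-refl , 0≤1)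

  cube-edge : ∀ i i′ → i ≢ i′ → Joins (hubPoint (hub 0F i)) (hubPoint (hub 1F i′))
  cube-edge 0F 1F _ = inner-side 2F , inj₂ (refl , refl)
  cube-edge 0F 2F _ = inner-side 3F , inj₁ (refl , refl)
  cube-edge 0F 3F _ = spoke 3F      , inj₁ (refl , refl)
  cube-edge 1F 0F _ = outer-side 0F , inj₂ (refl , refl)
  cube-edge 1F 2F _ = spoke 0F      , inj₂ (refl , refl)
  cube-edge 1F 3F _ = outer-side 3F , inj₁ (refl , refl)
  cube-edge 2F 0F _ = outer-side 1F , inj₁ (refl , refl)
  cube-edge 2F 1F _ = spoke 2F      , inj₂ (refl , refl)
  cube-edge 2F 3F _ = outer-side 2F , inj₂ (refl , refl)
  cube-edge 3F 0F _ = spoke 1F      , inj₁ (refl , refl)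
  cube-edge 3F 1F _ = inner-side 1F , inj₁ (refl , refl)
  cube-edge 3F 2F _ = inner-side 0F , inj₂ (refl , refl)
  cube-edge 0F 0F i≢i = ⊥-elim (i≢i refl)
  cube-edge 1F 1F i≢i = ⊥-elim (i≢i refl)
  cube-edge 2F 2F i≢i = ⊥-elim (i≢i refl)
  cube-edge 3F 3F i≢i = ⊥-elim (i≢i refl)

  hubs-join : ∀ h i h′ i′ → h ≢ h′ → i ≢ i′ → Joins (hubPoint (hub h i)) (hubPoint (hub h′ i′))
  hubs-join 0F i 1F i′ _ i≢i′ = cube-edge i i′ i≢i′
  hubs-join 1F i 0F i′ _ i≢i′ = Joins-sym (cube-edge i′ i (i≢i′ ∘ ≡-sym))
  hubs-join 0F _ 0F _ h≢h _ = ⊥-elim (h≢h refl)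
  hubs-join 1F _ 1F _ h≢h _ = ⊥-elim (h≢h refl)

  outer-hub : ∀ j → hubPoint (outer , next j) ≡ rot j (apex₀ outer)
  outer-hub 0F = refl
  outer-hub 1F = refl
  outer-hub 2F = refl
  outer-hub 3F = refl

  link-joins : ∀ x j {τ} → 0ℚ < τ → τ < 1ℚ → link x j ≡ true → Joins (hubPoint x) (rot j (tip₀ τ))
  link-joins (outer , j′) j {τ} 0<τ τ<1 h = key j outer τ (ℚ.<⇒≤ 0<τ , τ<1) ,
    inj₁ (≡-trans (cong (λ k → hubPoint (outer , k)) (does-true (j′ Fin.≟ next j) h)) (outer-hub j) , refl)
  link-joins (inner , j′) j {τ} 0<τ τ<1 h = key j inner τ (ℚ.<⇒≤ 0<τ , ℚ.<⇒≤ τ<1) ,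
    inj₁ (cong (λ k → hubPoint (inner , k)) (does-true (j′ Fin.≟ j) h) , refl)

  hub-key : ∀ x → Σ Key λ κ → End κ (hubPoint x)
  hub-key (outer , 0F) = spoke 0F , inj₂ refl
  hub-key (outer , 1F) = spoke 1F , inj₂ refl
  hub-key (outer , 2F) = spoke 2F , inj₂ refl
  hub-key (outer , 3F) = spoke 3F , inj₂ refl
  hub-key (inner , j)  = spoke j , inj₁ refl

  hubPoint-injective : ∀ h i h′ i′ → hubPoint (hub h i) ≡ hubPoint (hub h′ i′) → h ≡ h′ × i ≡ i′
  hubPoint-injective = from-yes (Fin.all? λ h → Fin.all? λ i → Fin.all? λ h′ → Fin.all? λ i′ →
    (hubPoint (hub h i) ≟P hubPoint (hub h′ i′)) →-dec ((h Fin.≟ h′) ×-dec (i Fin.≟ i′)))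

  -- Even sectors hold side 0 and odd sectors side 1. This keeps apart the two copies of a vertex,
  -- which share the same τ.
  sector-side : ∀ h i h′ i′ → sector h i ≡ sector h′ i′ → h ≡ h′
  sector-side = from-yes (Fin.all? λ h → Fin.all? λ i → Fin.all? λ h′ → Fin.all? λ i′ →
    (sector h i Fin.≟ sector h′ i′) →-dec (h Fin.≟ h′))

  -- Two vertices of different groups are joined in the layer of one group or of the other.
  link-covers : ∀ h i h′ i′ → h ≢ h′ → link (hub h i) (sector h′ i′) ≡ true ⊎ link (hub h′ i′) (sector h i) ≡ true
  link-covers = from-yes (Fin.all? λ h → Fin.all? λ i → Fin.all? λ h′ → Fin.all? λ i′ →
    ¬? (h Fin.≟ h′) →-dec ((link (hub h i) (sector h′ i′) 𝔹.≟ true) ⊎-dec (link (hub h′ i′) (sector h i) 𝔹.≟ true)))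

  on-axis : ∀ x → proj₁ (hubPoint x) ≡ 0ℚ ⊎ proj₂ (hubPoint x) ≡ 0ℚ
  on-axis (outer , 0F) = inj₂ refl
  on-axis (outer , 1F) = inj₁ refl
  on-axis (outer , 2F) = inj₂ refl
  on-axis (outer , 3F) = inj₁ refl
  on-axis (inner , 0F) = inj₂ refl
  on-axis (inner , 1F) = inj₁ refl
  on-axis (inner , 2F) = inj₂ refl
  on-axis (inner , 3F) = inj₁ refl

  off-axis : ∀ j a b → a ≢ 0ℚ → b ≢ 0ℚ → ¬ (proj₁ (rot j (a , b)) ≡ 0ℚ ⊎ proj₂ (rot j (a , b)) ≡ 0ℚ)
  off-axis 0F a b a≢0 b≢0 = λ { (inj₁ e) → a≢0 e ; (inj₂ e) → b≢0 e }
  off-axis 1F a b a≢0 b≢0 = λ { (inj₁ e) → b≢0 (ℚ.neg-injective e) ; (inj₂ e) → a≢0 e }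
  off-axis 2F a b a≢0 b≢0 = λ { (inj₁ e) → a≢0 (ℚ.neg-injective e) ; (inj₂ e) → b≢0 (ℚ.neg-injective e) }
  off-axis 3F a b a≢0 b≢0 = λ { (inj₁ e) → b≢0 e ; (inj₂ e) → a≢0 (ℚ.neg-injective e) }

  pos≢neg : ∀ {a b} → 0ℚ < a → 0ℚ < b → a ≢ - b
  pos≢neg 0<a 0<b eq = ℚ.<-asym 0<a (subst (_< 0ℚ) (≡-sym eq) (ℚ.neg-antimono-< 0<b))

  quadrant-unique : ∀ j j′ {a b a′ b′} → 0ℚ < a → 0ℚ < b → 0ℚ < a′ → 0ℚ < b′ → rot j (a , b) ≡ rot j′ (a′ , b′) → j ≡ j′
  quadrant-unique 0F 0F _ _ _ _ _ = refl
  quadrant-unique 1F 1F _ _ _ _ _ = refl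
  quadrant-unique 2F 2F _ _ _ _ _ = refl
  quadrant-unique 3F 3F _ _ _ _ _ = refl
  quadrant-unique 0F 1F a b a′ b′ e = ⊥-elim (pos≢neg a b′ (cong proj₁ e))
  quadrant-unique 0F 2F a b a′ b′ e = ⊥-elim (pos≢neg a a′ (cong proj₁ e))
  quadrant-unique 0F 3F a b a′ b′ e = ⊥-elim (pos≢neg b a′ (cong proj₂ e))
  quadrant-unique 1F 2F a b a′ b′ e = ⊥-elim (pos≢neg a b′ (cong proj₂ e))
  quadrant-unique 1F 3F a b a′ b′ e = ⊥-elim (pos≢neg a a′ (cong proj₂ e))
  quadrant-unique 2F 3F a b a′ b′ e = ⊥-elim (pos≢neg b′ a (≡-sym (cong proj₁ e)))
  quadrant-unique 1F 0F a b a′ b′ e = ⊥-elim (pos≢neg a′ b (≡-sym (cong proj₁ e)))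
  quadrant-unique 2F 0F a b a′ b′ e = ⊥-elim (pos≢neg a′ a (≡-sym (cong proj₁ e)))
  quadrant-unique 3F 0F a b a′ b′ e = ⊥-elim (pos≢neg b′ a (≡-sym (cong proj₂ e)))
  quadrant-unique 2F 1F a b a′ b′ e = ⊥-elim (pos≢neg a′ b (≡-sym (cong proj₂ e)))
  quadrant-unique 3F 1F a b a′ b′ e = ⊥-elim (pos≢neg a′ a (≡-sym (cong proj₂ e)))
  quadrant-unique 3F 2F a b a′ b′ e = ⊥-elim (pos≢neg b a′ (cong proj₁ e))

  tip₀-pos : ∀ {τ} → τ < 1ℚ → 0ℚ < 2ℚ * (1ℚ - τ)
  tip₀-pos {τ} τ<1 = *-pos {2ℚ} {1ℚ - τ} (ℚ.positive⁻¹ 2ℚ) (0<q-p τ<1)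

  hub≢outsider : ∀ x j {τ} → 0ℚ < τ → τ < 1ℚ → hubPoint x ≢ rot j (tip₀ τ)
  hub≢outsider x j {τ} 0<τ τ<1 eq = off-axis j (2ℚ * (1ℚ - τ)) τ
    (λ e → ℚ.<-irrefl (≡-sym e) (tip₀-pos τ<1)) (λ e → ℚ.<-irrefl (≡-sym e) 0<τ)
    (subst (λ p → proj₁ p ≡ 0ℚ ⊎ proj₂ p ≡ 0ℚ) eq (on-axis x))

  outsiders-injective : ∀ j j′ {τ τ′} → 0ℚ < τ → τ < 1ℚ → 0ℚ < τ′ → τ′ < 1ℚ →
    rot j (tip₀ τ) ≡ rot j′ (tip₀ τ′) → j ≡ j′ × τ ≡ τ′
  outsiders-injective j j′ {τ} {τ′} 0<τ τ<1 0<τ′ τ′<1 eq =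
    j≡j′ , cong proj₂ (≡-trans (≡-sym (unrot-rot j (tip₀ τ)))
      (≡-trans (cong (unrot j) (≡-trans eq (cong (λ k → rot k (tip₀ τ′)) (≡-sym j≡j′)))) (unrot-rot j (tip₀ τ′))))
    where
    j≡j′ : j ≡ j′
    j≡j′ = quadrant-unique j j′ (tip₀-pos τ<1) 0<τ (tip₀-pos τ′<1) 0<τ′ eq

  -- The fraction 1/(g + 2): strictly between 0 and 1, hence off the axes with the hubs, and in
  -- lowest terms, so that the denominator reveals `g`.
  τ : ℕ → ℚ
  τ g = mkℚ (ℤ.+ 1) (suc g) (1-coprimeTo (suc (suc g)))

  0<τ : ∀ g → 0ℚ < τ g
  0<τ g = ℚ.positive⁻¹ (τ g)

  τ<1 : ∀ g → τ g < 1ℚ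
  τ<1 g = ℚ.*<* (ℤ.+<+ (s≤s (s≤s z≤n)))

  τ-injective : ∀ g g′ → τ g ≡ τ g′ → g ≡ g′
  τ-injective g g′ eq = ℕ.suc-injective (cong ℚ.denominator-1 eq)

  -- The layers of the decomposition.

  module Layers {n : ℕ} (G : Graph n) (simple : IsSimple G) where
    open IsSimple simple

    vertex : Fin (n ℕ.* 2) → Fin n
    vertex x = proj₁ (remQuot {n} 2 x)

    side : Fin (n ℕ.* 2) → Fin 2
    side x = proj₂ (remQuot {n} 2 x)

    index : Fin (n ℕ.* 2) → Fin 4
    index x = fromℕ< (m%n<n (toℕ (vertex x)) 4)

    group : Fin (n ℕ.* 2) → ℕ
    group x = toℕ (vertex x) / 4

    vertex≡ : ∀ x y → group x ≡ group y → index x ≡ index y → vertex x ≡ vertex y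
    vertex≡ x y g≡ i≡ = toℕ-injective (≡-trans (m≡m%n+[m/n]*n (toℕ (vertex x)) 4)
      (≡-trans (cong₂ (λ r q → r ℕ.+ q ℕ.* 4) r≡ g≡) (≡-sym (m≡m%n+[m/n]*n (toℕ (vertex y)) 4))))
      where
      r≡ : toℕ (vertex x) % 4 ≡ toℕ (vertex y) % 4
      r≡ = ≡-trans (≡-sym (toℕ-fromℕ< _)) (≡-trans (cong toℕ i≡) (toℕ-fromℕ< _))

    x≡ : ∀ x y → vertex x ≡ vertex y → side x ≡ side y → x ≡ y
    x≡ x y v≡ s≡ = ≡-trans (≡-sym (combine-remQuot {n} 2 x)) (≡-trans (cong₂ combine v≡ s≡) (combine-remQuot {n} 2 y))

    P : Graph (n ℕ.* 2)
    P = G ×ₖ K 2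

    K₂-≢ : ∀ (h h′ : Fin 2) → K 2 h h′ ≡ true → h ≢ h′
    K₂-≢ 0F .0F () refl
    K₂-≢ 1F .1F () refl

    K₂-sym : ∀ (h h′ : Fin 2) → K 2 h h′ ≡ K 2 h′ h
    K₂-sym 0F 0F = refl
    K₂-sym 0F 1F = refl
    K₂-sym 1F 0F = refl
    K₂-sym 1F 1F = refl

    adjacent-sides : ∀ x y → P x y ≡ true → side x ≢ side y
    adjacent-sides x y e = K₂-≢ (side x) (side y) (proj₂ (∧-true {G (vertex x) (vertex y)} e))

    adjacent-vertices : ∀ x y → P x y ≡ true → vertex x ≢ vertex y
    adjacent-vertices x y e v≡ = true≢false (≡-trans (≡-sym (proj₁ (∧-true {G (vertex x) (vertex y)} e)))
      (≡-trans (cong (G (vertex x)) (≡-sym v≡)) (irrefl (vertex x))))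

    module Layer (c : ℕ) where

      central? : ∀ x → Dec (group x ≡ c)
      central? x = group x ℕ.≟ c

      hubOf : Fin (n ℕ.* 2) → Hub
      hubOf x = hub (side x) (index x)

      sectorOf : Fin (n ℕ.* 2) → Fin 4
      sectorOf x = sector (side x) (index x)

      place : ∀ x → Dec (group x ≡ c) → Point
      place x (yes _) = hubPoint (hubOf x)
      place x (no _)  = rot (sectorOf x) (tip₀ (τ (toℕ (vertex x))))

      pos : Fin (n ℕ.* 2) → Point
      pos x = place x (central? x)

      present : ∀ x y → Dec (group x ≡ c) → Dec (group y ≡ c) → Bool
      present x y (yes _) (yes _) = true
      present x y (yes _) (no _)  = link (hubOf x) (sectorOf y)
      present x y (no _)  (yes _) = link (hubOf y) (sectorOf x)
      present x y (no _)  (no _)  = false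

      layer : Graph (n ℕ.* 2)
      layer x y = P x y ∧ present x y (central? x) (central? y)

      present-sym : ∀ x y d d′ → present x y d d′ ≡ present y x d′ d
      present-sym x y (yes _) (yes _) = refl
      present-sym x y (yes _) (no _)  = refl
      present-sym x y (no _)  (yes _) = refl
      present-sym x y (no _)  (no _)  = refl

      layer-simple : IsSimple layer
      layer-simple = record
        { sym    = λ x y → cong₂ _∧_ (cong₂ _∧_ (sym (vertex x) (vertex y)) (K₂-sym (side x) (side y)))
                                     (present-sym x y (central? x) (central? y))
        ; irrefl = λ x → cong (λ b → (b ∧ K 2 (side x) (side x)) ∧ present x x (central? x) (central? x)) (irrefl (vertex x))
        }

      place-injective : ∀ x y d d′ → place x d ≡ place y d′ → x ≡ y
      place-injective x y (yes gx) (yes gy) eq =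
        let (s≡ , i≡) = hubPoint-injective (side x) (index x) (side y) (index y) eq
        in x≡ x y (vertex≡ x y (≡-trans gx (≡-sym gy)) i≡) s≡
      place-injective x y (yes _) (no _) eq = ⊥-elim (hub≢outsider (hubOf x) (sectorOf y) (0<τ _) (τ<1 _) eq)
      place-injective x y (no _) (yes _) eq = ⊥-elim (hub≢outsider (hubOf y) (sectorOf x) (0<τ _) (τ<1 _) (≡-sym eq))
      place-injective x y (no _) (no _) eq =
        let (j≡ , τ≡) = outsiders-injective (sectorOf x) (sectorOf y) (0<τ _) (τ<1 _) (0<τ _) (τ<1 _) eq
        in x≡ x y (toℕ-injective (τ-injective _ _ τ≡)) (sector-side (side x) (index x) (side y) (index y) j≡)

      place-joins : ∀ x y d d′ → P x y ≡ true → present x y d d′ ≡ true → Joins (place x d) (place y d′)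
      place-joins x y (yes gx) (yes gy) e _ = hubs-join (side x) (index x) (side y) (index y) (adjacent-sides x y e)
        (λ i≡ → adjacent-vertices x y e (vertex≡ x y (≡-trans gx (≡-sym gy)) i≡))
      place-joins x y (yes _) (no _) _ l = link-joins (hubOf x) (sectorOf y) (0<τ _) (τ<1 _) l
      place-joins x y (no _) (yes _) _ l = Joins-sym (link-joins (hubOf y) (sectorOf x) (0<τ _) (τ<1 _) l)

      place-key : ∀ x d → Σ Key λ κ → End κ (place x d)
      place-key x (yes _) = hub-key (hubOf x)
      -- An outsider is the tip of an inner fan segment of the configuration, whether or not the
      -- layer has an edge along it.
      place-key x (no _)  = key (sectorOf x) inner (τ g) (ℚ.<⇒≤ (0<τ g) , ℚ.<⇒≤ (τ<1 g)) , inj₂ refl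
        where g = toℕ (vertex x)

      layer-planar : Planar layer
      layer-planar = straightDrawing layer pos (λ u v → place-injective u v (central? u) (central? v))
        (λ u v e → let (p , l) = ∧-true {P u v} e in place-joins u v (central? u) (central? v) p l)
        (λ w → place-key w (central? w))

      layer-both : ∀ x y → P x y ≡ true → group x ≡ c → group y ≡ c → layer x y ≡ true
      layer-both x y e gx gy = cong₂ _∧_ e (go (central? x) (central? y))
        where
        go : ∀ d d′ → present x y d d′ ≡ true
        go (yes _) (yes _) = refl
        go (yes _) (no ¬g) = ⊥-elim (¬g gy)
        go (no ¬g) _       = ⊥-elim (¬g gx)

      layer-link : ∀ x y → P x y ≡ true → group x ≡ c → group y ≢ c → link (hubOf x) (sectorOf y) ≡ true → layer x y ≡ true
      layer-link x y e gx gy l = cong₂ _∧_ e (go (central? x) (central? y))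
        where
        go : ∀ d d′ → present x y d d′ ≡ true
        go (yes _) (yes g) = ⊥-elim (gy g)
        go (yes _) (no _)  = l
        go (no ¬g) _       = ⊥-elim (¬g gx)

    open Layer

    ∈-some-layer : ∀ x y → P x y ≡ true → layer (group x) x y ≡ true ⊎ layer (group y) x y ≡ true
    ∈-some-layer x y e = by-groups (group x ℕ.≟ group y)
      where
      P-sym : ∀ x y → P x y ≡ P y x
      P-sym x y = cong₂ _∧_ (sym (vertex x) (vertex y)) (K₂-sym (side x) (side y))
      by-groups : Dec (group x ≡ group y) → layer (group x) x y ≡ true ⊎ layer (group y) x y ≡ true
      by-groups (yes g≡) = inj₁ (layer-both (group x) x y e refl (≡-sym g≡))
      by-groups (no g≢)  = map⊎
        (layer-link (group x) x y e refl (g≢ ∘ ≡-sym))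
        (λ l → ≡-trans (IsSimple.sym (layer-simple (group y)) x y) (layer-link (group y) y x (≡-trans (P-sym y x) e) refl g≢ l))
        (link-covers (side x) (index x) (side y) (index y) (adjacent-sides x y e))

    group< : ∀ x → group x ℕ.< ⌈ n / 4 ⌉
    group< x = m<n*o⇒m/o<n (ℕ.<-≤-trans (toℕ<n (vertex x)) n≤)
      where
      open ℕ.≤-Reasoning
      n≤ : n ℕ.≤ ⌈ n / 4 ⌉ ℕ.* 4
      -- Rounding up adds 3 before the division, and the remainder modulo 4 takes back at most 3.
      n≤ = ℕ.+-cancelˡ-≤ 3 n (⌈ n / 4 ⌉ ℕ.* 4) (begin
        3 ℕ.+ n                                  ≡⟨ ℕ.+-comm 3 n ⟩
        n ℕ.+ 3                                  ≡⟨ m≡m%n+[m/n]*n (n ℕ.+ 3) 4 ⟩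
        (n ℕ.+ 3) % 4 ℕ.+ ⌈ n / 4 ⌉ ℕ.* 4        ≤⟨ ℕ.+-monoˡ-≤ (⌈ n / 4 ⌉ ℕ.* 4) (ℕ.s≤s⁻¹ (m%n<n (n ℕ.+ 3) 4)) ⟩
        3 ℕ.+ ⌈ n / 4 ⌉ ℕ.* 4                    ∎)

    thickness-upper : Decomposition ⌈ n / 4 ⌉ P
    thickness-upper =
      (λ c → layer (toℕ c)) , (λ c → layer-simple (toℕ c)) , (λ c → layer-planar (toℕ c)) ,
      (λ c u v h → proj₁ (∧-true {P u v} h)) , covers
      where
      layerAt : ∀ x {u v} → layer (group x) u v ≡ true → ∃ λ (c : Fin ⌈ n / 4 ⌉) → layer (toℕ c) u v ≡ true
      layerAt x {u} {v} h = fromℕ< (group< x) , subst (λ g → layer g u v ≡ true) (≡-sym (toℕ-fromℕ< (group< x))) h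
      covers : ∀ u v → P u v ≡ true → ∃ λ (c : Fin ⌈ n / 4 ⌉) → layer (toℕ c) u v ≡ true
      covers u v e with ∈-some-layer u v e
      ... | inj₁ h = layerAt u h
      ... | inj₂ h = layerAt v h

open import Data.Nat using (_≤_; _*_; _∸_)

theorem3p4 : (n : ℕ) → 2 ≤ n → (G : Graph n) → IsSimple G →
    ((k : ℕ) → Decomposition k (G ×ₖ K 2) → ⌈ numEdges G / 2 * n ∸ 2 ⌉ ≤ k)
    × Decomposition ⌈ n / 4 ⌉ (G ×ₖ K 2)
theorem3p4 n 2≤n G simple = thickness-lower 2≤n G simple , Layers.thickness-upper G simple
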